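{- There are constants $0<\lambda_0<\infty$ and $0<\varepsilon_0<1$ such that for $p=\frac1{2n}(1+\varepsilon)=\frac1{2n}(1+\lambda_n n^{ -1/3})$ with $\lambda_0\le|\lambda_n|\le\varepsilon_0n^{1/3}$, and all strictly distinct literals $x,y$: (i) if $\varepsilon<0$, \[ \Pr\big(x\underset{F_{n,p}}{\rightsquigarrow}\overline x\big)\Pr\big(y\underset{F_{n,p}}{\rightsquigarrow}\overline y\big)\le\Pr\big(x\underset{F_{n,p}}{\rightsquigarrow}\overline x\text{ and }y\underset{F_{n,p}}{\rightsquigarrow}\overline y\big)=O\Big(\frac{n^{ -2/3}}{\lambda_n^4}\Big); \] (ii) if $\varepsilon>0$, \[ 0\le\Pr\big(x\underset{F_{n,p}}{\rightsquigarrow}\overline x\text{ and }y\underset{F_{n,p}}{\rightsquigarrow}\overline y\big)-\Pr\big(x\underset{F_{n,p}}{\rightsquigarrow}\overline x\big)\Pr\big(y\underset{F_{n,p}}{\rightsquigarrow}\overline y\big)=O\Big(\frac{n^{ -2/3}}{\lambda_n}\Big). \]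
   Context: Variables $x_1,\dots,x_n$, literals $x_i,\overline x_i$; literals $u,v$ are strictly distinct if $u\ne v$ and $u\ne\overline v$. A 2-clause is $u\vee v$ with $u,v$ strictly distinct, $u\vee v=v\vee u$. $F_{n,p}$ contains each of the $4\binom n2$ clauses independently with probability $p$. The digraph $D_F$ on the literals has an edge $x\to y$ iff $\overline x\vee y$ is a clause of $F$; $x\underset{F}{\rightsquigarrow}y$ means a directed path from $x$ to $y$ in $D_F$. $O(g)$ means bounded by a universal constant times $|g|$.
   Formalization: The parameter ε (so that λ_n = ε n^{1/3} and p = (1+ε)/(2n)) is taken to range over rational numbers instead of real numbers. -}

module Defs where

open import Data.Bool using (Bool; true; false; not; if_then_else_)
open import Data.Nat as ℕ using (ℕ; zero; suc)
import Data.Nat.Properties as ℕP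
open import Data.Fin using (Fin; toℕ)
open import Data.List using (List; []; _∷_; concatMap; map; filter)
open import Data.List.Relation.Unary.Any using (Any)
open import Data.Fin.Base using ()
open import Data.List using ()
open import Data.Product using (_×_; _,_; proj₁; proj₂)
open import Data.Sum using (_⊎_)
open import Data.Rational using (ℚ; 0ℚ; 1ℚ; _+_; _*_; _-_)
open import Relation.Binary.PropositionalEquality using (_≡_; _≢_)
open import Relation.Binary.Construct.Closure.ReflexiveTransitive using (Star)
open import Relation.Nullary using (Dec; does)
open import Relation.Nullary.Decidable using (_×-dec_)
import Data.List as L

-- Literals over variables x_0..x_{n-1}: (i , true) is x_i, (i , false) is ¬x_i.
Literal : ℕ → Set
Literal n = Fin n × Bool

neg : ∀ {n} → Literal n → Literal n
neg (i , b) = (i , not b)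

-- u, v strictly distinct: u ≠ v and u ≠ ¬v, i.e. different variables.
StrictlyDistinct : ∀ {n} → Literal n → Literal n → Set
StrictlyDistinct u v = proj₁ u ≢ proj₁ v

-- A 2-clause u ∨ v, stored as an (unordered) pair of literals.
Clause : ℕ → Set
Clause n = Literal n × Literal n

Joins : ∀ {n} → Clause n → Literal n → Literal n → Set
Joins (a , b) u v = (a ≡ u × b ≡ v) ⊎ (a ≡ v × b ≡ u)

-- All 4 * (n choose 2) clauses, each exactly once: pairs (i,a),(j,b) with i < j.
allClauses : (n : ℕ) → List (Clause n)
allClauses n =
  concatMap (λ ij → map (λ ab → ((proj₁ ij , proj₁ ab) , (proj₂ ij , proj₂ ab)))
                        ((true , true) ∷ (true , false) ∷ (false , true) ∷ (false , false) ∷ []))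
    (filter (λ ij → toℕ (proj₁ ij) ℕ.<? toℕ (proj₂ ij))
      (L.cartesianProduct (L.allFin n) (L.allFin n)))

Formula : ℕ → Set
Formula n = List (Clause n)

Edge : ∀ {n} → Formula n → Literal n → Literal n → Set
Edge F x y = Any (λ c → Joins c (neg x) y) F

Reach : ∀ {n} → Formula n → Literal n → Literal n → Set
Reach F = Star (Edge F)

Expect : ∀ {n} → ℚ → List (Clause n) → (Formula n → ℚ) → ℚ
Expect p [] f = f []
Expect p (c ∷ cs) f = p * Expect p cs (λ S → f (c ∷ S)) + (1ℚ - p) * Expect p cs f

indicator : ∀ {P : Set} → Dec P → ℚ
indicator d = if does d then 1ℚ else 0ℚ

Pr : (n : ℕ) → ℚ → (ev : Formula n → Set) → ((F : Formula n) → Dec (ev F)) → ℚ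
Pr n p ev dec = Expect p (allClauses n) (λ F → indicator (dec F))

both : ∀ {n} {A B : Formula n → Set} → (∀ F → Dec (A F)) → (∀ F → Dec (B F)) →
       ∀ F → Dec (A F × B F)
both da db F = da F ×-dec db F

_^ℚ_ : ℚ → ℕ → ℚ
q ^ℚ zero = 1ℚ
q ^ℚ suc k = q * (q ^ℚ k)

-- Explore the literals reachable from x one at a time. As long as no contradiction appears, the state is described by
-- the number m of unexplored variables and the number a of active literals, so the probability that x does not reach
-- its negation is a number ρ(n - 1) defined by a recursion in (m , a). Exploring x after y, in what y left untouched,
-- bounds the covariance by the mean of ρ(n - 1 - W) - ρ(n - 1), where W is the number of literals reached from y and
-- runs with a contradiction do not count. Setting one variable aside shows that
-- ρ(k) - ρ(k + 1) ≤ 2 p (1 - ρ) E[W] + p² E[W²].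
-- With δ = |ε| / 16, supersolutions of the recursion built from exponentials θ^a give E[δ² W + δ⁴ W²] = O(δ) on both
-- sides of the transition, and 1 - ρ is O(δ) above it and O(p / δ²) below it; the bounds follow. Above the transition
-- the tilt θ must relax as variables are used up, because explorations of order δ n literals turn subcritical.

module Submission where

open import Defs
open import Data.Bool using (Bool; true; false; not; if_then_else_)
import Data.Bool.Properties as 𝔹ₚ
open import Data.Empty using (⊥)
open import Data.Fin as Fin using (Fin; toℕ)
import Data.Fin.Properties as Finₚ
open import Data.Integer as ℤ using (+_)
import Data.Integer.Properties as ℤₚ
open import Data.List as List using (List; []; _∷_; length)
open import Data.List.Membership.DecPropositional using () renaming (_∈?_ to member?)
open import Data.List.Membership.Propositional using (_∈_; find; lose)
open import Data.List.Membership.Propositional.Properties using (∈-cartesianProductWith⁺; ∈-cartesianProductWith⁻; ∈-cartesianProduct⁺; ∈-filter⁺; ∈-filter⁻; ∈-allFin)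
import Data.List.Properties as Listₚ
open import Data.List.Relation.Unary.All as All using (All; []; _∷_)
open import Data.List.Relation.Unary.AllPairs using ([]; _∷_)
open import Data.List.Relation.Unary.Any using (here; there)
open import Data.List.Relation.Unary.Unique.Propositional using (Unique)
import Data.List.Relation.Unary.Unique.Propositional.Properties as Uniqueₚ
open import Data.Nat as ℕ using (ℕ; zero; suc; NonZero)
import Data.Nat.Properties as ℕₚ
open import Data.Product using (_×_; Σ; _,_; proj₁; proj₂)
open import Data.Product.Properties using () renaming (≡-dec to ×-≡-dec)
open import Data.Rational as ℚ using (ℚ; 0ℚ; 1ℚ; ½; _+_; _*_; _-_; -_; _/_; _≤_; _<_; ∣_∣; _⊔_; _≤?_; nonNegative; positive)
open import Data.Rational.Properties
import Data.Rational.Unnormalised as ℚᵘ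
import Data.Rational.Unnormalised.Properties as ℚᵘₚ
open import Data.Sum as Sum using (_⊎_; inj₁; inj₂; [_,_]′)
open import Data.Unit using (⊤; tt)
open import Function using (_∘_)
open import Relation.Binary.Construct.Closure.ReflexiveTransitive as Star using (Star; _◅_; _◅◅_) renaming (ε to nil)
open import Relation.Binary.Definitions using (tri<; tri≈; tri>)
open import Relation.Binary.PropositionalEquality
open import Relation.Nullary using (Dec; yes; no; ¬_; ¬?; does; contradiction; _×-dec_; _⊎-dec_)
open import Relation.Nullary.Decidable using (True; toWitness; dec⇒maybe; dec-true; dec-false)
open import Tactic.RingSolver using (solve-∀)
open import Tactic.RingSolver.Core.AlmostCommutativeRing using (AlmostCommutativeRing; fromCommutativeRing)

-- The weights δ² and δ⁴ reflect the size of an exploration: it is usually short, but with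
-- probability of order δ it processes about 1/δ² literals, so E[W] is of order 1/δ and E[W²] of
-- order 1/δ³. The hypothesis on λ reads 1 ≤ δ³ n, hence p ≤ δ³. Above the transition p δ E[W] and
-- p² E[W²] are therefore O(p): one variable more or less changes ρ by O(p), and the covariance is
-- O(p) (E[W] + 1) = O(p/δ). Below it, a variable changes ρ by O(p²/δ³) only, and the covariance is
-- O(p²/δ⁴), which is also the order of the bound for the product of the two probabilities. Long
-- runs above the transition cannot simply be cut off, since δ³ n may be of order 1. They are handed
-- to a second supersolution; the handover happens after order δ n steps, and δ³ n ≥ 1 makes the
-- value found there a multiple of δ² i + δ⁴ i², which the first supersolution can absorb.

ringℚ : AlmostCommutativeRing _ _
ringℚ = fromCommutativeRing +-*-commutativeRing λ x → dec⇒maybe (0ℚ ≟ x)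

-- Inequalities between rationals

infixl 6 _⊕_
infixl 7 _⊗_

_⊕_ : ∀ {x y} → 0ℚ ≤ x → 0ℚ ≤ y → 0ℚ ≤ x + y
_⊕_ {x} {y} p q = subst (_≤ x + y) (+-identityˡ 0ℚ) (+-mono-≤ p q)

_⊗_ : ∀ {x y} → 0ℚ ≤ x → 0ℚ ≤ y → 0ℚ ≤ x * y
_⊗_ {x} {y} p q = subst (_≤ x * y) (*-zeroʳ x) (*-monoˡ-≤-nonNeg x {{nonNegative p}} q)

0≤c : ∀ c {_ : True (0ℚ ≤? c)} → 0ℚ ≤ c
0≤c c {t} = toWitness t

-- The form of nearly all numerical estimates below: `d` is an explicit certificate, assembled with
-- `⊕` and `⊗` from quantities of known sign, and a ring identity shows that it is the difference of
-- the two sides.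
≤-by : ∀ {x y d} → 0ℚ ≤ d → x + d ≡ y → x ≤ y
≤-by {x} {y} {d} 0≤d eq = subst₂ _≤_ (+-identityʳ x) eq (+-monoʳ-≤ x 0≤d)

diff≥0 : ∀ {x y} → x ≤ y → 0ℚ ≤ y - x
diff≥0 {x} {y} x≤y = subst (_≤ y - x) (+-inverseʳ x) (+-monoˡ-≤ (- x) x≤y)

x+⟨y-x⟩≡y : ∀ x y → x + (y - x) ≡ y
x+⟨y-x⟩≡y = solve-∀ ringℚ

diff≥0⁻¹ : ∀ {x y} → 0ℚ ≤ y - x → x ≤ y
diff≥0⁻¹ {x} {y} d = ≤-by d (x+⟨y-x⟩≡y x y)

*-mono-≤ : ∀ {x y u v} → 0ℚ ≤ x → x ≤ y → 0ℚ ≤ u → u ≤ v → x * u ≤ y * v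
*-mono-≤ {x} {y} {u} {v} 0≤x x≤y 0≤u u≤v =
  ≤-trans (*-monoˡ-≤-nonNeg x {{nonNegative 0≤x}} u≤v) (*-monoʳ-≤-nonNeg v {{nonNegative (≤-trans 0≤u u≤v)}} x≤y)

*-monoʳ : ∀ {x u v} → 0ℚ ≤ x → u ≤ v → x * u ≤ x * v
*-monoʳ {x} 0≤x u≤v = *-monoˡ-≤-nonNeg x {{nonNegative 0≤x}} u≤v

*-monoˡ : ∀ {x u v} → 0ℚ ≤ x → u ≤ v → u * x ≤ v * x
*-monoˡ {x} 0≤x u≤v = *-monoʳ-≤-nonNeg x {{nonNegative 0≤x}} u≤v

square≥0 : ∀ x → 0ℚ ≤ x * x
square≥0 x with ≤-total 0ℚ x
... | inj₁ 0≤x = 0≤x ⊗ 0≤x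
... | inj₂ x≤0 = subst (0ℚ ≤_) (neg² x) (diff≥0 x≤0 ⊗ diff≥0 x≤0)
  where
  neg² : ∀ x → (0ℚ - x) * (0ℚ - x) ≡ x * x
  neg² = solve-∀ ringℚ

*-cancelˡ-≤ : ∀ {x u v} → 0ℚ < x → x * u ≤ x * v → u ≤ v
*-cancelˡ-≤ {x} 0<x = *-cancelˡ-≤-pos x {{positive 0<x}}

infix 9 #_
#_ : ℕ → ℚ
# k = + k / 1

#-suc : ∀ k → # (suc k) ≡ 1ℚ + # k
#-suc k = toℚᵘ-injective (ℚᵘₚ.≃-trans (toℚᵘ-fromℚᵘ (ℚᵘ.mkℚᵘ (+ suc k) 0)) (ℚᵘₚ.≃-trans
  (ℚᵘ.*≡* (cong (λ z → (+ 1 ℤ.+ z) ℤ.* + 1) (sym (ℤₚ.*-identityʳ (+ k)))))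
  (ℚᵘₚ.≃-trans (ℚᵘₚ.+-congʳ ℚᵘ.1ℚᵘ (ℚᵘₚ.≃-sym (toℚᵘ-fromℚᵘ (ℚᵘ.mkℚᵘ (+ k) 0)))) (ℚᵘₚ.≃-sym (toℚᵘ-homo-+ 1ℚ (# k))))))

#-+ : ∀ j k → # (j ℕ.+ k) ≡ # j + # k
#-+ zero k = sym (+-identityˡ (# k))
#-+ (suc j) k = begin
  # (suc (j ℕ.+ k)) ≡⟨ #-suc (j ℕ.+ k) ⟩
  1ℚ + # (j ℕ.+ k) ≡⟨ cong (λ z → 1ℚ + z) (#-+ j k) ⟩
  1ℚ + (# j + # k) ≡⟨ sym (+-assoc 1ℚ (# j) (# k)) ⟩
  1ℚ + # j + # k ≡⟨ cong (_+ # k) (sym (#-suc j)) ⟩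
  # (suc j) + # k ∎
  where open ≡-Reasoning

#-* : ∀ j k → # (j ℕ.* k) ≡ # j * # k
#-* zero k = sym (*-zeroˡ (# k))
#-* (suc j) k = begin
  # (k ℕ.+ j ℕ.* k) ≡⟨ #-+ k (j ℕ.* k) ⟩
  # k + # (j ℕ.* k) ≡⟨ cong (λ z → # k + z) (#-* j k) ⟩
  # k + # j * # k ≡⟨ ring (# j) (# k) ⟩
  (1ℚ + # j) * # k ≡⟨ cong (_* # k) (sym (#-suc j)) ⟩
  # (suc j) * # k ∎
  where
  open ≡-Reasoning
  ring : ∀ j k → k + j * k ≡ (1ℚ + j) * k
  ring = solve-∀ ringℚ

#≥0 : ∀ k → 0ℚ ≤ # k
#≥0 zero = ≤-refl
#≥0 (suc k) = subst (0ℚ ≤_) (sym (#-suc k)) (0≤c 1ℚ ⊕ #≥0 k)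

#-mono : ∀ {j k} → j ℕ.≤ k → # j ≤ # k
#-mono {j} {k} j≤k = ≤-by (#≥0 (k ℕ.∸ j)) (trans (sym (#-+ j (k ℕ.∸ j))) (cong #_ (ℕₚ.m+[n∸m]≡n j≤k)))

-- Powers

^-nonNeg : ∀ {x} → 0ℚ ≤ x → ∀ k → 0ℚ ≤ x ^ℚ k
^-nonNeg 0≤x zero = 0≤c 1ℚ
^-nonNeg 0≤x (suc k) = 0≤x ⊗ ^-nonNeg 0≤x k

^-≤1 : ∀ {x} → 0ℚ ≤ x → x ≤ 1ℚ → ∀ k → x ^ℚ k ≤ 1ℚ
^-≤1 0≤x x≤1 zero = ≤-refl
^-≤1 0≤x x≤1 (suc k) = *-mono-≤ 0≤x x≤1 (^-nonNeg 0≤x k) (^-≤1 0≤x x≤1 k)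

^-mono : ∀ {x y} → 0ℚ ≤ x → x ≤ y → ∀ k → x ^ℚ k ≤ y ^ℚ k
^-mono 0≤x x≤y zero = ≤-refl
^-mono 0≤x x≤y (suc k) = *-mono-≤ 0≤x x≤y (^-nonNeg 0≤x k) (^-mono 0≤x x≤y k)

^-+ : ∀ x j k → x ^ℚ (j ℕ.+ k) ≡ x ^ℚ j * x ^ℚ k
^-+ x zero k = sym (*-identityˡ _)
^-+ x (suc j) k = trans (cong (x *_) (^-+ x j k)) (sym (*-assoc x _ _))

^-* : ∀ x y k → (x * y) ^ℚ k ≡ x ^ℚ k * y ^ℚ k
^-* x y zero = refl
^-* x y (suc k) = trans (cong (x * y *_) (^-* x y k)) (ring x y (x ^ℚ k) (y ^ℚ k))
  where
  ring : ∀ x y u v → x * y * (u * v) ≡ x * u * (y * v)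
  ring = solve-∀ ringℚ

-- The induction step leaves the surplus `k x²`, whatever the sign of `x`; the case of `- x` is
-- `bernoulli⁺`.
bernoulli : ∀ {x} → 0ℚ ≤ 1ℚ - x → ∀ k → 1ℚ - # k * x ≤ (1ℚ - x) ^ℚ k
bernoulli {x} h zero = ≤-reflexive (ring x)
  where
  ring : ∀ x → 1ℚ - 0ℚ * x ≡ 1ℚ
  ring = solve-∀ ringℚ
bernoulli {x} h (suc k) = ≤-trans
  (≤-by (#≥0 k ⊗ square≥0 x) (trans (cong (λ z → 1ℚ - z * x + # k * (x * x)) (#-suc k)) (ring x (# k))))
  (*-monoʳ h (bernoulli h k))
  where
  ring : ∀ x k → 1ℚ - (1ℚ + k) * x + k * (x * x) ≡ (1ℚ - x) * (1ℚ - k * x)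
  ring = solve-∀ ringℚ

bernoulli⁺ : ∀ {x} → 0ℚ ≤ 1ℚ + x → ∀ k → 1ℚ + # k * x ≤ (1ℚ + x) ^ℚ k
bernoulli⁺ {x} h k = subst₂ _≤_ (ring₁ (# k) x) (cong (_^ℚ k) (ring₂ x)) (bernoulli { - x} (subst (0ℚ ≤_) (sym (ring₂ x)) h) k)
  where
  ring₁ : ∀ k x → 1ℚ - k * - x ≡ 1ℚ + k * x
  ring₁ = solve-∀ ringℚ
  ring₂ : ∀ x → 1ℚ - - x ≡ 1ℚ + x
  ring₂ = solve-∀ ringℚ

-- (1-x)^k (1+kx) ≤ 1: from (1+x)^k ≥ 1+kx and (1-x)(1+x) ≤ 1.
reverse-bernoulli : ∀ {x} → 0ℚ ≤ 1ℚ - x → 0ℚ ≤ 1ℚ + x → ∀ k → (1ℚ - x) ^ℚ k * (1ℚ + # k * x) ≤ 1ℚ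
reverse-bernoulli {x} h h' k = ≤-trans
  (*-monoʳ (^-nonNeg h k) (bernoulli⁺ h' k))
  (subst (_≤ 1ℚ) (^-* (1ℚ - x) (1ℚ + x) k) (^-≤1 (h ⊗ h') (≤-by (square≥0 x) (ring x)) k))
  where
  ring : ∀ x → (1ℚ - x) * (1ℚ + x) + x * x ≡ 1ℚ
  ring = solve-∀ ringℚ

-- The exploration process

-- A literal is processed by testing each of the m unexplored variables: with probability q² none of its two
-- literals is hit, with probability 2pq exactly one is; hitting both is a contradiction and loses the mass.
-- In g k m', k variables were hit and m' = m - k remain.
Bin : ℚ → ℕ → (ℕ → ℕ → ℚ) → ℚ
Bin p zero g = g 0 0
Bin p (suc m) g = (1ℚ - p) * (1ℚ - p) * Bin p m (λ k m' → g k (suc m')) + # 2 * p * (1ℚ - p) * Bin p m (λ k m' → g (suc k) m')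

-- Expected payoff φ i m on termination after i processed literals with m unexplored variables left, started from
-- m unexplored variables and a active literals; runs that meet a contradiction pay 0. The first number is fuel,
-- to be taken equal to m + a. The factor q^a excludes contradictions with the other active literals.
K : ℚ → (ℕ → ℕ → ℚ) → ℕ → ℕ → ℕ → ℕ → ℚ
K p φ f i m zero = φ i m
K p φ zero i m (suc a) = 0ℚ
K p φ (suc f) i m (suc a) = (1ℚ - p) ^ℚ a * Bin p m (λ k m' → K p φ f (suc i) m' (a ℕ.+ k))

-- The mass that survives all tests: `K` with payoff 1, as `K-const` states, without the step
-- counter.
r : ℚ → ℕ → ℕ → ℕ → ℚ
r p f m zero = 1ℚ
r p zero m (suc a) = 0ℚ
r p (suc f) m (suc a) = (1ℚ - p) ^ℚ a * Bin p m (λ k m' → r p f m' (a ℕ.+ k))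

ρ : ℚ → ℕ → ℚ
ρ p m = r p (suc m) m 1

module Chain (p : ℚ) (0≤p : 0ℚ ≤ p) (0≤q : 0ℚ ≤ 1ℚ - p) where

  q : ℚ
  q = 1ℚ - p

  private
    0≤qq : 0ℚ ≤ q * q
    0≤qq = 0≤q ⊗ 0≤q

    0≤2pq : 0ℚ ≤ # 2 * p * q
    0≤2pq = #≥0 2 ⊗ 0≤p ⊗ 0≤q

  pred-+ : ∀ m a f → m ℕ.+ suc a ≡ suc f → m ℕ.+ a ≡ f
  pred-+ m a f eq = ℕₚ.suc-injective (trans (sym (ℕₚ.+-suc m a)) eq)

  -- Why `m + a` is the right fuel: a processed literal leaves the active ones and every hit
  -- variable moves from unexplored to active, so the sum drops by exactly one per step and `i + f`
  -- never changes.
  step-+ : ∀ {m f} m' a k → k ℕ.+ m' ≡ m → m ℕ.+ suc a ≡ suc f → m' ℕ.+ (a ℕ.+ k) ≡ f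
  step-+ {m} {f} m' a k eq eq' = begin
    m' ℕ.+ (a ℕ.+ k) ≡⟨ ℕₚ.+-comm m' (a ℕ.+ k) ⟩
    a ℕ.+ k ℕ.+ m' ≡⟨ ℕₚ.+-assoc a k m' ⟩
    a ℕ.+ (k ℕ.+ m') ≡⟨ cong (a ℕ.+_) eq ⟩
    a ℕ.+ m ≡⟨ ℕₚ.+-comm a m ⟩
    m ℕ.+ a ≡⟨ pred-+ m a f eq' ⟩
    f ∎
    where open ≡-Reasoning

  Bin-mono : ∀ m {g h} → (∀ k m' → k ℕ.+ m' ≡ m → g k m' ≤ h k m') → Bin p m g ≤ Bin p m h
  Bin-mono zero le = le 0 0 refl
  Bin-mono (suc m) le = +-mono-≤
    (*-monoʳ 0≤qq (Bin-mono m λ k m' eq → le k (suc m') (trans (ℕₚ.+-suc k m') (cong suc eq))))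
    (*-monoʳ 0≤2pq (Bin-mono m λ k m' eq → le (suc k) m' (cong suc eq)))

  Bin-cong : ∀ m {g h} → (∀ k m' → k ℕ.+ m' ≡ m → g k m' ≡ h k m') → Bin p m g ≡ Bin p m h
  Bin-cong m eq = ≤-antisym (Bin-mono m λ k m' e → ≤-reflexive (eq k m' e)) (Bin-mono m λ k m' e → ≤-reflexive (sym (eq k m' e)))

  Bin-linear : ∀ m x y {g h} → Bin p m (λ k m' → x * g k m' + y * h k m') ≡ x * Bin p m g + y * Bin p m h
  Bin-linear zero x y = refl
  Bin-linear (suc m) x y {g} {h} = trans
    (cong₂ (λ u v → q * q * u + # 2 * p * q * v) (Bin-linear m x y) (Bin-linear m x y))
    (ring (q * q) (# 2 * p * q) x y _ _ _ _)
    where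
    ring : ∀ c b x y u v s t → c * (x * u + y * v) + b * (x * s + y * t) ≡ x * (c * u + b * s) + y * (c * v + b * t)
    ring = solve-∀ ringℚ

  Bin-scale : ∀ m x {g} → Bin p m (λ k m' → x * g k m') ≡ x * Bin p m g
  Bin-scale zero x = refl
  Bin-scale (suc m) x {g} = trans
    (cong₂ (λ u v → q * q * u + # 2 * p * q * v) (Bin-scale m x) (Bin-scale m x))
    (ring (q * q) (# 2 * p * q) x _ _)
    where
    ring : ∀ c b x u v → c * (x * u) + b * (x * v) ≡ x * (c * u + b * v)
    ring = solve-∀ ringℚ

  -- The factor `q² + 2pqθ` that one unexplored variable contributes to the mean of `θ^a`. At
  -- `θ = 1` it is `1 - p²`, the mass `p²` of a double hit being lost.
  growth : ℚ → ℚ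
  growth θ = q * (1ℚ - p + # 2 * p * θ)

  Bin-exp : ∀ m a θ → Bin p m (λ k m' → θ ^ℚ (a ℕ.+ k)) ≡ θ ^ℚ a * growth θ ^ℚ m
  Bin-exp zero a θ = trans (cong (θ ^ℚ_) (ℕₚ.+-identityʳ a)) (sym (*-identityʳ _))
  Bin-exp (suc m) a θ = trans
    (cong₂ (λ u v → q * q * u + # 2 * p * q * v) (Bin-exp m a θ)
      (trans (Bin-cong m λ k m' _ → cong (θ ^ℚ_) (ℕₚ.+-suc a k)) (Bin-exp m (suc a) θ)))
    (ring p θ (θ ^ℚ a) (growth θ ^ℚ m))
    where
    ring : ∀ p θ u v → (1ℚ - p) * (1ℚ - p) * (u * v) + # 2 * p * (1ℚ - p) * (θ * u * v) ≡ u * ((1ℚ - p) * (1ℚ - p + # 2 * p * θ) * v)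
    ring = solve-∀ ringℚ

  -- A run ends with no active literal, so its fuel is then `m` and the invariant gives `i + m = T`;
  -- payoffs need to be compared only there.
  K-mono : ∀ {φ ψ} T → (∀ i m → i ℕ.+ m ≡ T → φ i m ≤ ψ i m) →
           ∀ f i m a → m ℕ.+ a ≡ f → i ℕ.+ f ≡ T → K p φ f i m a ≤ K p ψ f i m a
  K-mono T le f i m zero eq eqT = le i m (trans (cong (i ℕ.+_) (trans (sym (ℕₚ.+-identityʳ m)) eq)) eqT)
  K-mono T le zero i m (suc a) eq eqT = ≤-refl
  K-mono T le (suc f) i m (suc a) eq eqT = *-monoʳ (^-nonNeg 0≤q a) (Bin-mono m λ k m' e →
    K-mono T le f (suc i) m' (a ℕ.+ k) (step-+ m' a k e eq) (trans (sym (ℕₚ.+-suc i f)) eqT))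

  K-linear : ∀ x y {φ ψ} f i m a → K p (λ i m → x * φ i m + y * ψ i m) f i m a ≡ x * K p φ f i m a + y * K p ψ f i m a
  K-linear x y f i m zero = refl
  K-linear x y zero i m (suc a) = sym (trans (cong₂ _+_ (*-zeroʳ x) (*-zeroʳ y)) (+-identityˡ 0ℚ))
  K-linear x y {φ} {ψ} (suc f) i m (suc a) = trans
    (cong (q ^ℚ a *_) (trans (Bin-cong m λ k m' _ → K-linear x y f (suc i) m' (a ℕ.+ k)) (Bin-linear m x y)))
    (ring (q ^ℚ a) x y _ _)
    where
    ring : ∀ z x y u v → z * (x * u + y * v) ≡ x * (z * u) + y * (z * v)
    ring = solve-∀ ringℚ

  K-const : ∀ x f i m a → K p (λ _ _ → x) f i m a ≡ x * r p f m a
  K-const x f i m zero = sym (*-identityʳ x)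
  K-const x zero i m (suc a) = sym (*-zeroʳ x)
  K-const x (suc f) i m (suc a) = trans
    (cong (q ^ℚ a *_) (trans (Bin-cong m λ k m' _ → K-const x f (suc i) m' (a ℕ.+ k)) (Bin-scale m x)))
    (ring (q ^ℚ a) x _)
    where
    ring : ∀ z x u → z * (x * u) ≡ x * (z * u)
    ring = solve-∀ ringℚ

  r≥0 : ∀ f m a → 0ℚ ≤ r p f m a
  r≥0 f m zero = 0≤c 1ℚ
  r≥0 zero m (suc a) = ≤-refl
  r≥0 (suc f) m (suc a) = ^-nonNeg 0≤q a ⊗ subst (_≤ Bin p m (λ k m' → r p f m' (a ℕ.+ k))) (Bin-zero m) (Bin-mono m λ k m' _ → r≥0 f m' (a ℕ.+ k))
    where
    Bin-zero : ∀ m → Bin p m (λ _ _ → 0ℚ) ≡ 0ℚ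
    Bin-zero m = trans (Bin-scale m 0ℚ {λ _ _ → 0ℚ}) (*-zeroˡ (Bin p m (λ _ _ → 0ℚ)))

  q≤1 : q ≤ 1ℚ
  q≤1 = ≤-by 0≤p (ring p)
    where
    ring : ∀ p → 1ℚ - p + p ≡ 1ℚ
    ring = solve-∀ ringℚ

  growth≤1 : growth 1ℚ ≤ 1ℚ
  growth≤1 = ≤-by (square≥0 p) (ring p)
    where
    ring : ∀ p → (1ℚ - p) * (1ℚ - p + # 2 * p * 1ℚ) + p * p ≡ 1ℚ
    ring = solve-∀ ringℚ

  growth≥0 : ∀ {θ} → 0ℚ ≤ θ → 0ℚ ≤ growth θ
  growth≥0 0≤θ = 0≤q ⊗ (0≤q ⊕ #≥0 2 ⊗ 0≤p ⊗ 0≤θ)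

  1^ : ∀ k → 1ℚ ^ℚ k ≡ 1ℚ
  1^ zero = refl
  1^ (suc k) = trans (*-identityˡ _) (1^ k)

  r≤1 : ∀ f m a → r p f m a ≤ 1ℚ
  r≤1 f m zero = ≤-refl
  r≤1 zero m (suc a) = 0≤c 1ℚ
  r≤1 (suc f) m (suc a) = begin
    q ^ℚ a * Bin p m (λ k m' → r p f m' (a ℕ.+ k)) ≤⟨ *-monoʳ (^-nonNeg 0≤q a) (Bin-mono m λ k m' _ → r≤1 f m' (a ℕ.+ k)) ⟩
    q ^ℚ a * Bin p m (λ _ _ → 1ℚ) ≡⟨ cong (q ^ℚ a *_) (trans (Bin-cong m λ k _ _ → sym (1^ k)) (Bin-exp m 0 1ℚ)) ⟩
    q ^ℚ a * (1ℚ * growth 1ℚ ^ℚ m) ≤⟨ *-mono-≤ (^-nonNeg 0≤q a) (^-≤1 0≤q q≤1 a) (0≤c 1ℚ ⊗ ^-nonNeg (growth≥0 (0≤c 1ℚ)) m) (≤-trans (≤-reflexive (*-identityˡ _)) (^-≤1 (growth≥0 (0≤c 1ℚ)) growth≤1 m)) ⟩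
    1ℚ * 1ℚ ∎
    where open ≤-Reasoning

  set-aside : ℕ → ℕ → ℚ
  set-aside i m = q ^ℚ i * q ^ℚ i + # 2 * (1ℚ - q ^ℚ i) * q ^ℚ i * ρ p m

  -- One variable is set aside: after i steps it is untouched with weight q^2i and hit by exactly one of its
  -- literals with weight 2 (1 - q^i) q^i; in the latter case that literal is processed last.
  explore-set-aside : ∀ f i m a → m ℕ.+ a ≡ f → K p set-aside f i m a ≡
    q ^ℚ i * q ^ℚ i * r p (suc f) (suc m) a + # 2 * (1ℚ - q ^ℚ i) * q ^ℚ i * r p (suc f) m (suc a)
  explore-set-aside f i m zero eq = cong₂ _+_ (sym (*-identityʳ (q ^ℚ i * q ^ℚ i)))
    (cong (λ z → # 2 * (1ℚ - q ^ℚ i) * q ^ℚ i * r p (suc z) m 1) (trans (sym (ℕₚ.+-identityʳ m)) eq))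
  explore-set-aside zero i m (suc a) eq with () ← trans (sym (ℕₚ.+-suc m a)) eq
  explore-set-aside (suc f) i m (suc a) eq = begin
    q ^ℚ a * Bin p m (λ k m' → K p set-aside f (suc i) m' (a ℕ.+ k))
      ≡⟨ cong (q ^ℚ a *_) (Bin-cong m λ k m' e → explore-set-aside f (suc i) m' (a ℕ.+ k) (step-+ m' a k e eq)) ⟩
    q ^ℚ a * Bin p m (λ k m' → (q * z) * (q * z) * r p (suc f) (suc m') (a ℕ.+ k) + # 2 * (1ℚ - q * z) * (q * z) * r p (suc f) m' (suc (a ℕ.+ k)))
      ≡⟨ cong (q ^ℚ a *_) (Bin-linear m ((q * z) * (q * z)) (# 2 * (1ℚ - q * z) * (q * z))) ⟩
    q ^ℚ a * ((q * z) * (q * z) * U + # 2 * (1ℚ - q * z) * (q * z) * V)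
      -- `2 (1 - qz) qz = 2pq z² + 2 (1 - z) z q`: the variable set aside is hit in this very step,
      -- or it was hit before and, as one more waiting literal, must not be contradicted now, which
      -- costs the additional factor `q`.
      ≡⟨ ring p z (q ^ℚ a) U V ⟩
    z * z * (q ^ℚ a * (q * q * U + # 2 * p * q * V)) + # 2 * (1ℚ - z) * z * (q * q ^ℚ a * V)
      ≡⟨ cong (λ v → z * z * (q ^ℚ a * (q * q * U + # 2 * p * q * v)) + # 2 * (1ℚ - z) * z * (q * q ^ℚ a * V))
           (Bin-cong m λ k m' _ → cong (r p (suc f) m') (sym (ℕₚ.+-suc a k))) ⟩
    z * z * r p (suc (suc f)) (suc m) (suc a) + # 2 * (1ℚ - z) * z * r p (suc (suc f)) m (suc (suc a)) ∎
    where
    open ≡-Reasoning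
    z U V : ℚ
    z = q ^ℚ i
    U = Bin p m (λ k m' → r p (suc f) (suc m') (a ℕ.+ k))
    V = Bin p m (λ k m' → r p (suc f) m' (suc (a ℕ.+ k)))
    ring : ∀ p z x u v → x * ((1ℚ - p) * z * ((1ℚ - p) * z) * u + # 2 * (1ℚ - (1ℚ - p) * z) * ((1ℚ - p) * z) * v) ≡
      z * z * (x * ((1ℚ - p) * (1ℚ - p) * u + # 2 * p * (1ℚ - p) * v)) + # 2 * (1ℚ - z) * z * ((1ℚ - p) * x * v)
    ring = solve-∀ ringℚ

-- Moments of the exploration and increments of `ρ`

moment : ℚ → ℚ → ℕ → ℚ
moment e p k = K p (λ i _ → e * # i + e * # i * (e * # i)) (suc k) 0 k 1

module Moments (p : ℚ) (0≤p : 0ℚ ≤ p) (0≤q : 0ℚ ≤ 1ℚ - p) where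
  open Chain p 0≤p 0≤q

  K-mono₀ : ∀ {φ ψ} k → (∀ i m → i ℕ.+ m ≡ suc k → φ i m ≤ ψ i m) → K p φ (suc k) 0 k 1 ≤ K p ψ (suc k) 0 k 1
  K-mono₀ k le = K-mono (suc k) le (suc k) 0 k 1 (ℕₚ.+-comm k 1) refl

  K-scale₀ : ∀ x φ k → K p (λ i m → x * φ i m) (suc k) 0 k 1 ≡ x * K p φ (suc k) 0 k 1
  K-scale₀ x φ k = begin
    K p (λ i m → x * φ i m) (suc k) 0 k 1
      ≡⟨ ≤-antisym (K-mono₀ k λ i m _ → ≤-reflexive (ring x (φ i m))) (K-mono₀ k λ i m _ → ≤-reflexive (sym (ring x (φ i m)))) ⟩
    K p (λ i m → x * φ i m + 0ℚ * φ i m) (suc k) 0 k 1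
      ≡⟨ K-linear x 0ℚ (suc k) 0 k 1 ⟩
    x * K p φ (suc k) 0 k 1 + 0ℚ * K p φ (suc k) 0 k 1
      ≡⟨ sym (ring x (K p φ (suc k) 0 k 1)) ⟩
    x * K p φ (suc k) 0 k 1 ∎
    where
    open ≡-Reasoning
    ring : ∀ x u → x * u ≡ x * u + 0ℚ * u
    ring = solve-∀ ringℚ

  -- 1 - q^2i - 2 h (1 - h) ρ = 2 h (1 - h) (1 - ρ) + h² with h = 1 - q^i ≤ p i.
  ρ-step : ∀ {Q D B e} k → 0ℚ ≤ e → 0ℚ ≤ D → (∀ m → m ℕ.≤ suc k → 1ℚ - ρ p m ≤ Q) →
           # 2 * p * Q ≤ D * e → p * p ≤ D * (e * e) → moment e p k ≤ B → ρ p k - ρ p (suc k) ≤ D * B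
  ρ-step {Q} {D} {B} {e} k 0≤e 0≤D ρ-low hQ hp hB = begin
    ρ p k - ρ p (suc k)
      -- At `i = 0` the two weights in `explore-set-aside` are 1 and 0, so `ρ (k + 1)` is itself a
      -- payoff of the run with `k` variables and the difference becomes a single expectation.
      ≡⟨ cong₂ _-_ (sym (*-identityˡ (ρ p k))) (trans (sym (ring₀ (ρ p (suc k)) (r p (suc (suc k)) k 2))) (sym (explore-set-aside (suc k) 0 k 1 (ℕₚ.+-comm k 1)))) ⟩
    1ℚ * ρ p k - K p set-aside (suc k) 0 k 1
      ≡⟨ cong (_- K p set-aside (suc k) 0 k 1) (sym (K-const 1ℚ (suc k) 0 k 1)) ⟩
    K p (λ _ _ → 1ℚ) (suc k) 0 k 1 - K p set-aside (suc k) 0 k 1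
      ≡⟨ ring₁ (K p (λ _ _ → 1ℚ) (suc k) 0 k 1) (K p set-aside (suc k) 0 k 1) ⟩
    1ℚ * K p (λ _ _ → 1ℚ) (suc k) 0 k 1 + (- 1ℚ) * K p set-aside (suc k) 0 k 1
      ≡⟨ sym (K-linear 1ℚ (- 1ℚ) (suc k) 0 k 1) ⟩
    K p (λ i m → 1ℚ * 1ℚ + (- 1ℚ) * set-aside i m) (suc k) 0 k 1
      ≤⟨ K-mono₀ k (λ i m eq → pointwise i m (subst (m ℕ.≤_) eq (ℕₚ.m≤n+m m i))) ⟩
    K p (λ i _ → D * (e * # i + e * # i * (e * # i))) (suc k) 0 k 1
      ≡⟨ K-scale₀ D _ k ⟩
    D * moment e p k
      ≤⟨ *-monoʳ 0≤D hB ⟩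
    D * B ∎
    where
    open ≤-Reasoning
    ring₀ : ∀ x y → 1ℚ * 1ℚ * x + # 2 * (1ℚ - 1ℚ) * 1ℚ * y ≡ x
    ring₀ = solve-∀ ringℚ
    ring₁ : ∀ x y → x - y ≡ 1ℚ * x + (- 1ℚ) * y
    ring₁ = solve-∀ ringℚ
    pointwise : ∀ i m → m ℕ.≤ suc k → 1ℚ * 1ℚ + (- 1ℚ) * set-aside i m ≤ D * (e * # i + e * # i * (e * # i))
    pointwise i m m≤ = begin
      1ℚ * 1ℚ + (- 1ℚ) * set-aside i m
        ≤⟨ ≤-by (#≥0 2 ⊗ (square≥0 h ⊗ (diff≥0 (r≤1 (suc m) m 1)))) (ring₂ (q ^ℚ i) (ρ p m)) ⟩
      # 2 * h * (1ℚ - ρ p m) + h * h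
        ≤⟨ +-mono-≤ (*-mono-≤ (#≥0 2 ⊗ 0≤h) (*-monoʳ (#≥0 2) h≤) (diff≥0 (r≤1 (suc m) m 1)) (ρ-low m m≤)) (*-mono-≤ 0≤h h≤ 0≤h h≤) ⟩
      # 2 * (# i * p) * Q + (# i * p) * (# i * p)
        ≡⟨ ring₃ (# i) p Q ⟩
      # i * (# 2 * p * Q) + # i * # i * (p * p)
        ≤⟨ +-mono-≤ (*-monoʳ (#≥0 i) hQ) (*-monoʳ (#≥0 i ⊗ #≥0 i) hp) ⟩
      # i * (D * e) + # i * # i * (D * (e * e))
        ≡⟨ ring₄ (# i) D e ⟩
      D * (e * # i + e * # i * (e * # i)) ∎
      where
      h : ℚ
      h = 1ℚ - q ^ℚ i
      0≤h : 0ℚ ≤ h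
      0≤h = diff≥0 (^-≤1 0≤q q≤1 i)
      ring₅ : ∀ z x → 1ℚ - z + (z - (1ℚ - x)) ≡ x
      ring₅ = solve-∀ ringℚ
      h≤ : h ≤ # i * p
      h≤ = ≤-by (diff≥0 (bernoulli 0≤q i)) (ring₅ (q ^ℚ i) (# i * p))
      ring₂ : ∀ z r → 1ℚ * 1ℚ + (- 1ℚ) * (z * z + # 2 * (1ℚ - z) * z * r) + # 2 * ((1ℚ - z) * (1ℚ - z) * (1ℚ - r)) ≡ # 2 * (1ℚ - z) * (1ℚ - r) + (1ℚ - z) * (1ℚ - z)
      ring₂ = solve-∀ ringℚ
      ring₃ : ∀ i p Q → # 2 * (i * p) * Q + (i * p) * (i * p) ≡ i * (# 2 * p * Q) + i * i * (p * p)
      ring₃ = solve-∀ ringℚ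
      ring₄ : ∀ i D e → i * (D * e) + i * i * (D * (e * e)) ≡ D * (e * i + e * i * (e * i))
      ring₄ = solve-∀ ringℚ

  mean≤ : ∀ {e S} k → 0ℚ < e → moment e p k ≤ S * e → K p (λ i _ → # i) (suc k) 0 k 1 ≤ S
  mean≤ {e} {S} k 0<e le = *-cancelˡ-≤ 0<e (begin
    e * K p (λ i _ → # i) (suc k) 0 k 1 ≡⟨ sym (K-scale₀ e _ k) ⟩
    K p (λ i _ → e * # i) (suc k) 0 k 1 ≤⟨ K-mono₀ k (λ i m _ → ≤-by (square≥0 (e * # i)) refl) ⟩
    moment e p k ≤⟨ le ⟩
    S * e ≡⟨ *-comm S e ⟩
    e * S ∎)
    where open ≤-Reasoning

  ρ-steps : ∀ {d} k j → (∀ k' → k ℕ.≤ k' → k' ℕ.< k ℕ.+ j → ρ p k' - ρ p (suc k') ≤ d) → ρ p k ≤ ρ p (k ℕ.+ j) + d * # j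
  ρ-steps {d} k zero h = ≤-reflexive (trans (ring d (ρ p k)) (cong (λ z → ρ p z + d * # 0) (sym (ℕₚ.+-identityʳ k))))
    where
    ring : ∀ d x → x ≡ x + d * 0ℚ
    ring = solve-∀ ringℚ
  ρ-steps {d} k (suc j) h = begin
    ρ p k
      ≤⟨ ρ-steps k j (λ k' le lt → h k' le (ℕₚ.<-≤-trans lt (ℕₚ.+-monoʳ-≤ k (ℕₚ.n≤1+n j)))) ⟩
    ρ p (k ℕ.+ j) + d * # j
      ≤⟨ +-monoˡ-≤ (d * # j) (≤-by {ρ p (k ℕ.+ j)} (diff≥0 (h (k ℕ.+ j) (ℕₚ.m≤m+n k j) (ℕₚ.+-monoʳ-< k (ℕₚ.n<1+n j)))) (ring₁ (ρ p (k ℕ.+ j)) (ρ p (suc (k ℕ.+ j))) d)) ⟩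
    ρ p (suc (k ℕ.+ j)) + d + d * # j
      ≡⟨ ring₂ (ρ p (suc (k ℕ.+ j))) d (# j) ⟩
    ρ p (suc (k ℕ.+ j)) + d * (1ℚ + # j)
      ≡⟨ cong₂ (λ x y → ρ p x + d * y) (sym (ℕₚ.+-suc k j)) (sym (#-suc j)) ⟩
    ρ p (k ℕ.+ suc j) + d * # (suc j) ∎
    where
    open ≤-Reasoning
    ring₁ : ∀ x y d → x + (d - (x - y)) ≡ y + d
    ring₁ = solve-∀ ringℚ
    ring₂ : ∀ y d j → y + d + d * j ≡ y + d * (1ℚ + j)
    ring₂ = solve-∀ ringℚ

  -- After exploring from the first literal with n - 2 unexplored variables, k - i of them (k = n - 1) remain.
  covariance≤ : ∀ {L S d} n₂ → 0ℚ ≤ L → (∀ i m → i ℕ.+ m ≡ suc n₂ → ρ p m ≤ ρ p (suc n₂) + L * # i) →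
                K p (λ i _ → # i) (suc n₂) 0 n₂ 1 ≤ S → ρ p n₂ - ρ p (suc n₂) ≤ d → 0ℚ ≤ d →
                K p (λ _ m → ρ p m) (suc n₂) 0 n₂ 1 - ρ p (suc n₂) * ρ p (suc n₂) ≤ L * S + d
  covariance≤ {L} {S} {d} n₂ 0≤L lip mean step 0≤d = begin
    K p (λ _ m → ρ p m) (suc n₂) 0 n₂ 1 - P * P
      ≤⟨ +-monoˡ-≤ (- (P * P)) (K-mono₀ n₂ λ i m eq → ≤-trans (lip i m eq) (≤-reflexive (cong (_+ L * # i) (sym (*-identityʳ P))))) ⟩
    K p (λ i _ → P * 1ℚ + L * # i) (suc n₂) 0 n₂ 1 - P * P
      ≡⟨ cong (_- P * P) (trans (K-linear P L (suc n₂) 0 n₂ 1) (cong (λ z → P * z + L * K p (λ i _ → # i) (suc n₂) 0 n₂ 1) (trans (K-const 1ℚ (suc n₂) 0 n₂ 1) (*-identityˡ _)))) ⟩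
    P * ρ p n₂ + L * K p (λ i _ → # i) (suc n₂) 0 n₂ 1 - P * P
      -- The factor `P ≤ 1` in front of the increment is removed by `P d + (1 - P) d = d`.
      ≤⟨ ≤-by (0≤L ⊗ diff≥0 mean ⊕ (r≥0 (suc (suc n₂)) (suc n₂) 1 ⊗ diff≥0 step ⊕ diff≥0 (r≤1 (suc (suc n₂)) (suc n₂) 1) ⊗ 0≤d)) (ring P (ρ p n₂) L S _ d) ⟩
    L * S + d ∎
    where
    open ≤-Reasoning
    P : ℚ
    P = ρ p (suc n₂)
    ring : ∀ P R L S M d → P * R + L * M - P * P + (L * (S - M) + (P * (d - (R - P)) + (1ℚ - P) * d)) ≡ L * S + d
    ring = solve-∀ ringℚ

-- Supersolutions and subsolutions of the recursion

module Supersolutions (p : ℚ) (0≤p : 0ℚ ≤ p) (0≤q : 0ℚ ≤ 1ℚ - p) where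
  open Chain p 0≤p 0≤q

  private
    shift-+ : ∀ {T} i f → i ℕ.+ suc f ≡ T → suc i ℕ.+ f ≡ T
    shift-+ i f eq = trans (sym (ℕₚ.+-suc i f)) eq

  -- Since q ≤ growth θ (and similarly with a varying θ), every waiting active literal may be traded for an
  -- unexplored variable; so only states with a single active literal have to be checked.
  late-supersolution : ∀ T (Φ Y θ : ℕ → ℚ) → (∀ i → 0ℚ ≤ Y i) → (∀ f → f ℕ.≤ T → 0ℚ ≤ θ f) → (∀ i → Φ i ≤ Y i) →
    (∀ f → suc f ℕ.≤ T → θ f ≤ (1ℚ - p + # 2 * p * θ f) * θ (suc f)) →
    (∀ i f → i ℕ.+ suc f ≡ T → Y (suc i) * growth (θ f) ^ℚ f ≤ Y i * θ (suc f)) →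
    ∀ f i m a → m ℕ.+ a ≡ f → i ℕ.+ f ≡ T → K p (λ i _ → Φ i) f i m a ≤ Y i * θ f ^ℚ a
  late-supersolution T Φ Y θ 0≤Y 0≤θ Φ≤Y h₁ h₂ = go
    where
    open ≤-Reasoning
    go : ∀ f i m a → m ℕ.+ a ≡ f → i ℕ.+ f ≡ T → K p (λ i _ → Φ i) f i m a ≤ Y i * θ f ^ℚ a
    go f i m zero eq eqT = ≤-trans (Φ≤Y i) (≤-reflexive (sym (*-identityʳ (Y i))))
    go zero i m (suc a) eq eqT with () ← trans (sym (ℕₚ.+-suc m a)) eq
    go (suc f) i m (suc a) eq eqT = begin
      q ^ℚ a * Bin p m (λ k m' → K p (λ i _ → Φ i) f (suc i) m' (a ℕ.+ k))
        ≤⟨ *-monoʳ (^-nonNeg 0≤q a) (Bin-mono m λ k m' e → go f (suc i) m' (a ℕ.+ k) (step-+ m' a k e eq) (shift-+ i f eqT)) ⟩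
      q ^ℚ a * Bin p m (λ k m' → Y (suc i) * θ f ^ℚ (a ℕ.+ k))
        ≡⟨ cong (q ^ℚ a *_) (trans (Bin-scale m (Y (suc i))) (cong (Y (suc i) *_) (Bin-exp m a (θ f)))) ⟩
      q ^ℚ a * (Y (suc i) * (θ f ^ℚ a * g ^ℚ m))
        ≡⟨ ring₁ (q ^ℚ a) (Y (suc i)) (θ f ^ℚ a) (g ^ℚ m) ⟩
      Y (suc i) * g ^ℚ m * (q ^ℚ a * θ f ^ℚ a)
        ≤⟨ *-monoʳ (0≤Y (suc i) ⊗ ^-nonNeg 0≤g m) (subst₂ _≤_ (^-* q (θ f) a) (^-* g (θ (suc f)) a) (^-mono (0≤q ⊗ 0≤θ f f≤T) (≤-trans (*-monoʳ 0≤q (h₁ f T≥)) (≤-reflexive (sym (*-assoc q _ (θ (suc f)))))) a)) ⟩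
      Y (suc i) * g ^ℚ m * (g ^ℚ a * θ (suc f) ^ℚ a)
        ≡⟨ ring₂ (Y (suc i)) (g ^ℚ m) (g ^ℚ a) (θ (suc f) ^ℚ a) ⟩
      θ (suc f) ^ℚ a * (Y (suc i) * (g ^ℚ m * g ^ℚ a))
        ≡⟨ cong (λ z → θ (suc f) ^ℚ a * (Y (suc i) * z)) (trans (sym (^-+ g m a)) (cong (g ^ℚ_) (pred-+ m a f eq))) ⟩
      θ (suc f) ^ℚ a * (Y (suc i) * g ^ℚ f)
        ≤⟨ *-monoʳ (^-nonNeg (0≤θ (suc f) T≥) a) (h₂ i f eqT) ⟩
      θ (suc f) ^ℚ a * (Y i * θ (suc f))
        ≡⟨ ring₃ (θ (suc f) ^ℚ a) (Y i) (θ (suc f)) ⟩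
      Y i * (θ (suc f) * θ (suc f) ^ℚ a) ∎
      where
      g : ℚ
      g = growth (θ f)
      T≥ : suc f ℕ.≤ T
      T≥ = subst (suc f ℕ.≤_) eqT (ℕₚ.m≤n+m (suc f) i)
      f≤T : f ℕ.≤ T
      f≤T = ℕₚ.≤-trans (ℕₚ.n≤1+n f) T≥
      0≤g : 0ℚ ≤ g
      0≤g = growth≥0 (0≤θ f f≤T)
      ring₁ : ∀ z y t g → z * (y * (t * g)) ≡ y * g * (z * t)
      ring₁ = solve-∀ ringℚ
      ring₂ : ∀ y g h t → y * g * (h * t) ≡ t * (y * (g * h))
      ring₂ = solve-∀ ringℚ
      ring₃ : ∀ z y t → z * (y * t) ≡ y * (t * z)
      ring₃ = solve-∀ ringℚ

  -- With v = e i, the function A (v + v²) θ₁^a + A (4 v + 12) (θ₁^a - θ₂^a): in one step θ₁^a loses a fraction e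
  -- while θ₂^a loses almost nothing, so the second term pays for the increments of the first.
  early-bound : ℚ → ℚ → ℚ → ℚ → ℕ → ℕ → ℚ
  early-bound e A θ₁ θ₂ i a = A * (e * # i + e * # i * (e * # i)) * θ₁ ^ℚ a + A * (# 4 * (e * # i) + # 12) * (θ₁ ^ℚ a - θ₂ ^ℚ a)

  -- The recursion is followed as long as the next fuel is `Good`; at the last good fuel `fallback`
  -- takes over with the first term of `early-bound`, where the factor `A` leaves room for a
  -- constant. By `h₁` the mean of the power of `θ₁` loses a fraction `e`; by `h₂` that of `θ₂`
  -- loses at most half that amount.
  early-supersolution : ∀ {e A θ₁ θ₂} T (Good Bad : ℕ → Set) → 0ℚ ≤ e → 1ℚ ≤ A → 0ℚ ≤ θ₂ → θ₂ ≤ θ₁ →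
    (∀ f → Good f ⊎ Bad f) →
    (∀ f m a → Good (suc f) → suc f ℕ.≤ T → m ℕ.+ a ≡ f → q ^ℚ a * (θ₁ ^ℚ a * growth θ₁ ^ℚ m) ≤ (1ℚ - e) * θ₁ ^ℚ suc a) →
    (∀ f m a → suc f ℕ.≤ T → m ℕ.+ a ≡ f → θ₂ ^ℚ suc a - ½ * e * θ₁ ^ℚ suc a ≤ q ^ℚ a * (θ₂ ^ℚ a * growth θ₂ ^ℚ m)) →
    (∀ f i m a → Good (suc f) → Bad f → m ℕ.+ a ≡ suc f → i ℕ.+ suc f ≡ T →
      K p (λ i _ → e * # i + e * # i * (e * # i)) (suc f) i m a ≤ A * (e * # i + e * # i * (e * # i)) * θ₁ ^ℚ a) →
    ∀ f i m a → Good f → m ℕ.+ a ≡ f → i ℕ.+ f ≡ T →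
      K p (λ i _ → e * # i + e * # i * (e * # i)) f i m a ≤ early-bound e A θ₁ θ₂ i a
  early-supersolution {e} {A} {θ₁} {θ₂} T Good Bad 0≤e 1≤A 0≤θ₂ θ₂≤θ₁ dec h₁ h₂ fallback = go
    where
    open ≤-Reasoning
    Φ : ℕ → ℚ
    Φ i = e * # i + e * # i * (e * # i)
    0≤v : ∀ i → 0ℚ ≤ e * # i
    0≤v i = 0≤e ⊗ #≥0 i
    0≤A : 0ℚ ≤ A
    0≤A = ≤-trans (0≤c 1ℚ) 1≤A
    0≤θ₁ : 0ℚ ≤ θ₁
    0≤θ₁ = ≤-trans 0≤θ₂ θ₂≤θ₁
    0≤β : ∀ i → 0ℚ ≤ A * (# 4 * (e * # i) + # 12)
    0≤β i = 0≤A ⊗ (#≥0 4 ⊗ 0≤v i ⊕ #≥0 12)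
    0≤Φ : ∀ i → 0ℚ ≤ Φ i
    0≤Φ i = 0≤v i ⊕ 0≤v i ⊗ 0≤v i
    go : ∀ f i m a → Good f → m ℕ.+ a ≡ f → i ℕ.+ f ≡ T → K p (λ i _ → Φ i) f i m a ≤ early-bound e A θ₁ θ₂ i a
    go f i m zero good eq eqT = ≤-by (diff≥0 1≤A ⊗ 0≤Φ i) (ring (Φ i) A (# 4 * (e * # i) + # 12))
      where
      ring : ∀ x A b → x + (A - 1ℚ) * x ≡ A * x * 1ℚ + A * b * (1ℚ - 1ℚ)
      ring = solve-∀ ringℚ
    go zero i m (suc a) good eq eqT with () ← trans (sym (ℕₚ.+-suc m a)) eq
    go (suc f) i m (suc a) good eq eqT = [ proceed , (λ bad → ≤-trans (fallback f i m (suc a) good bad eq eqT)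
        (≤-by (0≤β i ⊗ diff≥0 (^-mono 0≤θ₂ θ₂≤θ₁ (suc a))) refl)) ]′ (dec f)
      where
      α β X Z Θ₁ Θ₂ : ℚ
      α = A * Φ (suc i)
      β = A * (# 4 * (e * # suc i) + # 12)
      X = q ^ℚ a * (θ₁ ^ℚ a * growth θ₁ ^ℚ m)
      Z = q ^ℚ a * (θ₂ ^ℚ a * growth θ₂ ^ℚ m)
      Θ₁ = θ₁ ^ℚ suc a
      Θ₂ = θ₂ ^ℚ suc a
      T≥ : suc f ℕ.≤ T
      T≥ = subst (suc f ℕ.≤_) eqT (ℕₚ.m≤n+m (suc f) i)
      0≤Θ₁ : 0ℚ ≤ Θ₁
      0≤Θ₁ = ^-nonNeg 0≤θ₁ (suc a)
      0≤Θ₂ : 0ℚ ≤ Θ₂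
      0≤Θ₂ = ^-nonNeg 0≤θ₂ (suc a)
      ring₀ : ∀ x y u v → x * u + y * (u - v) ≡ (x + y) * u + (- y) * v
      ring₀ = solve-∀ ringℚ
      ring₁ : ∀ z x y u v → z * (x * u + (- y) * v) ≡ x * (z * u) - y * (z * v)
      ring₁ = solve-∀ ringℚ
      ring₂ : ∀ x y u v e s t → x * u - y * v + (x * ((1ℚ - e) * s - u) + y * (v - (t - ½ * e * s))) ≡ x * ((1ℚ - e) * s) - y * (t - ½ * e * s)
      ring₂ = solve-∀ ringℚ
      ring₃ : ∀ A e i s t → (A * (e * (1ℚ + i) + e * (1ℚ + i) * (e * (1ℚ + i))) + A * (# 4 * (e * (1ℚ + i)) + # 12)) * ((1ℚ - e) * s) - A * (# 4 * (e * (1ℚ + i)) + # 12) * (t - ½ * e * s)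
         + (A * e * s * (1ℚ + e * i + # 2 * e + (e * i + e) * (e * i + e)) + # 4 * A * e * t) ≡
         A * (e * i + e * i * (e * i)) * s + A * (# 4 * (e * i) + # 12) * (s - t)
      ring₃ = solve-∀ ringℚ
      proceed : Good f → K p (λ i _ → Φ i) (suc f) i m (suc a) ≤ early-bound e A θ₁ θ₂ i (suc a)
      proceed good' = begin
        q ^ℚ a * Bin p m (λ k m' → K p (λ i _ → Φ i) f (suc i) m' (a ℕ.+ k))
          ≤⟨ *-monoʳ (^-nonNeg 0≤q a) (Bin-mono m λ k m' eq' → ≤-trans (go f (suc i) m' (a ℕ.+ k) good' (step-+ m' a k eq' eq) (shift-+ i f eqT))
               (≤-reflexive (ring₀ α β (θ₁ ^ℚ (a ℕ.+ k)) (θ₂ ^ℚ (a ℕ.+ k))))) ⟩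
        q ^ℚ a * Bin p m (λ k m' → (α + β) * θ₁ ^ℚ (a ℕ.+ k) + (- β) * θ₂ ^ℚ (a ℕ.+ k))
          ≡⟨ cong (q ^ℚ a *_) (trans (Bin-linear m (α + β) (- β)) (cong₂ (λ x y → (α + β) * x + (- β) * y) (Bin-exp m a θ₁) (Bin-exp m a θ₂))) ⟩
        q ^ℚ a * ((α + β) * (θ₁ ^ℚ a * growth θ₁ ^ℚ m) + (- β) * (θ₂ ^ℚ a * growth θ₂ ^ℚ m))
          ≡⟨ ring₁ (q ^ℚ a) (α + β) β _ _ ⟩
        (α + β) * X - β * Z
          ≤⟨ ≤-by ((0≤A ⊗ 0≤Φ (suc i) ⊕ 0≤β (suc i)) ⊗ diff≥0 (h₁ f m a good T≥ (pred-+ m a f eq)) ⊕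
                   0≤β (suc i) ⊗ diff≥0 (h₂ f m a T≥ (pred-+ m a f eq))) refl ⟩
        (α + β) * X - β * Z + ((α + β) * ((1ℚ - e) * Θ₁ - X) + β * (Z - (Θ₂ - ½ * e * Θ₁)))
          ≡⟨ trans (ring₂ (α + β) β X Z e Θ₁ Θ₂) (cong (λ z → (A * (e * z + e * z * (e * z)) + A * (# 4 * (e * z) + # 12)) * ((1ℚ - e) * Θ₁) - A * (# 4 * (e * z) + # 12) * (Θ₂ - ½ * e * Θ₁)) (#-suc i)) ⟩
        (A * (e * (1ℚ + # i) + e * (1ℚ + # i) * (e * (1ℚ + # i))) + A * (# 4 * (e * (1ℚ + # i)) + # 12)) * ((1ℚ - e) * Θ₁) - A * (# 4 * (e * (1ℚ + # i)) + # 12) * (Θ₂ - ½ * e * Θ₁)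
          -- Origin of 4 and 12: with `v = e i`, the net loss `½ e β = A e (2 (v + e) + 6)` of the
          -- second term must cover the increment `A e (1 + 2 v + e)` of the first coefficient and
          -- the increment `4 A e` of the second.
          ≤⟨ ≤-by (0≤A ⊗ 0≤e ⊗ 0≤Θ₁ ⊗ (0≤c 1ℚ ⊕ 0≤v i ⊕ #≥0 2 ⊗ 0≤e ⊕ square≥0 (e * # i + e)) ⊕ #≥0 4 ⊗ 0≤A ⊗ 0≤e ⊗ 0≤Θ₂) (ring₃ A e (# i) Θ₁ Θ₂) ⟩
        early-bound e A θ₁ θ₂ i (suc a) ∎


  -- Where 2 θ^a < 1 there is nothing to prove, and elsewhere a δ ≤ 1.
  r-lower-supercritical : ∀ {δ s} N → 0ℚ ≤ δ → 0ℚ ≤ 1ℚ - δ → 0ℚ ≤ s → s ≤ δ → p ≤ s * δ →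
    (∀ m → m ℕ.≤ N → 1ℚ - δ + s ≤ growth (1ℚ - δ) ^ℚ m) →
    ∀ f m a → m ℕ.≤ N → m ℕ.+ a ≡ f → # 2 * (1ℚ - δ) ^ℚ a - 1ℚ ≤ r p f m a
  r-lower-supercritical {δ} {s} N 0≤δ 0≤θ 0≤s s≤δ p≤ h = go
    where
    open ≤-Reasoning
    θ : ℚ
    θ = 1ℚ - δ
    go : ∀ f m a → m ℕ.≤ N → m ℕ.+ a ≡ f → # 2 * θ ^ℚ a - 1ℚ ≤ r p f m a
    go f m zero m≤N eq = ≤-refl
    go zero m (suc a) m≤N eq with () ← trans (sym (ℕₚ.+-suc m a)) eq
    go (suc f) m (suc a) m≤N eq = [ (λ small → ≤-trans (+-monoˡ-≤ (- 1ℚ) small) (r≥0 (suc f) m (suc a))) , proceed ]′ (≤-total (# 2 * θ ^ℚ suc a) 1ℚ)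
      where
      -- Reverse Bernoulli gives `θ^(a+1) (1 + a δ) ≤ 1`; as the power is at least one half,
      -- `1 + a δ ≤ 2`.
      aδ≤1 : 1ℚ ≤ # 2 * θ ^ℚ suc a → 0ℚ ≤ 1ℚ - # a * δ
      aδ≤1 large = ≤-trans (diff≥0 large ⊗ (0≤c 1ℚ ⊕ #≥0 a ⊗ 0≤δ) ⊕ #≥0 2 ⊗ diff≥0 aux) (≤-reflexive (ring₄ (θ ^ℚ suc a) (# a) δ))
        where
        aux : θ ^ℚ suc a * (1ℚ + # a * δ) ≤ 1ℚ
        aux = ≤-trans (≤-by (^-nonNeg 0≤θ (suc a) ⊗ 0≤δ) (trans (ring₅ (θ ^ℚ suc a) (# a) δ) (cong (λ z → θ ^ℚ suc a * (1ℚ + z * δ)) (sym (#-suc a)))))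
          (reverse-bernoulli {δ} 0≤θ (0≤c 1ℚ ⊕ 0≤δ) (suc a))
          where
          ring₅ : ∀ x a d → x * (1ℚ + a * d) + x * d ≡ x * (1ℚ + (1ℚ + a) * d)
          ring₅ = solve-∀ ringℚ
        ring₄ : ∀ x a d → (# 2 * x - 1ℚ) * (1ℚ + a * d) + # 2 * (1ℚ - x * (1ℚ + a * d)) ≡ 1ℚ - a * d
        ring₄ = solve-∀ ringℚ
      ring₁ : ∀ d s p a z x → # 2 * ((1ℚ - d) * x) - 1ℚ + (# 2 * x * ((z - (1ℚ - a * p)) * (1ℚ - d + s) + (a * p * (d - s) + a * (s * d - p) + s * (1ℚ - a * d))) + (1ℚ - z)) ≡
        # 2 * (z * (x * (1ℚ - d + s))) - z * 1ℚ
      ring₁ = solve-∀ ringℚ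
      ring₂ : ∀ z x y → # 2 * (z * x) - z * y ≡ z * (# 2 * x + (- 1ℚ) * y)
      ring₂ = solve-∀ ringℚ
      ring₃ : ∀ x → # 2 * x + (- 1ℚ) * 1ℚ ≡ # 2 * x - 1ℚ
      ring₃ = solve-∀ ringℚ
      proceed : 1ℚ ≤ # 2 * θ ^ℚ suc a → # 2 * θ ^ℚ suc a - 1ℚ ≤ r p (suc f) m (suc a)
      proceed large = begin
        # 2 * (θ * θ ^ℚ a) - 1ℚ
          -- The factor `q^a` costs about `a p ≤ a δ s`, and `a δ ≤ 1` lets the slack `s` in the
          -- growth hypothesis cover it.
          ≤⟨ ≤-by (#≥0 2 ⊗ ^-nonNeg 0≤θ a ⊗ (diff≥0 (bernoulli 0≤q a) ⊗ (0≤θ ⊕ 0≤s) ⊕ (#≥0 a ⊗ 0≤p ⊗ diff≥0 s≤δ ⊕ #≥0 a ⊗ diff≥0 p≤ ⊕ 0≤s ⊗ aδ≤1 large)) ⊕ diff≥0 (^-≤1 0≤q q≤1 a))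
               (ring₁ δ s p (# a) (q ^ℚ a) (θ ^ℚ a)) ⟩
        # 2 * (q ^ℚ a * (θ ^ℚ a * (θ + s))) - q ^ℚ a * 1ℚ
          ≤⟨ +-mono-≤ (*-monoʳ (#≥0 2) (*-monoʳ (^-nonNeg 0≤q a) (*-monoʳ (^-nonNeg 0≤θ a) (h m m≤N))))
               (neg-antimono-≤ (*-monoʳ (^-nonNeg 0≤q a) (≤-trans (≤-reflexive (*-identityˡ _)) (^-≤1 (growth≥0 (0≤c 1ℚ)) growth≤1 m)))) ⟩
        # 2 * (q ^ℚ a * (θ ^ℚ a * growth θ ^ℚ m)) - q ^ℚ a * (1ℚ * growth 1ℚ ^ℚ m)
          ≡⟨ ring₂ (q ^ℚ a) _ _ ⟩
        q ^ℚ a * (# 2 * (θ ^ℚ a * growth θ ^ℚ m) + (- 1ℚ) * (1ℚ * growth 1ℚ ^ℚ m))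
          ≡⟨ cong (q ^ℚ a *_) (sym (trans (Bin-linear m (# 2) (- 1ℚ)) (cong₂ (λ x y → # 2 * x + (- 1ℚ) * y) (Bin-exp m a θ) (Bin-exp m 0 1ℚ)))) ⟩
        q ^ℚ a * Bin p m (λ k m' → # 2 * θ ^ℚ (a ℕ.+ k) + (- 1ℚ) * 1ℚ ^ℚ k)
          ≤⟨ *-monoʳ (^-nonNeg 0≤q a) (Bin-mono m λ k m' e → ≤-trans (≤-reflexive (trans (cong (λ z → # 2 * θ ^ℚ (a ℕ.+ k) + (- 1ℚ) * z) (1^ k)) (ring₃ (θ ^ℚ (a ℕ.+ k)))))
               (go f m' (a ℕ.+ k) (ℕₚ.≤-trans (subst (m' ℕ.≤_) e (ℕₚ.m≤n+m m' k)) m≤N) (step-+ m' a k e eq))) ⟩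
        r p (suc f) m (suc a) ∎


  -- A growing exponential, which the drift `s` makes decrease in mean, is subtracted from `1 + x`.
  -- Contradictions cost at most `(a + 1) p` per step, `q^a` for the waiting literals and one
  -- further `q` for all double hits; the gain `x s θ^a ≥ x s t (a + 1)`, where `t ≤ 1` is used,
  -- pays for them.
  r-lower-subcritical : ∀ {t s x} N → 0ℚ ≤ t → t ≤ 1ℚ → 0ℚ ≤ s → 0ℚ ≤ x → (1ℚ + x) * p ≤ x * s * t →
    (∀ m → m ℕ.≤ N → growth (1ℚ + t) ^ℚ m ≤ 1ℚ + t - s) → (∀ m → m ℕ.≤ N → q ≤ growth 1ℚ ^ℚ m) →
    ∀ f m a → m ℕ.≤ N → m ℕ.+ a ≡ f → 1ℚ + x - x * (1ℚ + t) ^ℚ a ≤ r p f m a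
  r-lower-subcritical {t} {s} {x} N 0≤t t≤1 0≤s 0≤x px h h₁ = go
    where
    open ≤-Reasoning
    θ : ℚ
    θ = 1ℚ + t
    0≤θ : 0ℚ ≤ θ
    0≤θ = 0≤c 1ℚ ⊕ 0≤t
    go : ∀ f m a → m ℕ.≤ N → m ℕ.+ a ≡ f → 1ℚ + x - x * θ ^ℚ a ≤ r p f m a
    go f m zero m≤N eq = ≤-reflexive (ring x)
      where
      ring : ∀ x → 1ℚ + x - x * 1ℚ ≡ 1ℚ
      ring = solve-∀ ringℚ
    go zero m (suc a) m≤N eq with () ← trans (sym (ℕₚ.+-suc m a)) eq
    go (suc f) m (suc a) m≤N eq = begin
      1ℚ + x - x * (θ * θ ^ℚ a)
        ≤⟨ ≤-by ((0≤c 1ℚ ⊕ 0≤x) ⊗ diff≥0 (bernoulli {p} 0≤q (suc a)) ⊕ (0≤x ⊗ 0≤s ⊗ diff≥0 θ^a≥ ⊕ #≥0 (suc a) ⊗ diff≥0 px)) (ring₁ x t s p (# suc a) (θ ^ℚ a) (q ^ℚ suc a)) ⟩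
      (1ℚ + x) * (q * q ^ℚ a) - x * (1ℚ * (θ ^ℚ a * (θ - s)))
        ≤⟨ +-mono-≤ (≤-trans (≤-reflexive (cong ((1ℚ + x) *_) (*-comm q (q ^ℚ a)))) (*-monoʳ (0≤c 1ℚ ⊕ 0≤x) (*-monoʳ (^-nonNeg 0≤q a) (≤-trans (h₁ m m≤N) (≤-reflexive (sym (*-identityˡ _)))))))
             (neg-antimono-≤ (*-monoʳ 0≤x (*-mono-≤ (^-nonNeg 0≤q a) (^-≤1 0≤q q≤1 a) (^-nonNeg 0≤θ a ⊗ ^-nonNeg (growth≥0 0≤θ) m) (*-monoʳ (^-nonNeg 0≤θ a) (h m m≤N))))) ⟩
      (1ℚ + x) * (q ^ℚ a * (1ℚ * growth 1ℚ ^ℚ m)) - x * (q ^ℚ a * (θ ^ℚ a * growth θ ^ℚ m))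
        ≡⟨ ring₂ (1ℚ + x) x (q ^ℚ a) _ _ ⟩
      q ^ℚ a * ((1ℚ + x) * (1ℚ * growth 1ℚ ^ℚ m) + (- x) * (θ ^ℚ a * growth θ ^ℚ m))
        ≡⟨ cong (q ^ℚ a *_) (sym (trans (Bin-linear m (1ℚ + x) (- x)) (cong₂ (λ u y → (1ℚ + x) * u + (- x) * y) (Bin-exp m 0 1ℚ) (Bin-exp m a θ)))) ⟩
      q ^ℚ a * Bin p m (λ k m' → (1ℚ + x) * 1ℚ ^ℚ k + (- x) * θ ^ℚ (a ℕ.+ k))
        ≤⟨ *-monoʳ (^-nonNeg 0≤q a) (Bin-mono m λ k m' e → ≤-trans (≤-reflexive (trans (cong (λ z → (1ℚ + x) * z + (- x) * θ ^ℚ (a ℕ.+ k)) (1^ k)) (ring₃ x (θ ^ℚ (a ℕ.+ k)))))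
             (go f m' (a ℕ.+ k) (ℕₚ.≤-trans (subst (m' ℕ.≤_) e (ℕₚ.m≤n+m m' k)) m≤N) (step-+ m' a k e eq))) ⟩
      r p (suc f) m (suc a) ∎
      where
      θ^a≥ : # suc a * t ≤ θ ^ℚ a
      θ^a≥ = ≤-trans (≤-by (diff≥0 t≤1) (trans (cong (λ z → z * t + (1ℚ - t)) (#-suc a)) (ring₄ (# a) t))) (bernoulli⁺ 0≤θ a)
        where
        ring₄ : ∀ a t → (1ℚ + a) * t + (1ℚ - t) ≡ 1ℚ + a * t
        ring₄ = solve-∀ ringℚ
      ring₁ : ∀ x t s p b u z → 1ℚ + x - x * ((1ℚ + t) * u) + ((1ℚ + x) * (z - (1ℚ - b * p)) + (x * s * (u - b * t) + b * (x * s * t - (1ℚ + x) * p))) ≡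
        (1ℚ + x) * z - x * (1ℚ * (u * (1ℚ + t - s)))
      ring₁ = solve-∀ ringℚ
      ring₂ : ∀ y x z u v → y * (z * u) - x * (z * v) ≡ z * (y * u + (- x) * v)
      ring₂ = solve-∀ ringℚ
      ring₃ : ∀ x v → (1ℚ + x) * 1ℚ + (- x) * v ≡ 1ℚ + x - x * v
      ring₃ = solve-∀ ringℚ

1-cδ≥0 : ∀ {δ} c → 0ℚ ≤ c → δ ≤ + 1 / 1024 → 0ℚ ≤ 1ℚ - c * (+ 1 / 1024) → 0ℚ ≤ 1ℚ - c * δ
1-cδ≥0 {δ} c 0≤c small h = ≤-trans (h ⊕ 0≤c ⊗ diff≥0 small) (≤-reflexive (ring c δ (+ 1 / 1024)))
  where
  ring : ∀ c d k → 1ℚ - c * k + c * (k - d) ≡ 1ℚ - c * d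
  ring = solve-∀ ringℚ

1-δ≥0 : ∀ {δ} → δ ≤ + 1 / 1024 → 0ℚ ≤ 1ℚ - δ
1-δ≥0 small = diff≥0 (≤-trans small (diff≥0⁻¹ (0≤c (1ℚ - + 1 / 1024))))

-- B₀ δ is the value of early-bound at i = 0 and a = 1.
abstract
  B₀ : ℚ
  B₀ = # 4608 * # 12 * # 127

  B₀-def : # 4608 * # 12 * # 127 ≡ B₀
  B₀-def = refl

  1≤B₀ : 1ℚ ≤ B₀
  1≤B₀ = *-mono-≤ {1ℚ} {# 4608 * # 12} {1ℚ} {# 127} (0≤c 1ℚ) (*-mono-≤ {1ℚ} {# 4608} {1ℚ} {# 12} (0≤c 1ℚ) (diff≥0⁻¹ (0≤c (# 4608 - 1ℚ))) (0≤c 1ℚ) (diff≥0⁻¹ (0≤c (# 12 - 1ℚ)))) (0≤c 1ℚ) (diff≥0⁻¹ (0≤c (# 127 - 1ℚ)))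

-- Above the transition `ρ-step` is used with `D = 513 p / δ`: `2 * 256` comes from the bound
-- `256 δ` on `1 - ρ`, and the last 1 is spare. Together with the moment bound `B₀ δ` this makes the
-- increments of `ρ` at most `B₁ p`.
B₁ : ℚ
B₁ = # 513 * B₀

-- Estimates above the transition

module Supercritical (p : ℚ) (0≤p : 0ℚ ≤ p) (0≤q : 0ℚ ≤ 1ℚ - p) (n : ℕ) (δ : ℚ) (0<δ : 0ℚ < δ) (δ-small : δ ≤ + 1 / 1024)
  (p-n : p * # n ≡ ½ + # 8 * δ) (p≤δ³ : p ≤ δ * δ * δ) (n-large : 1ℚ ≤ δ * δ * δ * # n) where
  open Chain p 0≤p 0≤q
  open Moments p 0≤p 0≤q
  open Supersolutions p 0≤p 0≤q

  -- Besides a root close to 1, the equation `θ = growth θ ^ n` has one near `1 - 32 δ`. Between the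
  -- two roots, where `θ₁` lies, exponentials decrease in mean; below both, where `θ₂` lies, they do
  -- not. `A₀ = 2 * 48²` is what `fallback` needs.
  e θ₁ θ₂ A₀ : ℚ
  e = δ * δ
  θ₁ = 1ℚ - δ
  θ₂ = 1ℚ - # 128 * δ
  A₀ = # 4608

  private
    0≤δ : 0ℚ ≤ δ
    0≤δ = <⇒≤ 0<δ

    1-128δ : 0ℚ ≤ 1ℚ - # 128 * δ
    1-128δ = 1-cδ≥0 (# 128) (#≥0 128) δ-small (0≤c (1ℚ - # 128 * (+ 1 / 1024)))

    1-512δ : 0ℚ ≤ 1ℚ - # 512 * δ
    1-512δ = 1-cδ≥0 (# 512) (#≥0 512) δ-small (0≤c (1ℚ - # 512 * (+ 1 / 1024)))

    1-16δ : 0ℚ ≤ 1ℚ - # 16 * δ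
    1-16δ = 1-cδ≥0 (# 16) (#≥0 16) δ-small (0≤c (1ℚ - # 16 * (+ 1 / 1024)))

    1-δ : 0ℚ ≤ 1ℚ - δ
    1-δ = 1-δ≥0 δ-small

    δ²-p : 0ℚ ≤ δ * δ - p
    δ²-p = ≤-trans (diff≥0 p≤δ³ ⊕ 0≤δ ⊗ 0≤δ ⊗ 1-δ) (≤-reflexive (ring δ p))
      where
      ring : ∀ d p → d * d * d - p + d * d * (1ℚ - d) ≡ d * d - p
      ring = solve-∀ ringℚ

    δ-p : 0ℚ ≤ δ - p
    δ-p = ≤-trans (δ²-p ⊕ 0≤δ ⊗ 1-δ) (≤-reflexive (ring δ p))
      where
      ring : ∀ d p → d * d - p + d * (1ℚ - d) ≡ d - p
      ring = solve-∀ ringℚ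

    1/16-p : 0ℚ ≤ + 1 / 16 - p
    1/16-p = ≤-trans (0≤c (+ 1 / 16) ⊗ 1-16δ ⊕ δ-p) (≤-reflexive (ring δ p))
      where
      ring : ∀ d p → + 1 / 16 * (1ℚ - # 16 * d) + (d - p) ≡ + 1 / 16 - p
      ring = solve-∀ ringℚ

    0≤θ₁ : 0ℚ ≤ θ₁
    0≤θ₁ = 1-δ

    0≤θ₂ : 0ℚ ≤ θ₂
    0≤θ₂ = 1-128δ

  -- With x = p² + 256 p δ, growth θ₂ ≥ 1 - x ≥ (1 - y)² for y = (x + x²)/2, so the second-order term of
  -- (1 - n y)² provides the slack.
  growth-lower : ∀ m → m ℕ.≤ n → 1ℚ - # 128 * δ + # 1024 * (δ * δ) ≤ growth θ₂ ^ℚ m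
  growth-lower m m≤n = begin
    1ℚ - # 128 * δ + # 1024 * (δ * δ) ≤⟨ ≤-by (0≤t ⊗ 0≤t ⊗ 0≤t ⊗ (0≤c (+ 3 / 4) ⊕ 0≤c (+ 9 / 64) ⊗ 0≤t)) (trans (cong (_+ t * t * t * (+ 3 / 4 + + 9 / 64 * t)) (ring₀ δ)) (ring₁ t)) ⟩
    (1ℚ - τ) * (1ℚ - τ) ≤⟨ *-mono-≤ 0≤1-τ z^m≥ 0≤1-τ z^m≥ ⟩
    z ^ℚ m * z ^ℚ m ≡⟨ sym (^-* z z m) ⟩
    (z * z) ^ℚ m ≤⟨ ^-mono (square≥0 z) (≤-trans z²≤ growth≥) m ⟩
    growth θ₂ ^ℚ m ∎
    where
    open ≤-Reasoning
    t w x y z τ : ℚ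
    t = # 64 * δ
    w = p + # 256 * δ
    x = p * w
    y = ½ * x + ½ * (x * x)
    z = 1ℚ - y
    τ = t + + 3 / 8 * (t * t)
    0≤t : 0ℚ ≤ t
    0≤t = #≥0 64 ⊗ 0≤δ
    ring₀ : ∀ d → 1ℚ - # 128 * d + # 1024 * (d * d) ≡ 1ℚ - # 2 * (# 64 * d) + + 1 / 4 * (# 64 * d * (# 64 * d))
    ring₀ = solve-∀ ringℚ
    ring₁ : ∀ t → 1ℚ - # 2 * t + + 1 / 4 * (t * t) + t * t * t * (+ 3 / 4 + + 9 / 64 * t) ≡ (1ℚ - (t + + 3 / 8 * (t * t))) * (1ℚ - (t + + 3 / 8 * (t * t)))
    ring₁ = solve-∀ ringℚ
    0≤w : 0ℚ ≤ w
    0≤w = 0≤p ⊕ #≥0 256 ⊗ 0≤δ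
    1-w : 0ℚ ≤ 1ℚ - w
    1-w = ≤-trans (1-512δ ⊕ #≥0 255 ⊗ 0≤δ ⊕ δ-p) (≤-reflexive (ring δ p))
      where
      ring : ∀ d p → 1ℚ - # 512 * d + # 255 * d + (d - p) ≡ 1ℚ - (p + # 256 * d)
      ring = solve-∀ ringℚ
    0≤x : 0ℚ ≤ x
    0≤x = 0≤p ⊗ 0≤w
    1-x : 0ℚ ≤ 1ℚ - x
    1-x = ≤-trans (0≤q ⊗ 0≤w ⊕ 1-w) (≤-reflexive (ring p w))
      where
      ring : ∀ p w → (1ℚ - p) * w + (1ℚ - w) ≡ 1ℚ - p * w
      ring = solve-∀ ringℚ
    0≤y : 0ℚ ≤ y
    0≤y = 0≤c ½ ⊗ 0≤x ⊕ 0≤c ½ ⊗ (0≤x ⊗ 0≤x)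
    x-y : 0ℚ ≤ x - y
    x-y = ≤-trans (0≤c ½ ⊗ 0≤x ⊗ 1-x) (≤-reflexive (ring x))
      where
      ring : ∀ x → ½ * x * (1ℚ - x) ≡ x - (½ * x + ½ * (x * x))
      ring = solve-∀ ringℚ
    z²≤ : z * z ≤ 1ℚ - x
    z²≤ = ≤-by (x-y ⊗ (0≤x ⊕ 0≤y)) (ring x)
      where
      ring : ∀ x → (1ℚ - (½ * x + ½ * (x * x))) * (1ℚ - (½ * x + ½ * (x * x))) + (x - (½ * x + ½ * (x * x))) * (x + (½ * x + ½ * (x * x))) ≡ 1ℚ - x
      ring = solve-∀ ringℚ
    growth≥ : 1ℚ - x ≤ growth θ₂
    growth≥ = ≤-by (#≥0 256 ⊗ (0≤p ⊗ 0≤p ⊗ 0≤δ)) (ring p δ)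
      where
      ring : ∀ p d → 1ℚ - p * (p + # 256 * d) + # 256 * (p * p * d) ≡ (1ℚ - p) * (1ℚ - p + # 2 * p * (1ℚ - # 128 * d))
      ring = solve-∀ ringℚ
    ny≤τ : # n * y ≤ τ
    ny≤τ = ≤-trans (≤-reflexive (trans (ring p (# n) w) (cong (λ u → ½ * u * w * (1ℚ + p * w)) p-n)))
      (≤-by (δ²-p ⊕ #≥0 511 ⊗ (0≤δ ⊗ 0≤δ) ⊕ 0≤p ⊗ (0≤c (+ 1 / 4) ⊗ 1-16δ ⊕ 0≤c ½ ⊗ (0≤c ½ ⊗ 1-16δ ⊕ (0≤c ½ ⊕ #≥0 8 ⊗ 0≤δ) ⊗ (1-w ⊗ (0≤c 1ℚ ⊕ 0≤w))))) (ring′ p δ))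
      where
      ring : ∀ p n w → n * (½ * (p * w) + ½ * ((p * w) * (p * w))) ≡ ½ * (p * n) * w * (1ℚ + p * w)
      ring = solve-∀ ringℚ
      ring′ : ∀ p d → ½ * (½ + # 8 * d) * (p + # 256 * d) * (1ℚ + p * (p + # 256 * d)) +
        (d * d - p + # 511 * (d * d) + p * (+ 1 / 4 * (1ℚ - # 16 * d) + ½ * (½ * (1ℚ - # 16 * d) + (½ + # 8 * d) * ((1ℚ - (p + # 256 * d)) * (1ℚ + (p + # 256 * d))))))
        ≡ # 64 * d + + 3 / 8 * (# 64 * d * (# 64 * d))
      ring′ = solve-∀ ringℚ
    my≤τ : # m * y ≤ τ
    my≤τ = ≤-trans (*-monoˡ 0≤y (#-mono m≤n)) ny≤τ
    0≤1-τ : 0ℚ ≤ 1ℚ - τ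
    0≤1-τ = ≤-trans (1-128δ ⊕ #≥0 64 ⊗ 0≤δ ⊗ (1-128δ ⊕ #≥0 104 ⊗ 0≤δ)) (≤-reflexive (ring δ))
      where
      ring : ∀ d → 1ℚ - # 128 * d + # 64 * d * (1ℚ - # 128 * d + # 104 * d) ≡ 1ℚ - (# 64 * d + + 3 / 8 * (# 64 * d * (# 64 * d)))
      ring = solve-∀ ringℚ
    z^m≥ : 1ℚ - τ ≤ z ^ℚ m
    z^m≥ = ≤-trans (+-monoʳ-≤ 1ℚ (neg-antimono-≤ my≤τ)) (bernoulli {y} (≤-trans (1-x ⊕ x-y) (≤-reflexive (ring x y))) m)
      where
      ring : ∀ x y → 1ℚ - x + (x - y) ≡ 1ℚ - y
      ring = solve-∀ ringℚ

  -- The subsolution `2 θ₂^a - 1` at `a = 1`, with the slack `s = 1024 δ²` of `growth-lower`; 256 is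
  -- twice 128.
  ρ-lower : ∀ m → m ℕ.≤ n → 1ℚ - ρ p m ≤ # 256 * δ
  ρ-lower m m≤n = ≤-trans (≤-by (diff≥0 (r-lower-supercritical {# 128 * δ} {# 1024 * (δ * δ)} n (#≥0 128 ⊗ 0≤δ) 1-128δ (#≥0 1024 ⊗ (0≤δ ⊗ 0≤δ))
      (≤-by (#≥0 128 ⊗ 0≤δ ⊗ (1-16δ ⊕ #≥0 8 ⊗ 0≤δ)) (ring₁ δ))
      (≤-trans p≤δ³ (*-mono-≤ (0≤δ ⊗ 0≤δ) (≤-by (#≥0 1023 ⊗ (0≤δ ⊗ 0≤δ)) (ring₂ (δ * δ))) 0≤δ (≤-by (#≥0 127 ⊗ 0≤δ) (ring₄ δ))))
      growth-lower (suc m) m 1 m≤n (ℕₚ.+-comm m 1))) refl)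
    (≤-reflexive (ring₃ δ (ρ p m)))
    where
    ring₁ : ∀ d → # 1024 * (d * d) + # 128 * d * (1ℚ - # 16 * d + # 8 * d) ≡ # 128 * d
    ring₁ = solve-∀ ringℚ
    ring₂ : ∀ x → x + # 1023 * x ≡ # 1024 * x
    ring₂ = solve-∀ ringℚ
    ring₄ : ∀ x → x + # 127 * x ≡ # 128 * x
    ring₄ = solve-∀ ringℚ
    ring₃ : ∀ d r → 1ℚ - r + (r - (# 2 * ((1ℚ - # 128 * d) * 1ℚ) - 1ℚ)) ≡ # 256 * d
    ring₃ = solve-∀ ringℚ

  private
    -- The factor `q^a` costs a fraction up to `a p ≤ a δ³`, which is unbounded in `a`. But `θ₁`
    -- exceeds `θ₂ (1 + 2δ)`, so `½ δ² θ₁^(a+1)` is at least `(a + 1) δ³ θ₂^(a+1)`: the allowance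
    -- grows with `a` as well.
    hY : ∀ T → T ℕ.≤ n → ∀ f m a → suc f ℕ.≤ T → m ℕ.+ a ≡ f → θ₂ ^ℚ suc a - ½ * e * θ₁ ^ℚ suc a ≤ q ^ℚ a * (θ₂ ^ℚ a * growth θ₂ ^ℚ m)
    hY T T≤n f m a sf≤T eq = begin
      θ₂ * θ₂ ^ℚ a - ½ * e * θ₁ ^ℚ suc a
        ≤⟨ ≤-by (0≤c ½ ⊗ (0≤δ ⊗ 0≤δ) ⊗ diff≥0 tilt ⊕ (#≥0 a ⊗ diff≥0 p≤δ³ ⊕ 0≤δ ⊗ 0≤δ ⊗ 0≤δ ⊕ 0≤c ½ ⊗ (0≤δ ⊗ 0≤δ)) ⊗ ^-nonNeg 0≤θ₂ (suc a))
             (trans (cong (λ z → θ₂ * θ₂ ^ℚ a - ½ * e * θ₁ ^ℚ suc a + (½ * (δ * δ) * (θ₁ ^ℚ suc a - θ₂ ^ℚ suc a * (1ℚ + z * (# 2 * δ))) + (# a * (δ * δ * δ - p) + δ * δ * δ + ½ * (δ * δ)) * θ₂ ^ℚ suc a)) (#-suc a))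
               (ring₁ δ p (# a) (θ₁ ^ℚ suc a) (θ₂ ^ℚ a))) ⟩
      (1ℚ - # a * p) * (θ₂ ^ℚ a * θ₂)
        ≤⟨ *-monoˡ (^-nonNeg 0≤θ₂ a ⊗ 0≤θ₂) (bernoulli {p} 0≤q a) ⟩
      q ^ℚ a * (θ₂ ^ℚ a * θ₂)
        ≤⟨ *-monoʳ (^-nonNeg 0≤q a) (*-monoʳ (^-nonNeg 0≤θ₂ a) (≤-trans (≤-by (#≥0 1024 ⊗ (0≤δ ⊗ 0≤δ)) refl) (growth-lower m m≤n))) ⟩
      q ^ℚ a * (θ₂ ^ℚ a * growth θ₂ ^ℚ m) ∎
      where
      open ≤-Reasoning
      m≤n : m ℕ.≤ n
      m≤n = ℕₚ.≤-trans (subst (m ℕ.≤_) eq (ℕₚ.m≤m+n m a)) (ℕₚ.≤-trans (ℕₚ.n≤1+n f) (ℕₚ.≤-trans sf≤T T≤n))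
      tilt : θ₂ ^ℚ suc a * (1ℚ + # suc a * (# 2 * δ)) ≤ θ₁ ^ℚ suc a
      tilt = begin
        θ₂ ^ℚ suc a * (1ℚ + # suc a * (# 2 * δ)) ≤⟨ *-monoʳ (^-nonNeg 0≤θ₂ (suc a)) (bernoulli⁺ {# 2 * δ} 0≤1+2δ (suc a)) ⟩
        θ₂ ^ℚ suc a * (1ℚ + # 2 * δ) ^ℚ suc a ≡⟨ sym (^-* θ₂ (1ℚ + # 2 * δ) (suc a)) ⟩
        (θ₂ * (1ℚ + # 2 * δ)) ^ℚ suc a ≤⟨ ^-mono (0≤θ₂ ⊗ 0≤1+2δ) (≤-by (#≥0 125 ⊗ 0≤δ ⊕ #≥0 256 ⊗ (0≤δ ⊗ 0≤δ)) (ring δ)) (suc a) ⟩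
        θ₁ ^ℚ suc a ∎
        where
        0≤1+2δ : 0ℚ ≤ 1ℚ + # 2 * δ
        0≤1+2δ = 0≤c 1ℚ ⊕ #≥0 2 ⊗ 0≤δ
        ring : ∀ d → (1ℚ - # 128 * d) * (1ℚ + # 2 * d) + (# 125 * d + # 256 * (d * d)) ≡ 1ℚ - d
        ring = solve-∀ ringℚ
      ring₁ : ∀ d p a s t → (1ℚ - # 128 * d) * t - ½ * (d * d) * s + (½ * (d * d) * (s - (1ℚ - # 128 * d) * t * (1ℚ + (1ℚ + a) * (# 2 * d))) + (a * (d * d * d - p) + d * d * d + ½ * (d * d)) * ((1ℚ - # 128 * d) * t)) ≡
        (1ℚ - a * p) * (t * (1ℚ - # 128 * d))
      ring₁ = solve-∀ ringℚ

    -- With fuel `f`, the number of literals waiting and variables unexplored, `2 p f` plays the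
    -- role of the mean offspring number. Its excess over 1 is `16 δ` at `f = n`; the early phase
    -- lasts while half of this is left.
    Good Bad : ℕ → Set
    Good f = # 8 * δ ≤ # 2 * p * # f - 1ℚ
    Bad f = # 2 * p * # f - 1ℚ ≤ # 8 * δ

    -- Waiting literals are again traded for unexplored variables. With `growth θ₁ = 1 - x`,
    -- goodness gives `f x ≥ δ (1 + 8 δ)` up to terms in `p`, which half of the `8 δ` absorbs; then
    -- `(1 - δ²)(1 - δ)(1 + δ + 4 δ²) ≥ 1` leaves room for the loss `e`.
    hX : ∀ T f m a → Good (suc f) → suc f ℕ.≤ T → m ℕ.+ a ≡ f → q ^ℚ a * (θ₁ ^ℚ a * growth θ₁ ^ℚ m) ≤ (1ℚ - e) * θ₁ ^ℚ suc a
    hX T f m a good _ eq = begin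
      q ^ℚ a * (θ₁ ^ℚ a * g ^ℚ m)
        ≤⟨ *-monoˡ (^-nonNeg 0≤θ₁ a ⊗ ^-nonNeg 0≤g m) (^-mono 0≤q q≤g a) ⟩
      g ^ℚ a * (θ₁ ^ℚ a * g ^ℚ m)
        ≡⟨ trans (ring₁ (g ^ℚ a) (θ₁ ^ℚ a) (g ^ℚ m)) (cong (θ₁ ^ℚ a *_) (trans (sym (^-+ g m a)) (cong (g ^ℚ_) eq))) ⟩
      θ₁ ^ℚ a * g ^ℚ f
        ≤⟨ *-monoʳ (^-nonNeg 0≤θ₁ a) (≤-trans (≤-trans (≤-by (^-nonNeg 0≤g f ⊗ diff≥0 main) (ring₃ (g ^ℚ f) ((1ℚ - e) * θ₁ * (1ℚ + # f * x)))) (≤-reflexive (ring₄ (g ^ℚ f) ((1ℚ - e) * θ₁) (1ℚ + # f * x))))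
             (≤-trans (*-monoʳ (1-e ⊗ 0≤θ₁) rb) (≤-reflexive (*-identityʳ _)))) ⟩
      θ₁ ^ℚ a * ((1ℚ - e) * θ₁)
        ≡⟨ ring₁ (θ₁ ^ℚ a) (1ℚ - e) θ₁ ⟩
      (1ℚ - e) * θ₁ ^ℚ suc a ∎
      where
      open ≤-Reasoning
      g x : ℚ
      g = growth θ₁
      x = p * p + # 2 * p * δ * (1ℚ - p)
      0≤g : 0ℚ ≤ g
      0≤g = growth≥0 0≤θ₁
      1-e : 0ℚ ≤ 1ℚ - e
      1-e = ≤-trans (1-δ ⊕ 0≤δ ⊗ 1-δ) (≤-reflexive (ring δ))
        where
        ring : ∀ d → 1ℚ - d + d * (1ℚ - d) ≡ 1ℚ - d * d
        ring = solve-∀ ringℚ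
      q≤g : q ≤ g
      q≤g = ≤-by (0≤q ⊗ 0≤p ⊗ (1-16δ ⊕ #≥0 14 ⊗ 0≤δ)) (ring p δ)
        where
        ring : ∀ p d → (1ℚ - p) + (1ℚ - p) * p * (1ℚ - # 16 * d + # 14 * d) ≡ (1ℚ - p) * (1ℚ - p + # 2 * p * (1ℚ - d))
        ring = solve-∀ ringℚ
      g≡ : g ≡ 1ℚ - x
      g≡ = ring p δ
        where
        ring : ∀ p d → (1ℚ - p) * (1ℚ - p + # 2 * p * (1ℚ - d)) ≡ 1ℚ - (p * p + # 2 * p * d * (1ℚ - p))
        ring = solve-∀ ringℚ
      rb : g ^ℚ f * (1ℚ + # f * x) ≤ 1ℚ
      rb = subst (λ z → z ^ℚ f * (1ℚ + # f * x) ≤ 1ℚ) (sym g≡)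
        (reverse-bernoulli {x} (subst (0ℚ ≤_) g≡ 0≤g) (0≤c 1ℚ ⊕ (0≤p ⊗ 0≤p ⊕ #≥0 2 ⊗ 0≤p ⊗ 0≤δ ⊗ 0≤q)) f)
      fx≥ : δ * (1ℚ + # 4 * δ) ≤ # f * x
      fx≥ = ≤-by (#≥0 f ⊗ (0≤p ⊗ 0≤p) ⊕ 0≤δ ⊗ 0≤q ⊗ diff≥0 good ⊕ 0≤δ ⊗ (#≥0 4 ⊗ δ-p ⊕ 0≤p ⊗ (1-16δ ⊕ #≥0 8 ⊗ 0≤δ) ⊕ #≥0 2 ⊗ (0≤p ⊗ 0≤p)))
        (trans (cong (λ z → δ * (1ℚ + # 4 * δ) + (# f * (p * p) + δ * (1ℚ - p) * (# 2 * p * z - 1ℚ - # 8 * δ) + δ * (# 4 * (δ - p) + p * (1ℚ - # 16 * δ + # 8 * δ) + # 2 * (p * p)))) (#-suc f)) (ring δ p (# f)))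
        where
        ring : ∀ d p f → d * (1ℚ + # 4 * d) + (f * (p * p) + d * (1ℚ - p) * (# 2 * p * (1ℚ + f) - 1ℚ - # 8 * d) + d * (# 4 * (d - p) + p * (1ℚ - # 16 * d + # 8 * d) + # 2 * (p * p))) ≡ f * (p * p + # 2 * p * d * (1ℚ - p))
        ring = solve-∀ ringℚ
      main : 1ℚ ≤ (1ℚ - e) * θ₁ * (1ℚ + # f * x)
      main = ≤-trans (≤-by (0≤δ ⊗ 0≤δ ⊗ (1-16δ ⊕ #≥0 12 ⊗ 0≤δ) ⊕ 0≤δ ⊗ 0≤δ ⊗ (1-16δ ⊕ #≥0 13 ⊗ 0≤δ ⊕ #≥0 3 ⊗ 0≤δ ⊗ 1-δ) ⊕ #≥0 4 ⊗ (0≤δ ⊗ 0≤δ ⊗ 0≤δ ⊗ 0≤δ ⊗ 0≤δ)) (ring δ))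
        (*-monoʳ (1-e ⊗ 0≤θ₁) (+-monoʳ-≤ 1ℚ fx≥))
        where
        ring : ∀ d → 1ℚ + (d * d * (1ℚ - # 16 * d + # 12 * d) + d * d * (1ℚ - # 16 * d + # 13 * d + # 3 * d * (1ℚ - d)) + # 4 * (d * d * d * d * d)) ≡ (1ℚ - d * d) * (1ℚ - d) * (1ℚ + d * (1ℚ + # 4 * d))
        ring = solve-∀ ringℚ
      ring₁ : ∀ x y z → x * (y * z) ≡ y * (z * x)
      ring₁ = solve-∀ ringℚ
      ring₃ : ∀ x y → x + x * (y - 1ℚ) ≡ x * y
      ring₃ = solve-∀ ringℚ
      ring₄ : ∀ x y z → x * (y * z) ≡ y * (x * z)
      ring₄ = solve-∀ ringℚ

    excess : ℕ → ℚ
    excess f = # 2 * p * # f - 1ℚ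

    -- The factor 1/8 makes this tilt equal to `θ₁` at excess `8 δ`, where the early phase ends. It
    -- passes 1 at criticality and exceeds 1 once the process is subcritical. To second order,
    -- `growth θ ^ f` stays below `θ` by a multiple of `excess²` on both sides.
    θ : ℕ → ℚ
    θ f = 1ℚ - (+ 1 / 8) * excess f

    excess≥-1 : ∀ f → 0ℚ ≤ excess f + 1ℚ
    excess≥-1 f = ≤-trans (#≥0 2 ⊗ 0≤p ⊗ #≥0 f) (≤-reflexive (ring p (# f)))
      where
      ring : ∀ p f → # 2 * p * f ≡ # 2 * p * f - 1ℚ + 1ℚ
      ring = solve-∀ ringℚ

    excess≤16δ : ∀ f → f ℕ.≤ n → 0ℚ ≤ # 16 * δ - excess f
    excess≤16δ f f≤n = ≤-trans (#≥0 2 ⊗ 0≤p ⊗ diff≥0 (#-mono f≤n)) (≤-reflexive (trans (ring₁ p (# f) (# n)) (trans (cong (λ z → # 2 * z - # 2 * p * # f) p-n) (ring₂ δ p (# f)))))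
      where
      ring₁ : ∀ p f n → # 2 * p * (n - f) ≡ # 2 * (p * n) - # 2 * p * f
      ring₁ = solve-∀ ringℚ
      ring₂ : ∀ d p f → # 2 * (½ + # 8 * d) - # 2 * p * f ≡ # 16 * d - (# 2 * p * f - 1ℚ)
      ring₂ = solve-∀ ringℚ

    excess≤1 : ∀ f → f ℕ.≤ n → 0ℚ ≤ 1ℚ - excess f
    excess≤1 f f≤n = ≤-trans (1-16δ ⊕ excess≤16δ f f≤n) (≤-reflexive (ring δ (excess f)))
      where
      ring : ∀ d E → 1ℚ - # 16 * d + (# 16 * d - E) ≡ 1ℚ - E
      ring = solve-∀ ringℚ

    θ-suc : ∀ f → θ (suc f) ≡ 1ℚ - (+ 1 / 8) * excess f - (+ 1 / 4) * p
    θ-suc f = trans (cong (λ z → 1ℚ - (+ 1 / 8) * (# 2 * p * z - 1ℚ)) (#-suc f)) (ring p (# f))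
      where
      ring : ∀ p f → 1ℚ - (+ 1 / 8) * (# 2 * p * (1ℚ + f) - 1ℚ) ≡ 1ℚ - (+ 1 / 8) * (# 2 * p * f - 1ℚ) - (+ 1 / 4) * p
      ring = solve-∀ ringℚ

    3/4≤θ : ∀ f → f ℕ.≤ n → 0ℚ ≤ θ f - (+ 3 / 4)
    3/4≤θ f f≤n = ≤-trans (0≤c (+ 1 / 8) ⊗ excess≤1 f f≤n ⊕ 0≤c (+ 1 / 8)) (≤-reflexive (ring (excess f)))
      where
      ring : ∀ E → (+ 1 / 8) * (1ℚ - E) + (+ 1 / 8) ≡ 1ℚ - (+ 1 / 8) * E - (+ 3 / 4)
      ring = solve-∀ ringℚ

    0≤θ : ∀ f → f ℕ.≤ n → 0ℚ ≤ θ f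
    0≤θ f f≤n = ≤-trans (3/4≤θ f f≤n ⊕ 0≤c (+ 3 / 4)) (≤-reflexive (ring (θ f)))
      where
      ring : ∀ t → t - (+ 3 / 4) + (+ 3 / 4) ≡ t
      ring = solve-∀ ringℚ

    -- As `θ f ≥ 3/4`, the first factor is at least `1 + p/2`, while `θ` falls only by `p/4` when
    -- the fuel grows by one.
    θ-drift : ∀ f → f ℕ.≤ n → θ f ≤ (1ℚ - p + # 2 * p * θ f) * θ (suc f)
    θ-drift f f≤n = subst (λ z → θ f ≤ (1ℚ - p + # 2 * p * θ f) * z) (sym (θ-suc f))
      (≤-by (0≤p ⊗ ((#≥0 2 ⊗ 3/4≤θ f f≤n ⊕ 0≤c ½) ⊗ (3/4≤θ f f≤n ⊕ 0≤c (+ 1 / 4) ⊗ 0≤q) ⊕ 3/4≤θ f f≤n)) (ring p (θ f)))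
      where
      ring : ∀ p t → t + p * ((# 2 * (t - (+ 3 / 4)) + ½) * (t - (+ 3 / 4) + (+ 1 / 4) * (1ℚ - p)) + (t - (+ 3 / 4))) ≡ (1ℚ - p + # 2 * p * t) * (t - (+ 1 / 4) * p)
      ring = solve-∀ ringℚ

    -- The gain `excess²/16` is what allows the weight `Y` to grow with `i` away from criticality;
    -- at excess 0 there is none.
    θ-growth : ∀ f → f ℕ.≤ n → growth (θ f) ^ℚ f * (1ℚ + (+ 1 / 16) * (excess f * excess f)) ≤ θ (suc f)
    θ-growth f f≤n = begin
      g ^ℚ f * (1ℚ + (+ 1 / 16) * (E * E)) ≤⟨ *-monoʳ (^-nonNeg 0≤g f) main ⟩
      g ^ℚ f * (θ (suc f) * (1ℚ + # f * x)) ≡⟨ ring₀ (g ^ℚ f) (θ (suc f)) (1ℚ + # f * x) ⟩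
      θ (suc f) * (g ^ℚ f * (1ℚ + # f * x)) ≤⟨ *-monoʳ 0≤θ′ rb ⟩
      θ (suc f) * 1ℚ ≡⟨ *-identityʳ (θ (suc f)) ⟩
      θ (suc f) ∎
      where
      open ≤-Reasoning
      E g x : ℚ
      E = excess f
      g = growth (θ f)
      x = p * p + # 2 * p * ((+ 1 / 8) * E) * (1ℚ - p)
      0≤g : 0ℚ ≤ g
      0≤g = growth≥0 (0≤θ f f≤n)
      ring₀ : ∀ x y z → x * (y * z) ≡ y * (x * z)
      ring₀ = solve-∀ ringℚ
      0≤θ′ : 0ℚ ≤ θ (suc f)
      0≤θ′ = ≤-trans (3/4≤θ f f≤n ⊕ 0≤c (+ 1 / 4) ⊗ 0≤q ⊕ 0≤c ½) (≤-reflexive (trans (ring p (θ f)) (sym (θ-suc f))))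
        where
        ring : ∀ p t → t - (+ 3 / 4) + (+ 1 / 4) * (1ℚ - p) + ½ ≡ t - (+ 1 / 4) * p
        ring = solve-∀ ringℚ
      g≡ : g ≡ 1ℚ - x
      g≡ = ring p E
        where
        ring : ∀ p E → (1ℚ - p) * (1ℚ - p + # 2 * p * (1ℚ - (+ 1 / 8) * E)) ≡ 1ℚ - (p * p + # 2 * p * ((+ 1 / 8) * E) * (1ℚ - p))
        ring = solve-∀ ringℚ
      0≤1+x : 0ℚ ≤ 1ℚ + x
      0≤1+x = ≤-trans (0≤p ⊗ 0≤p ⊕ 0≤c (+ 1 / 4) ⊗ 0≤p ⊗ 0≤q ⊗ excess≥-1 f ⊕ 0≤q ⊗ (0≤q ⊕ 0≤c (+ 3 / 4) ⊗ 0≤p) ⊕ 0≤p) (≤-reflexive (ring p E))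
        where
        ring : ∀ p E → p * p + (+ 1 / 4) * p * (1ℚ - p) * (E + 1ℚ) + (1ℚ - p) * (1ℚ - p + (+ 3 / 4) * p) + p ≡ 1ℚ + (p * p + # 2 * p * ((+ 1 / 8) * E) * (1ℚ - p))
        ring = solve-∀ ringℚ
      rb : g ^ℚ f * (1ℚ + # f * x) ≤ 1ℚ
      rb = subst (λ z → z ^ℚ f * (1ℚ + # f * x) ≤ 1ℚ) (sym g≡) (reverse-bernoulli {x} (subst (0ℚ ≤_) g≡ 0≤g) 0≤1+x f)
      -- With `2 p f = 1 + E`, the terms on the right that are free of `p` are `1 + (7 E² - E³)/64`,
      -- at least `1 + 6/64 E²` because `E ≤ 1`. The remaining surplus and `E ≥ -1` take care of the
      -- terms in `p`.
      main : 1ℚ + (+ 1 / 16) * (E * E) ≤ θ (suc f) * (1ℚ + # f * x)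
      main = ≤-trans
        (≤-by (0≤c (+ 1 / 64) ⊗ square≥0 E ⊗ excess≤1 f f≤n ⊕ 0≤c (+ 63 / 8192) ⊗ square≥0 E ⊕ 0≤c (+ 193 / 512) ⊗ 1/16-p ⊗ square≥0 E ⊕
               0≤c (+ 1 / 64) ⊗ 0≤p ⊗ excess≥-1 f ⊗ square≥0 E ⊕ 0≤c (+ 1 / 8) ⊗ 0≤p ⊗ square≥0 (1ℚ + (+ 9 / 8) * E) ⊕
               0≤c (+ 1 / 4) ⊗ 0≤p ⊗ (1/16-p ⊕ 0≤c (+ 7 / 16) ⊕ 0≤p ⊗ (0≤c (+ 3 / 8) ⊗ excess≤1 f f≤n ⊕ 0≤c (+ 1 / 8) ⊕ 0≤c (+ 1 / 8) ⊗ square≥0 E)))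
          (ring₁ p E))
        (≤-reflexive (trans (ring₂ p (# f)) (cong (_* (1ℚ + # f * x)) (sym (θ-suc f)))))
        where
        ring₁ : ∀ p E → 1ℚ + (+ 1 / 16) * (E * E) +
           ((+ 1 / 64) * (E * E) * (1ℚ - E) + (+ 63 / 8192) * (E * E) + (+ 193 / 512) * (+ 1 / 16 - p) * (E * E) +
            (+ 1 / 64) * p * (E + 1ℚ) * (E * E) + (+ 1 / 8) * p * ((1ℚ + (+ 9 / 8) * E) * (1ℚ + (+ 9 / 8) * E)) +
            (+ 1 / 4) * p * (+ 1 / 16 - p + (+ 7 / 16) + p * ((+ 3 / 8) * (1ℚ - E) + (+ 1 / 8) + (+ 1 / 8) * (E * E)))) ≡
           (1ℚ - (+ 1 / 8) * E - (+ 1 / 4) * p) * (1ℚ + (1ℚ + E) * (½ * p + (+ 1 / 8) * E * (1ℚ - p)))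
        ring₁ = solve-∀ ringℚ
        ring₂ : ∀ p f → (1ℚ - (+ 1 / 8) * (# 2 * p * f - 1ℚ) - (+ 1 / 4) * p) * (1ℚ + (1ℚ + (# 2 * p * f - 1ℚ)) * (½ * p + (+ 1 / 8) * (# 2 * p * f - 1ℚ) * (1ℚ - p))) ≡
          (1ℚ - (+ 1 / 8) * (# 2 * p * f - 1ℚ) - (+ 1 / 4) * p) * (1ℚ + f * (p * p + # 2 * p * ((+ 1 / 8) * (# 2 * p * f - 1ℚ)) * (1ℚ - p)))
        ring₂ = solve-∀ ringℚ

    -- `e i ≤ v₀` means `i ≤ 48 δ n`. During these steps the excess may pass through 0, where
    -- `θ-growth` gains nothing, so `w` is held constant. After `48 δ n` steps the excess has
    -- dropped by at least `48 δ`, from at most `16 δ`.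
    v₀ : ℚ
    v₀ = # 48 * (δ * δ * δ * # n)

    48≤v₀ : 0ℚ ≤ v₀ - # 48
    48≤v₀ = ≤-trans (#≥0 48 ⊗ diff≥0 n-large) (≤-reflexive (ring (δ * δ * δ * # n)))
      where
      ring : ∀ x → # 48 * (x - 1ℚ) ≡ # 48 * x - # 48
      ring = solve-∀ ringℚ

    w : ℕ → ℚ
    w i = v₀ ⊔ e * # i

    1≤w : ∀ i → 0ℚ ≤ w i - 1ℚ
    1≤w i = ≤-trans (diff≥0 (p≤p⊔q v₀ (e * # i)) ⊕ 48≤v₀ ⊕ #≥0 47) (≤-reflexive (ring (w i) v₀))
      where
      ring : ∀ w v₀ → w - v₀ + (v₀ - # 48) + # 47 ≡ w - 1ℚ
      ring = solve-∀ ringℚ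

    0≤w : ∀ i → 0ℚ ≤ w i
    0≤w i = ≤-trans (1≤w i ⊕ 0≤c 1ℚ) (≤-reflexive (ring (w i)))
      where
      ring : ∀ w → w - 1ℚ + 1ℚ ≡ w
      ring = solve-∀ ringℚ

    Y : ℕ → ℚ
    Y i = # 2 * (w i * w i)

    0≤v : ∀ i → 0ℚ ≤ e * # i
    0≤v i = 0≤δ ⊗ 0≤δ ⊗ #≥0 i

    v-suc : ∀ i → e * # suc i ≡ e * # i + e
    v-suc i = trans (cong (e *_) (#-suc i)) (ring e (# i))
      where
      ring : ∀ e i → e * (1ℚ + i) ≡ e * i + e
      ring = solve-∀ ringℚ

    Φ≤Y : ∀ i → e * # i + e * # i * (e * # i) ≤ Y i
    Φ≤Y i = ≤-by (0≤w i ⊗ 1≤w i ⊕ diff≥0 (p≤q⊔p v₀ (e * # i)) ⊗ (0≤c 1ℚ ⊕ 0≤w i ⊕ 0≤v i)) (ring (w i) (e * # i))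
      where
      ring : ∀ w v → v + v * v + (w * (w - 1ℚ) + (w - v) * (1ℚ + w + v)) ≡ # 2 * (w * w)
      ring = solve-∀ ringℚ

    w-growth-below : ∀ i f → e * # suc i ≤ v₀ → w (suc i) * w (suc i) ≤ w i * w i * (1ℚ + (+ 1 / 16) * (excess f * excess f))
    w-growth-below i f v≤v₀ = ≤-trans (*-mono-≤ (0≤w (suc i)) w≤w (0≤w (suc i)) w≤w)
      (≤-by (0≤w i ⊗ 0≤w i ⊗ (0≤c (+ 1 / 16) ⊗ square≥0 (excess f))) (ring (w i * w i) (excess f)))
      where
      w≤w : w (suc i) ≤ w i
      w≤w = ≤-trans (≤-reflexive (p≥q⇒p⊔q≡p v≤v₀)) (p≤p⊔q v₀ (e * # i))
      ring : ∀ x E → x + x * (+ 1 / 16 * (E * E)) ≡ x * (1ℚ + (+ 1 / 16) * (E * E))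
      ring = solve-∀ ringℚ

    -- Beyond v₀ the process is subcritical by at least 32 δ.
    w-growth-above : ∀ i f → i ℕ.+ suc f ℕ.≤ n → v₀ ≤ e * # suc i → w (suc i) * w (suc i) ≤ w i * w i * (1ℚ + (+ 1 / 16) * (excess f * excess f))
    w-growth-above i f if≤n v₀≤v = ≤-trans (*-mono-≤ (0≤w (suc i)) w≤w+e (0≤w (suc i)) w≤w+e)
            (≤-by (0≤c (+ 1 / 16) ⊗ (0≤w i ⊗ 0≤w i) ⊗ (-32δ-E ⊗ (-32δ-E ⊕ #≥0 64 ⊗ 0≤δ)) ⊕
                   0≤δ ⊗ 0≤δ ⊗ (#≥0 61 ⊗ (0≤w i ⊗ 0≤w i) ⊕ #≥0 2 ⊗ (0≤w i ⊗ 1≤w i) ⊕ 1≤w i ⊗ (0≤w i ⊕ 0≤c 1ℚ) ⊕ 1-δ ⊗ (0≤c 1ℚ ⊕ 0≤δ)))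
              (ring₁ (w i) δ (excess f)))
      where
      w≤w+e : w (suc i) ≤ w i + e
      w≤w+e = ≤-trans (≤-reflexive (trans (p≤q⇒p⊔q≡q v₀≤v) (v-suc i))) (+-monoˡ-≤ e (p≤q⊔p v₀ (e * # i)))
      48δn≤ : # 48 * δ * # n ≤ # suc i
      48δn≤ = *-cancelˡ-≤ 0<δ (*-cancelˡ-≤ 0<δ (subst₂ _≤_ (ring₂ δ (# n)) (*-assoc δ δ (# suc i)) v₀≤v))
        where
        ring₂ : ∀ d n → # 48 * (d * d * d * n) ≡ d * (d * (# 48 * d * n))
        ring₂ = solve-∀ ringℚ
      if≤n′ : # suc i + # f ≤ # n
      if≤n′ = subst (_≤ # n) (trans (cong #_ (ℕₚ.+-suc i f)) (#-+ (suc i) f)) (#-mono if≤n)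
      -32δ-E : 0ℚ ≤ - (# 32 * δ) - excess f
      -32δ-E = ≤-trans (#≥0 2 ⊗ 0≤p ⊗ diff≥0 if≤n′ ⊕ #≥0 2 ⊗ 0≤p ⊗ diff≥0 48δn≤ ⊕ #≥0 768 ⊗ (0≤δ ⊗ 0≤δ))
        (≤-reflexive (trans (ring₃ p δ (# suc i) (# f) (# n)) (trans (cong (λ u → # 2 * u - # 96 * δ * u - # 2 * p * # f + # 768 * (δ * δ)) p-n) (ring₄ p δ (# f)))))
        where
        ring₃ : ∀ p d i f n → # 2 * p * (n - (i + f)) + # 2 * p * (i - # 48 * d * n) + # 768 * (d * d) ≡ # 2 * (p * n) - # 96 * d * (p * n) - # 2 * p * f + # 768 * (d * d)
        ring₃ = solve-∀ ringℚ
        ring₄ : ∀ p d f → # 2 * (½ + # 8 * d) - # 96 * d * (½ + # 8 * d) - # 2 * p * f + # 768 * (d * d) ≡ - (# 32 * d) - (# 2 * p * f - 1ℚ)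
        ring₄ = solve-∀ ringℚ
      ring₁ : ∀ w d E → (w + d * d) * (w + d * d) + (+ 1 / 16 * (w * w) * ((- (# 32 * d) - E) * (- (# 32 * d) - E + # 64 * d)) +
        d * d * (# 61 * (w * w) + # 2 * (w * (w - 1ℚ)) + (w - 1ℚ) * (w + 1ℚ) + (1ℚ - d) * (1ℚ + d))) ≡ w * w * (1ℚ + (+ 1 / 16) * (E * E))
      ring₁ = solve-∀ ringℚ

    w-growth : ∀ i f → i ℕ.+ suc f ℕ.≤ n → w (suc i) * w (suc i) ≤ w i * w i * (1ℚ + (+ 1 / 16) * (excess f * excess f))
    w-growth i f if≤n = [ w-growth-below i f , w-growth-above i f if≤n ]′ (≤-total (e * # suc i) v₀)

    late : ∀ T → T ℕ.≤ n → ∀ f i m a → m ℕ.+ a ≡ f → i ℕ.+ f ≡ T → K p (λ i _ → e * # i + e * # i * (e * # i)) f i m a ≤ Y i * θ f ^ℚ a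
    late T T≤n = late-supersolution T (λ i → e * # i + e * # i * (e * # i)) Y θ (λ i → #≥0 2 ⊗ (0≤w i ⊗ 0≤w i))
      (λ f f≤T → 0≤θ f (ℕₚ.≤-trans f≤T T≤n)) Φ≤Y
      (λ f sf≤T → θ-drift f (ℕₚ.≤-trans (ℕₚ.n≤1+n f) (ℕₚ.≤-trans sf≤T T≤n)))
      λ i f eqT → let f≤n = ℕₚ.≤-trans (ℕₚ.n≤1+n f) (ℕₚ.≤-trans (subst (suc f ℕ.≤_) eqT (ℕₚ.m≤n+m (suc f) i)) T≤n) in begin
        Y (suc i) * growth (θ f) ^ℚ f
          ≤⟨ *-monoˡ (^-nonNeg (growth≥0 (0≤θ f f≤n)) f) (*-monoʳ (#≥0 2) (w-growth i f (ℕₚ.≤-trans (ℕₚ.≤-reflexive eqT) T≤n))) ⟩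
        # 2 * (w i * w i * (1ℚ + (+ 1 / 16) * (excess f * excess f))) * growth (θ f) ^ℚ f
          ≡⟨ ring (w i * w i) (1ℚ + (+ 1 / 16) * (excess f * excess f)) (growth (θ f) ^ℚ f) ⟩
        Y i * (growth (θ f) ^ℚ f * (1ℚ + (+ 1 / 16) * (excess f * excess f)))
          ≤⟨ *-monoʳ (#≥0 2 ⊗ (0≤w i ⊗ 0≤w i)) (θ-growth f f≤n) ⟩
        Y i * θ (suc f) ∎
      where
      open ≤-Reasoning
      ring : ∀ x y z → # 2 * (x * y) * z ≡ # 2 * x * (z * y)
      ring = solve-∀ ringℚ

    -- When the early phase ends, i is of order δ n.
    fallback : ∀ T → T ℕ.≤ n → # 12 * δ ≤ excess T → ∀ f i m a → Good (suc f) → Bad f → m ℕ.+ a ≡ suc f → i ℕ.+ suc f ≡ T →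
      K p (λ i _ → e * # i + e * # i * (e * # i)) (suc f) i m a ≤ A₀ * (e * # i + e * # i * (e * # i)) * θ₁ ^ℚ a
    fallback T T≤n start f i m a good bad eq eqT = ≤-trans (late T T≤n (suc f) i m a eq eqT)
      (*-mono-≤ (#≥0 2 ⊗ (0≤w i ⊗ 0≤w i)) Y≤ (^-nonNeg (0≤θ (suc f) (ℕₚ.≤-trans (subst (suc f ℕ.≤_) eqT (ℕₚ.m≤n+m (suc f) i)) T≤n)) a)
        (^-mono (0≤θ (suc f) (ℕₚ.≤-trans (subst (suc f ℕ.≤_) eqT (ℕₚ.m≤n+m (suc f) i)) T≤n)) θ≤θ₁ a))
      where
      θ≤θ₁ : θ (suc f) ≤ θ₁
      θ≤θ₁ = ≤-by (0≤c (+ 1 / 8) ⊗ diff≥0 good) (ring δ (excess (suc f)))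
        where
        ring : ∀ d E → 1ℚ - (+ 1 / 8) * E + (+ 1 / 8) * (E - # 8 * d) ≡ 1ℚ - d
        ring = solve-∀ ringℚ
      v : ℚ
      v = e * # i
      -- The excess drops by `2 p` per unit of fuel, from at least `12 δ` at `T` to at most `8 δ` at
      -- `f`, and `T = i + 1 + f`.
      4δ≤ : # 4 * δ ≤ # 2 * p * (# i + 1ℚ)
      4δ≤ = ≤-by (diff≥0 start ⊕ diff≥0 bad) (trans (cong (λ z → # 4 * δ + (# 2 * p * z - 1ℚ - # 12 * δ + (# 8 * δ - (# 2 * p * # f - 1ℚ)))) #T) (ring δ p (# i) (# f)))
        where
        #T : # T ≡ # i + (1ℚ + # f)
        #T = trans (cong #_ (sym eqT)) (trans (#-+ i (suc f)) (cong (λ z → # i + z) (#-suc f)))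
        ring : ∀ d p i f → # 4 * d + (# 2 * p * (i + (1ℚ + f)) - 1ℚ - # 12 * d + (# 8 * d - (# 2 * p * f - 1ℚ))) ≡ # 2 * p * (i + 1ℚ)
        ring = solve-∀ ringℚ
      -- `4δ≤` is multiplied by `24 δ² n`, which turns `4 δ` into `2 v₀`. One of these two copies,
      -- being at least 48, absorbs the `48 e` by which `i + 1` differs from `i`.
      v₀≤48v : v₀ ≤ # 48 * v
      v₀≤48v = ≤-by (#≥0 24 ⊗ (0≤δ ⊗ 0≤δ ⊗ #≥0 n) ⊗ diff≥0 4δ≤ ⊕ #≥0 24 ⊗ (1-16δ ⊗ (0≤δ ⊗ 0≤δ ⊗ (#≥0 i ⊕ 0≤c 1ℚ))) ⊕ (48≤v₀ ⊕ #≥0 48 ⊗ 1-e)) ring₁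
        where
        1-e : 0ℚ ≤ 1ℚ - e
        1-e = ≤-trans (1-δ ⊗ (0≤c 1ℚ ⊕ 0≤δ)) (≤-reflexive (ring δ))
          where
          ring : ∀ d → (1ℚ - d) * (1ℚ + d) ≡ 1ℚ - d * d
          ring = solve-∀ ringℚ
        ring₁ : v₀ + (# 24 * (δ * δ * # n) * (# 2 * p * (# i + 1ℚ) - # 4 * δ) + # 24 * ((1ℚ - # 16 * δ) * (δ * δ * (# i + 1ℚ))) + (v₀ - # 48 + # 48 * (1ℚ - e))) ≡ # 48 * v
        ring₁ = trans (ring₃ δ p (# i) (# n)) (trans (cong (λ u → # 48 * (δ * δ) * u * (# i + 1ℚ) + # 24 * ((1ℚ - # 16 * δ) * (δ * δ * (# i + 1ℚ))) - # 48 * (δ * δ)) p-n) (ring₄ δ (# i)))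
          where
          ring₃ : ∀ d p i n → # 48 * (d * d * d * n) + (# 24 * (d * d * n) * (# 2 * p * (i + 1ℚ) - # 4 * d) + # 24 * ((1ℚ - # 16 * d) * (d * d * (i + 1ℚ))) + (# 48 * (d * d * d * n) - # 48 + # 48 * (1ℚ - d * d))) ≡
            # 48 * (d * d) * (p * n) * (i + 1ℚ) + # 24 * ((1ℚ - # 16 * d) * (d * d * (i + 1ℚ))) - # 48 * (d * d)
          ring₃ = solve-∀ ringℚ
          ring₄ : ∀ d i → # 48 * (d * d) * (½ + # 8 * d) * (i + 1ℚ) + # 24 * ((1ℚ - # 16 * d) * (d * d * (i + 1ℚ))) - # 48 * (d * d) ≡ # 48 * (d * d * i)
          ring₄ = solve-∀ ringℚ
      w≤48v : w i ≤ # 48 * v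
      w≤48v = ⊔-lub v₀≤48v (≤-by (#≥0 47 ⊗ 0≤v i) (ring v))
        where
        ring : ∀ v → v + # 47 * v ≡ # 48 * v
        ring = solve-∀ ringℚ
      Y≤ : Y i ≤ A₀ * (v + v * v)
      Y≤ = ≤-trans (*-monoʳ (#≥0 2) (*-mono-≤ (0≤w i) w≤48v (0≤w i) w≤48v)) (≤-by (#≥0 4608 ⊗ 0≤v i) (ring v))
        where
        ring : ∀ v → # 2 * (# 48 * v * (# 48 * v)) + # 4608 * v ≡ # 4608 * (v + v * v)
        ring = solve-∀ ringℚ

    moment-bound : ∀ k → suc k ℕ.≤ n → # 12 * δ ≤ excess (suc k) → moment e p k ≤ B₀ * δ
    moment-bound k k<n start = ≤-trans
      (early-supersolution {e} {A₀} {θ₁} {θ₂} (suc k) Good Bad (0≤δ ⊗ 0≤δ) (diff≥0⁻¹ (0≤c (A₀ - 1ℚ))) 0≤θ₂ (≤-by (#≥0 127 ⊗ 0≤δ) (ring₁ δ))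
        (λ f → ≤-total _ _) (hX (suc k)) (hY (suc k) k<n) (fallback (suc k) k<n start)
        (suc k) 0 k 1 (≤-trans (≤-by (#≥0 4 ⊗ 0≤δ) (ring₂ δ)) start) (ℕₚ.+-comm k 1) refl)
      (≤-reflexive (trans (ring₃ A₀ δ) (cong (_* δ) B₀-def)))
      where
      ring₁ : ∀ d → 1ℚ - # 128 * d + # 127 * d ≡ 1ℚ - d
      ring₁ = solve-∀ ringℚ
      ring₂ : ∀ d → # 8 * d + # 4 * d ≡ # 12 * d
      ring₂ = solve-∀ ringℚ
      ring₃ : ∀ A d → A * (d * d * 0ℚ + d * d * 0ℚ * (d * d * 0ℚ)) * ((1ℚ - d) * 1ℚ) + A * (# 4 * (d * d * 0ℚ) + # 12) * ((1ℚ - d) * 1ℚ - (1ℚ - # 128 * d) * 1ℚ) ≡ A * # 12 * # 127 * d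
      ring₃ = solve-∀ ringℚ

  covariance-bound : ∀ y → δ * y ≡ 1ℚ → ∀ n₂ → suc (suc n₂) ≡ n →
    K p (λ _ m → ρ p m) (suc n₂) 0 n₂ 1 - ρ p (suc n₂) * ρ p (suc n₂) ≤ B₁ * p * (B₀ * y) + B₁ * p
  covariance-bound y δy n₂ n≡ = covariance≤ n₂ 0≤d lipschitz
    (mean≤ n₂ (subst (_< δ * δ) (*-zeroʳ δ) (*-monoʳ-<-pos δ {{positive 0<δ}} 0<δ))
      (≤-trans (moment-bound n₂ (ℕₚ.≤-trans (ℕₚ.n≤1+n (suc n₂)) (ℕₚ.≤-reflexive n≡)) (start (suc n₂) 1 (trans (ℕₚ.+-comm (suc n₂) 1) n≡) (≤-trans (≤-reflexive (ring₁ p)) (≤-by (#≥0 2 ⊗ δ-p ⊕ #≥0 2 ⊗ 0≤δ) (ring₂ p δ)))))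
        (≤-reflexive (sym (ring₃ δ y B₀ δy)))))
    (step n₂ (start (suc n₂) 1 (trans (ℕₚ.+-comm (suc n₂) 1) n≡) (≤-trans (≤-reflexive (ring₁ p)) (≤-by (#≥0 2 ⊗ δ-p ⊕ #≥0 2 ⊗ 0≤δ) (ring₂ p δ)))) (ℕₚ.≤-trans (ℕₚ.n≤1+n (suc n₂)) (ℕₚ.≤-reflexive n≡))) 0≤d
    where
    ring₁ : ∀ p → # 2 * p * # 1 ≡ # 2 * p
    ring₁ = solve-∀ ringℚ
    ring₂ : ∀ p d → # 2 * p + (# 2 * (d - p) + # 2 * d) ≡ # 4 * d
    ring₂ = solve-∀ ringℚ
    ring₃ : ∀ d y B → d * y ≡ 1ℚ → B * y * (d * d) ≡ B * d
    ring₃ d y B eq = trans (ring d y B) (trans (cong (λ u → B * d * u) eq) (*-identityʳ (B * d)))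
      where
      ring : ∀ d y B → B * y * (d * d) ≡ B * d * (d * y)
      ring = solve-∀ ringℚ
    0≤B₀ : 0ℚ ≤ B₀
    0≤B₀ = ≤-trans (0≤c 1ℚ) 1≤B₀
    0≤B₁ : 0ℚ ≤ B₁
    0≤B₁ = #≥0 513 ⊗ 0≤B₀
    d D : ℚ
    d = B₁ * p
    D = # 513 * p * y
    0≤d : 0ℚ ≤ d
    0≤d = 0≤B₁ ⊗ 0≤p
    0≤y : 0ℚ ≤ y
    0≤y = *-cancelˡ-≤ 0<δ (≤-trans (≤-reflexive (*-zeroʳ δ)) (≤-trans (0≤c 1ℚ) (≤-reflexive (sym δy))))
    start : ∀ m i → m ℕ.+ i ≡ n → # 2 * p * # i ≤ # 4 * δ → # 12 * δ ≤ excess m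
    start m i eq le = ≤-by (diff≥0 le) (trans (cong (λ z → # 12 * δ + (# 4 * δ - z)) refl) (trans (ring p δ (# m) (# i)) (trans (cong (λ z → # 16 * δ - z + (# 2 * p * # m)) (trans (ring′ p (# m) (# i)) (trans (cong (λ z → # 2 * (p * z)) (trans (sym (#-+ m i)) (cong #_ eq))) (cong (# 2 *_) p-n)))) (ring″ δ p (# m)))))
      where
      ring : ∀ p d m i → # 12 * d + (# 4 * d - # 2 * p * i) ≡ # 16 * d - (# 2 * p * m + # 2 * p * i) + # 2 * p * m
      ring = solve-∀ ringℚ
      ring′ : ∀ p m i → # 2 * p * m + # 2 * p * i ≡ # 2 * (p * (m + i))
      ring′ = solve-∀ ringℚ
      ring″ : ∀ d p m → # 16 * d - # 2 * (½ + # 8 * d) + # 2 * p * m ≡ # 2 * p * m - 1ℚ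
      ring″ = solve-∀ ringℚ
    step : ∀ k → # 12 * δ ≤ excess (suc k) → suc k ℕ.≤ n → ρ p k - ρ p (suc k) ≤ d
    step k s k<n = ≤-trans
      (ρ-step {# 256 * δ} {D} {B₀ * δ} {e} k (0≤δ ⊗ 0≤δ) (#≥0 513 ⊗ 0≤p ⊗ 0≤y) (λ m m≤ → ρ-lower m (ℕₚ.≤-trans m≤ k<n))
        (≤-trans (≤-by (0≤p ⊗ 0≤δ) (ring₄ p δ)) (≤-reflexive (sym (trans (ring₅ p y δ) (cong (λ u → # 513 * p * δ * u) δy)))))
        (≤-trans (≤-trans (*-monoʳ 0≤p p≤δ³) (≤-by (#≥0 512 ⊗ (0≤p ⊗ (0≤δ ⊗ 0≤δ ⊗ 0≤δ))) (ring₆ p δ)))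
          (≤-reflexive (sym (trans (ring₇ p y δ) (cong (λ u → # 513 * p * (δ * δ * δ) * u) δy)))))
        (moment-bound k k<n s))
      (≤-reflexive (trans (ring₈ p y δ B₀) (trans (cong (λ u → B₁ * p * u) δy) (*-identityʳ d))))
      where
      ring₄ : ∀ p d → # 2 * p * (# 256 * d) + p * d ≡ # 513 * p * d * 1ℚ
      ring₄ = solve-∀ ringℚ
      ring₅ : ∀ p y d → # 513 * p * y * (d * d) ≡ # 513 * p * d * (d * y)
      ring₅ = solve-∀ ringℚ
      ring₆ : ∀ p d → p * (d * d * d) + # 512 * (p * (d * d * d)) ≡ # 513 * p * (d * d * d) * 1ℚ
      ring₆ = solve-∀ ringℚ
      ring₇ : ∀ p y d → # 513 * p * y * (d * d * (d * d)) ≡ # 513 * p * (d * d * d) * (d * y)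
      ring₇ = solve-∀ ringℚ
      ring₈ : ∀ p y d B → # 513 * p * y * (B * d) ≡ # 513 * B * p * (d * y)
      ring₈ = solve-∀ ringℚ
    -- Increments of `ρ` are controlled only while the excess is at least `12 δ`, that is for
    -- `2 p i ≤ 4 δ`. For larger `i` the trivial `ρ ≤ 1` suffices, since `1 - ρ ≤ 256 δ ≤ 128 p i`.
    lipschitz : ∀ i m → i ℕ.+ m ≡ suc n₂ → ρ p m ≤ ρ p (suc n₂) + d * # i
    lipschitz i m eq = [ near , far ]′ (≤-total (# 2 * p * # i) (# 4 * δ))
      where
      m+i≡ : m ℕ.+ i ≡ suc n₂
      m+i≡ = trans (ℕₚ.+-comm m i) eq
      n₁≤n : suc n₂ ℕ.≤ n
      n₁≤n = ℕₚ.≤-trans (ℕₚ.n≤1+n (suc n₂)) (ℕₚ.≤-reflexive n≡)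
      near : # 2 * p * # i ≤ # 4 * δ → ρ p m ≤ ρ p (suc n₂) + d * # i
      near le = subst (λ z → ρ p m ≤ ρ p z + d * # i) m+i≡
        (ρ-steps m i λ k m≤k k< → step k
          (≤-trans (start (suc m) i (trans (cong suc m+i≡) n≡) le) (+-monoˡ-≤ (- 1ℚ) (*-monoʳ (#≥0 2 ⊗ 0≤p) (#-mono (ℕ.s≤s m≤k)))))
          (ℕₚ.≤-trans (subst (suc k ℕ.≤_) m+i≡ k<) n₁≤n))
      far : # 4 * δ ≤ # 2 * p * # i → ρ p m ≤ ρ p (suc n₂) + d * # i
      far ge = ≤-trans (r≤1 (suc m) m 1)
        (≤-by (diff≥0 (ρ-lower (suc n₂) n₁≤n) ⊕ #≥0 64 ⊗ diff≥0 ge ⊕ (#≥0 513 ⊗ diff≥0 1≤B₀ ⊕ #≥0 385) ⊗ 0≤p ⊗ #≥0 i) (ring δ p (# i) (ρ p (suc n₂)) B₀))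
        where
        ring : ∀ d p i r B → 1ℚ + (# 256 * d - (1ℚ - r) + # 64 * (# 2 * p * i - # 4 * d) + (# 513 * (B - 1ℚ) + # 385) * p * i) ≡ r + # 513 * B * p * i
        ring = solve-∀ ringℚ

-- Estimates below the transition

module Subcritical (p : ℚ) (0≤p : 0ℚ ≤ p) (0≤q : 0ℚ ≤ 1ℚ - p) (n : ℕ) (δ : ℚ) (0<δ : 0ℚ < δ) (δ-small : δ ≤ + 1 / 1024)
  (p-n : p * # n ≡ ½ - # 8 * δ) (p≤δ³ : # 2 * p ≤ δ * δ * δ) (y : ℚ) (δy : δ * y ≡ 1ℚ) where
  open Chain p 0≤p 0≤q
  open Moments p 0≤p 0≤q
  open Supersolutions p 0≤p 0≤q

  private
    e θ₁ : ℚ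
    e = δ * δ
    θ₁ = 1ℚ + δ

    0≤δ : 0ℚ ≤ δ
    0≤δ = <⇒≤ 0<δ

    1-16δ : 0ℚ ≤ 1ℚ - # 16 * δ
    1-16δ = 1-cδ≥0 (# 16) (#≥0 16) δ-small (0≤c (1ℚ - # 16 * (+ 1 / 1024)))

    1-δ : 0ℚ ≤ 1ℚ - δ
    1-δ = 1-δ≥0 δ-small

    0≤θ₁ : 0ℚ ≤ θ₁
    0≤θ₁ = 0≤c 1ℚ ⊕ 0≤δ

    1-e : 0ℚ ≤ 1ℚ - e
    1-e = ≤-trans (1-δ ⊗ 0≤θ₁) (≤-reflexive (ring δ))
      where
      ring : ∀ d → (1ℚ - d) * (1ℚ + d) ≡ 1ℚ - d * d
      ring = solve-∀ ringℚ

    0≤y : 0ℚ ≤ y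
    0≤y = *-cancelˡ-≤ 0<δ (≤-trans (≤-reflexive (*-zeroʳ δ)) (≤-trans (0≤c 1ℚ) (≤-reflexive (sym δy))))

    1≤y : 0ℚ ≤ y - 1ℚ
    1≤y = ≤-trans (0≤y ⊗ 1-δ) (≤-reflexive (trans (ring δ y) (cong (λ u → y - u) δy)))
      where
      ring : ∀ d y → y * (1ℚ - d) ≡ y - d * y
      ring = solve-∀ ringℚ

    -- Reverse Bernoulli at a negative argument: `(1 + z)^m (1 - m z) ≤ 1` for `z = 2 p δ`, where
    -- `m z ≤ δ (1 - 16 δ)`. The drift `16 δ²` outweighs both the second-order terms and the
    -- fraction `e = δ²`.
    growth-upper : ∀ m → m ℕ.≤ n → growth θ₁ ^ℚ m ≤ (1ℚ - e) * θ₁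
    growth-upper m m≤n = begin
      growth θ₁ ^ℚ m
        ≤⟨ ^-mono (growth≥0 0≤θ₁) (≤-by (0≤p ⊗ 0≤p ⊗ (0≤c 1ℚ ⊕ #≥0 2 ⊗ 0≤δ)) (ring₀ p δ)) m ⟩
      g ^ℚ m
        ≤⟨ ≤-by (^-nonNeg 0≤g m ⊗ diff≥0 main) (ring₁ (g ^ℚ m) ((1ℚ - e) * θ₁) (1ℚ + # m * - z)) ⟩
      (1ℚ - e) * θ₁ * (g ^ℚ m * (1ℚ + # m * - z))
        ≤⟨ *-monoʳ (1-e ⊗ 0≤θ₁) rb ⟩
      (1ℚ - e) * θ₁ * 1ℚ
        ≡⟨ *-identityʳ ((1ℚ - e) * θ₁) ⟩
      (1ℚ - e) * θ₁ ∎
      where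
      open ≤-Reasoning
      z g : ℚ
      z = # 2 * p * δ
      g = 1ℚ - - z
      0≤z : 0ℚ ≤ z
      0≤z = #≥0 2 ⊗ 0≤p ⊗ 0≤δ
      0≤g : 0ℚ ≤ g
      0≤g = ≤-trans (0≤c 1ℚ ⊕ 0≤z) (≤-reflexive (ring z))
        where
        ring : ∀ z → 1ℚ + z ≡ 1ℚ - - z
        ring = solve-∀ ringℚ
      ring₀ : ∀ p d → (1ℚ - p) * (1ℚ - p + # 2 * p * (1ℚ + d)) + p * p * (1ℚ + # 2 * d) ≡ 1ℚ - - (# 2 * p * d)
      ring₀ = solve-∀ ringℚ
      rb : g ^ℚ m * (1ℚ + # m * - z) ≤ 1ℚ
      rb = reverse-bernoulli { - z} 0≤g (≤-trans (1-16δ ⊕ 0≤δ ⊗ (#≥0 14 ⊕ #≥0 2 ⊗ 0≤q)) (≤-reflexive (ring p δ))) m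
        where
        ring : ∀ p d → 1ℚ - # 16 * d + d * (# 14 + # 2 * (1ℚ - p)) ≡ 1ℚ + - (# 2 * p * d)
        ring = solve-∀ ringℚ
      nz : 1ℚ - δ * (1ℚ - # 16 * δ) ≤ 1ℚ + # m * - z
      nz = ≤-by (0≤z ⊗ diff≥0 (#-mono m≤n)) (trans (ring₂ p δ (# m) (# n)) (trans (cong (λ u → 1ℚ - δ * (1ℚ - # 16 * δ) + # 2 * δ * u + # m * - z) p-n) (ring₃ δ (# m * - z))))
        where
        ring₂ : ∀ p d m n → 1ℚ - d * (1ℚ - # 16 * d) + # 2 * p * d * (n - m) ≡ 1ℚ - d * (1ℚ - # 16 * d) + # 2 * d * (p * n) + m * - (# 2 * p * d)
        ring₂ = solve-∀ ringℚ
        ring₃ : ∀ d z → 1ℚ - d * (1ℚ - # 16 * d) + # 2 * d * (½ - # 8 * d) + z ≡ 1ℚ + z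
        ring₃ = solve-∀ ringℚ
      main : 1ℚ ≤ (1ℚ - e) * θ₁ * (1ℚ + # m * - z)
      main = ≤-trans (≤-by (0≤δ ⊗ 0≤δ ⊗ (#≥0 13 ⊗ 1-e ⊕ 0≤δ ⊗ (#≥0 16 ⊗ 1-e) ⊕ (1-16δ ⊕ #≥0 14 ⊗ 0≤δ ⊕ #≥0 2 ⊗ (0≤δ ⊗ 1-δ))))
        (ring δ)) (*-monoʳ (1-e ⊗ 0≤θ₁) nz)
        where
        ring : ∀ d → 1ℚ + d * d * (# 13 * (1ℚ - d * d) + d * (# 16 * (1ℚ - d * d)) + (1ℚ - # 16 * d + # 14 * d + # 2 * (d * (1ℚ - d)))) ≡ (1ℚ - d * d) * (1ℚ + d) * (1ℚ - d * (1ℚ - # 16 * d))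
        ring = solve-∀ ringℚ
      ring₁ : ∀ x y z → x + x * (y * z - 1ℚ) ≡ y * (x * z)
      ring₁ = solve-∀ ringℚ

    -- All double hits of one step together cost at most `m p²`, and `m p ≤ n p < 1`.
    q≤growth-1 : ∀ m → m ℕ.≤ n → q ≤ growth 1ℚ ^ℚ m
    q≤growth-1 m m≤n = ≤-trans
      (≤-by (0≤p ⊗ (0≤p ⊗ diff≥0 (#-mono m≤n) ⊕ (0≤c ½ ⊕ #≥0 8 ⊗ 0≤δ))) (trans (ring₁ p δ (# m) (# n)) (trans (cong (λ u → 1ℚ - p + p * (u + ½ + # 8 * δ) - p * (# m * p)) p-n) (ring₂ p δ (# m)))))
      (subst (λ z → 1ℚ - # m * (p * p) ≤ z ^ℚ m) (ring₃ p) (bernoulli {p * p} (≤-trans (0≤q ⊗ (0≤c 1ℚ ⊕ 0≤p)) (≤-reflexive (ring₄ p))) m))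
      where
      ring₁ : ∀ p d m n → 1ℚ - p + p * (p * (n - m) + (½ + # 8 * d)) ≡ 1ℚ - p + p * (p * n + ½ + # 8 * d) - p * (m * p)
      ring₁ = solve-∀ ringℚ
      ring₂ : ∀ p d m → 1ℚ - p + p * (½ - # 8 * d + ½ + # 8 * d) - p * (m * p) ≡ 1ℚ - m * (p * p)
      ring₂ = solve-∀ ringℚ
      ring₃ : ∀ p → 1ℚ - p * p ≡ (1ℚ - p) * (1ℚ - p + # 2 * p * 1ℚ)
      ring₃ = solve-∀ ringℚ
      ring₄ : ∀ p → (1ℚ - p) * (1ℚ + p) ≡ 1ℚ - p * p
      ring₄ = solve-∀ ringℚ

    -- Chosen so that `x δ³ = 2 p`, which is at least `(1 + x) p` because `x ≤ 1`; this is the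
    -- condition of `r-lower-subcritical` for `t = δ` and `s = δ²`. The resulting bound on `1 - ρ`
    -- is `x δ`.
    x : ℚ
    x = # 2 * p * (y * y * y)

    0≤x : 0ℚ ≤ x
    0≤x = #≥0 2 ⊗ 0≤p ⊗ (0≤y ⊗ 0≤y ⊗ 0≤y)

    cancel : ∀ u → u * (δ * δ * δ) * (y * y * y) ≡ u
    cancel u = trans (ring u δ y) (trans (cong (λ z → u * (z * z * z)) δy) (*-identityʳ u))
      where
      ring : ∀ u d y → u * (d * d * d) * (y * y * y) ≡ u * ((d * y) * (d * y) * (d * y))
      ring = solve-∀ ringℚ

    x≤1 : x ≤ 1ℚ
    x≤1 = ≤-trans (*-monoˡ (0≤y ⊗ 0≤y ⊗ 0≤y) p≤δ³) (≤-reflexive (trans (cong (_* (y * y * y)) (sym (*-identityˡ (δ * δ * δ)))) (cancel 1ℚ)))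

  ρ-lower : ∀ m → m ℕ.≤ n → 1ℚ - ρ p m ≤ # 2 * p * (y * y)
  ρ-lower m m≤n = ≤-trans (≤-by (diff≥0 (r-lower-subcritical {δ} {e} {x} n 0≤δ (diff≥0⁻¹ 1-δ) (0≤δ ⊗ 0≤δ) 0≤x
      (≤-trans (≤-by (diff≥0 x≤1 ⊗ 0≤p) (ring₁ x p)) (≤-reflexive (sym (trans (ring₂ p y δ) (cancel (# 2 * p))))))
      (λ m m≤n → ≤-trans (growth-upper m m≤n) (≤-by (0≤δ ⊗ 0≤δ ⊗ 0≤δ) (ring₃ δ)))
      q≤growth-1 (suc m) m 1 m≤n (ℕₚ.+-comm m 1))) (ring₄ x δ (ρ p m)))
    (≤-reflexive (trans (ring₅ p y δ) (trans (cong (λ u → # 2 * p * (y * y) * u) δy) (*-identityʳ _))))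
    where
    ring₁ : ∀ x p → (1ℚ + x) * p + (1ℚ - x) * p ≡ # 2 * p
    ring₁ = solve-∀ ringℚ
    ring₂ : ∀ p y d → # 2 * p * (y * y * y) * (d * d) * d ≡ # 2 * p * (d * d * d) * (y * y * y)
    ring₂ = solve-∀ ringℚ
    ring₃ : ∀ d → (1ℚ - d * d) * (1ℚ + d) + d * d * d ≡ 1ℚ + d - d * d
    ring₃ = solve-∀ ringℚ
    ring₄ : ∀ x d r → 1ℚ - r + (r - (1ℚ + x - x * ((1ℚ + d) * 1ℚ))) ≡ x * d
    ring₄ = solve-∀ ringℚ
    ring₅ : ∀ p y d → # 2 * p * (y * y * y) * d ≡ # 2 * p * (y * y) * (d * y)
    ring₅ = solve-∀ ringℚ

  private
    moment-bound : ∀ k → suc k ℕ.≤ n → moment e p k ≤ # 12 * δ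
    moment-bound k k<n = ≤-trans
      -- The drift is favourable at every fuel, so the early phase never ends and no fallback is
      -- called. The second base is 1, which makes the value at the start `12 (θ₁ - 1)`.
      (early-supersolution {e} {1ℚ} {θ₁} {1ℚ} (suc k) (λ _ → ⊤) (λ _ → ⊥) (0≤δ ⊗ 0≤δ) ≤-refl (0≤c 1ℚ) (≤-by 0≤δ refl)
        (λ _ → inj₁ tt) hX hY (λ _ _ _ _ _ ()) (suc k) 0 k 1 tt (ℕₚ.+-comm k 1) refl)
      (≤-reflexive (ring δ))
      where
      ring : ∀ d → 1ℚ * (d * d * 0ℚ + d * d * 0ℚ * (d * d * 0ℚ)) * ((1ℚ + d) * 1ℚ) + 1ℚ * (# 4 * (d * d * 0ℚ) + # 12) * ((1ℚ + d) * 1ℚ - 1ℚ * 1ℚ) ≡ # 12 * d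
      ring = solve-∀ ringℚ
      m≤n : ∀ f m a → suc f ℕ.≤ suc k → m ℕ.+ a ≡ f → m ℕ.≤ n
      m≤n f m a sf≤ eq = ℕₚ.≤-trans (subst (m ℕ.≤_) eq (ℕₚ.m≤m+n m a)) (ℕₚ.≤-trans (ℕₚ.n≤1+n f) (ℕₚ.≤-trans sf≤ k<n))
      hX : ∀ f m a → ⊤ → suc f ℕ.≤ suc k → m ℕ.+ a ≡ f → q ^ℚ a * (θ₁ ^ℚ a * growth θ₁ ^ℚ m) ≤ (1ℚ - e) * θ₁ ^ℚ suc a
      hX f m a _ sf≤ eq = ≤-trans
        (*-mono-≤ (^-nonNeg 0≤q a) (^-≤1 0≤q q≤1 a) (^-nonNeg 0≤θ₁ a ⊗ ^-nonNeg (growth≥0 0≤θ₁) m) (*-monoʳ (^-nonNeg 0≤θ₁ a) (growth-upper m (m≤n f m a sf≤ eq))))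
        (≤-reflexive (ring′ (θ₁ ^ℚ a) (1ℚ - e) θ₁))
        where
        ring′ : ∀ t e s → 1ℚ * (t * (e * s)) ≡ e * (s * t)
        ring′ = solve-∀ ringℚ
      hY : ∀ f m a → suc f ℕ.≤ suc k → m ℕ.+ a ≡ f → 1ℚ ^ℚ suc a - ½ * e * θ₁ ^ℚ suc a ≤ q ^ℚ a * (1ℚ ^ℚ a * growth 1ℚ ^ℚ m)
      hY f m a sf≤ eq = begin
        1ℚ ^ℚ suc a - ½ * e * θ₁ ^ℚ suc a
          ≡⟨ cong (_- ½ * e * θ₁ ^ℚ suc a) (1^ (suc a)) ⟩
        1ℚ - ½ * e * θ₁ ^ℚ suc a
          -- `½ δ² θ₁^(a+1)` is at least `½ δ³ (a + 1)`, and `2 p ≤ δ³` turns this into the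
          -- contradiction cost `(a + 1) p`.
          ≤⟨ ≤-by (0≤c ½ ⊗ (0≤δ ⊗ 0≤δ) ⊗ diff≥0 (bernoulli⁺ {δ} 0≤θ₁ (suc a)) ⊕ (0≤c ½ ⊗ (#≥0 (suc a) ⊗ diff≥0 p≤δ³) ⊕ 0≤c ½ ⊗ (0≤δ ⊗ 0≤δ))) (ring₁ δ p (# suc a) (θ₁ ^ℚ suc a)) ⟩
        1ℚ - # suc a * p
          ≤⟨ bernoulli {p} 0≤q (suc a) ⟩
        q * q ^ℚ a
          ≤⟨ *-monoˡ (^-nonNeg 0≤q a) (q≤growth-1 m (m≤n f m a sf≤ eq)) ⟩
        growth 1ℚ ^ℚ m * q ^ℚ a
          ≡⟨ trans (*-comm (growth 1ℚ ^ℚ m) (q ^ℚ a)) (cong (q ^ℚ a *_) (trans (sym (*-identityˡ (growth 1ℚ ^ℚ m))) (cong (_* growth 1ℚ ^ℚ m) (sym (1^ a))))) ⟩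
        q ^ℚ a * (1ℚ ^ℚ a * growth 1ℚ ^ℚ m) ∎
        where
        open ≤-Reasoning
        ring₁ : ∀ d p b s → 1ℚ - ½ * (d * d) * s + (½ * (d * d) * (s - (1ℚ + b * d)) + (½ * (b * (d * d * d - # 2 * p)) + ½ * (d * d))) ≡ 1ℚ - b * p
        ring₁ = solve-∀ ringℚ


  -- Each increment of `ρ` is at most `60 p² y³` and the mean size at most `12 y`; one further
  -- increment is absorbed by `y ≥ 1`, so 780 is `720 + 60`.
  covariance-bound : ∀ n₂ → suc (suc n₂) ≡ n →
    K p (λ _ m → ρ p m) (suc n₂) 0 n₂ 1 - ρ p (suc n₂) * ρ p (suc n₂) ≤ # 780 * (p * p) * (y * y * y * y)
  covariance-bound n₂ n≡ = ≤-trans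
    (covariance≤ {d} {# 12 * y} {d} n₂ 0≤d
      (λ i m eq → subst (λ z → ρ p m ≤ ρ p z + d * # i) (trans (ℕₚ.+-comm m i) eq)
        (ρ-steps m i λ k m≤k k< → step k (ℕₚ.≤-trans (subst (suc k ℕ.≤_) (trans (ℕₚ.+-comm m i) eq) k<) n₁≤n)))
      (mean≤ n₂ (subst (_< δ * δ) (*-zeroʳ δ) (*-monoʳ-<-pos δ {{positive 0<δ}} 0<δ))
        (≤-trans (moment-bound n₂ n₁≤n) (≤-reflexive (sym (trans (ring₁ δ y) (trans (cong (λ u → # 12 * δ * u) δy) (*-identityʳ _)))))))
      (step n₂ n₁≤n) 0≤d)
    (≤-by (#≥0 60 ⊗ (0≤p ⊗ 0≤p ⊗ (0≤y ⊗ 0≤y ⊗ 0≤y)) ⊗ 1≤y) (ring₂ p y))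
    where
    n₁≤n : suc n₂ ℕ.≤ n
    n₁≤n = ℕₚ.≤-trans (ℕₚ.n≤1+n (suc n₂)) (ℕₚ.≤-reflexive n≡)
    d D : ℚ
    d = # 60 * (p * p * (y * y * y))
    D = # 5 * (p * p) * (y * y * y * y)
    0≤d : 0ℚ ≤ d
    0≤d = #≥0 60 ⊗ (0≤p ⊗ 0≤p ⊗ (0≤y ⊗ 0≤y ⊗ 0≤y))
    ring₁ : ∀ d y → # 12 * y * (d * d) ≡ # 12 * d * (d * y)
    ring₁ = solve-∀ ringℚ
    ring₂ : ∀ p y → # 60 * (p * p * (y * y * y)) * (# 12 * y) + # 60 * (p * p * (y * y * y)) + # 60 * (p * p * (y * y * y)) * (y - 1ℚ) ≡ # 780 * (p * p) * (y * y * y * y)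
    ring₂ = solve-∀ ringℚ
    step : ∀ k → suc k ℕ.≤ n → ρ p k - ρ p (suc k) ≤ d
    step k k<n = ≤-trans
      (ρ-step {# 2 * p * (y * y)} {D} {# 12 * δ} {e} k (0≤δ ⊗ 0≤δ) (#≥0 5 ⊗ (0≤p ⊗ 0≤p) ⊗ (0≤y ⊗ 0≤y ⊗ 0≤y ⊗ 0≤y)) (λ m m≤ → ρ-lower m (ℕₚ.≤-trans m≤ k<n))
        (≤-trans (≤-by (0≤p ⊗ 0≤p ⊗ (0≤y ⊗ 0≤y)) (ring₃ p y)) (≤-reflexive (sym (trans (ring₄ p y δ) (cong (λ u → # 5 * (p * p) * (y * y) * (u * u)) δy)))))
        (≤-trans (≤-by (#≥0 4 ⊗ (0≤p ⊗ 0≤p)) (ring₅ p)) (≤-reflexive (sym (trans (ring₆ p y δ) (cong (λ u → # 5 * (p * p) * (u * u * u * u)) δy)))))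
        (moment-bound k k<n))
      (≤-reflexive (trans (ring₇ p y δ) (trans (cong (λ u → d * u) δy) (*-identityʳ d))))
      where
      ring₃ : ∀ p y → # 2 * p * (# 2 * p * (y * y)) + p * p * (y * y) ≡ # 5 * (p * p) * (y * y) * (1ℚ * 1ℚ)
      ring₃ = solve-∀ ringℚ
      ring₄ : ∀ p y d → # 5 * (p * p) * (y * y * y * y) * (d * d) ≡ # 5 * (p * p) * (y * y) * (d * y * (d * y))
      ring₄ = solve-∀ ringℚ
      ring₅ : ∀ p → p * p + # 4 * (p * p) ≡ # 5 * (p * p) * (1ℚ * 1ℚ * 1ℚ * 1ℚ)
      ring₅ = solve-∀ ringℚ
      ring₆ : ∀ p y d → # 5 * (p * p) * (y * y * y * y) * (d * d * (d * d)) ≡ # 5 * (p * p) * (d * y * (d * y) * (d * y) * (d * y))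
      ring₆ = solve-∀ ringℚ
      ring₇ : ∀ p y d → # 5 * (p * p) * (y * y * y * y) * (# 12 * d) ≡ # 60 * (p * p * (y * y * y)) * (d * y)
      ring₇ = solve-∀ ringℚ

-- Clauses

_≟ˡ_ : ∀ {n} (u v : Literal n) → Dec (u ≡ v)
_≟ˡ_ = ×-≡-dec Fin._≟_ 𝔹ₚ._≟_

joins? : ∀ {n} (c : Clause n) (u v : Literal n) → Dec (Joins c u v)
joins? (a , b) u v = (a ≟ˡ u ×-dec b ≟ˡ v) ⊎-dec (a ≟ˡ v ×-dec b ≟ˡ u)

neg-neg : ∀ {n} (u : Literal n) → neg (neg u) ≡ u
neg-neg (i , b) = cong (i ,_) (𝔹ₚ.not-involutive b)

joins-swap : ∀ {n} {a b u v : Literal n} → Joins (a , b) u v → Joins (b , a) u v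
joins-swap (inj₁ (p , q)) = inj₂ (q , p)
joins-swap (inj₂ (p , q)) = inj₁ (q , p)

private
  signs : List (Bool × Bool)
  signs = (true , true) ∷ (true , false) ∷ (false , true) ∷ (false , false) ∷ []

  ∈-signs : ∀ s → s ∈ signs
  ∈-signs (true , true) = here refl
  ∈-signs (true , false) = there (here refl)
  ∈-signs (false , true) = there (there (here refl))
  ∈-signs (false , false) = there (there (there (here refl)))

  signs-unique : Unique signs
  signs-unique = ((λ ()) ∷ (λ ()) ∷ (λ ()) ∷ []) ∷ ((λ ()) ∷ (λ ()) ∷ []) ∷ ((λ ()) ∷ []) ∷ [] ∷ []

  orderedPairs : ∀ n → List (Fin n × Fin n)
  orderedPairs n = List.filter (λ ij → toℕ (proj₁ ij) ℕ.<? toℕ (proj₂ ij)) (List.cartesianProduct (List.allFin n) (List.allFin n))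

  clause : ∀ {n} → Fin n × Fin n → Bool × Bool → Clause n
  clause ij ab = (proj₁ ij , proj₁ ab) , (proj₂ ij , proj₂ ab)

  concatMap-map : ∀ {A B C : Set} (f : A → B → C) xs ys → List.concatMap (λ x → List.map (f x) ys) xs ≡ List.cartesianProductWith f xs ys
  concatMap-map f [] ys = refl
  concatMap-map f (x ∷ xs) ys = cong (List.map (f x) ys List.++_) (concatMap-map f xs ys)

  allClauses-product : ∀ n → allClauses n ≡ List.cartesianProductWith clause (orderedPairs n) signs
  allClauses-product n = concatMap-map clause (orderedPairs n) signs

allClauses-unique : ∀ n → Unique (allClauses n)
allClauses-unique n = subst Unique (sym (allClauses-product n))
  (Uniqueₚ.cartesianProductWith⁺ clause (λ { refl → refl , refl })
    (Uniqueₚ.filter⁺ _ (Uniqueₚ.cartesianProduct⁺ (Uniqueₚ.allFin⁺ n) (Uniqueₚ.allFin⁺ n))) signs-unique)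

∈-allClauses : ∀ {n} (u v : Literal n) → toℕ (proj₁ u) ℕ.< toℕ (proj₁ v) → (u , v) ∈ allClauses n
∈-allClauses {n} (i , a) (j , b) i<j = subst ((_ , _) ∈_) (sym (allClauses-product n))
  (∈-cartesianProductWith⁺ clause (∈-filter⁺ (λ ij → toℕ (proj₁ ij) ℕ.<? toℕ (proj₂ ij)) (∈-cartesianProduct⁺ (∈-allFin i) (∈-allFin j)) i<j) (∈-signs (a , b)))

allClauses-ordered : ∀ {n} {u v : Literal n} → (u , v) ∈ allClauses n → toℕ (proj₁ u) ℕ.< toℕ (proj₁ v)
allClauses-ordered {n} uv∈ with ∈-cartesianProductWith⁻ clause (orderedPairs n) signs (subst (_ ∈_) (allClauses-product n) uv∈)
... | ij , ab , ij∈ , _ , refl = proj₂ (∈-filter⁻ (λ ij → toℕ (proj₁ ij) ℕ.<? toℕ (proj₂ ij)) {xs = List.cartesianProduct (List.allFin n) (List.allFin n)} ij∈)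

joins-∈-allClauses : ∀ {n} (u v : Literal n) → StrictlyDistinct u v → Σ (Clause n) λ c → c ∈ allClauses n × Joins c u v
joins-∈-allClauses u v u≢v with ℕₚ.<-cmp (toℕ (proj₁ u)) (toℕ (proj₁ v))
... | tri< lt _ _ = (u , v) , ∈-allClauses u v lt , inj₁ (refl , refl)
... | tri≈ _ eq _ = contradiction (Finₚ.toℕ-injective eq) u≢v
... | tri> _ _ gt = (v , u) , ∈-allClauses v u gt , inj₂ (refl , refl)

-- Records the position of the only clause on `u` and `v`, in either order. Because it is the only
-- one, learning its status is a single coin toss.
data Once {n} (u v : Literal n) : List (Clause n) → Set where
  here : ∀ {c cs} → Joins c u v → All (λ c → ¬ Joins c u v) cs → Once u v (c ∷ cs)
  there : ∀ {c cs} → ¬ Joins c u v → Once u v cs → Once u v (c ∷ cs)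

unique⇒once : ∀ {n} {u v : Literal n} {c} cs → Unique cs → c ∈ cs → Joins c u v → (∀ {d} → d ∈ cs → Joins d u v → d ≡ c) → Once u v cs
unique⇒once (c ∷ cs) (c∉ ∷ _) (here refl) j only = here j (All.tabulate λ d∈ jd → All.lookup c∉ d∈ (sym (only (there d∈) jd)))
unique⇒once (d ∷ cs) (d∉ ∷ uniq) (there c∈) j only = there (λ jd → All.lookup d∉ c∈ (only (here refl) jd)) (unique⇒once cs uniq c∈ j (only ∘ there))

allClauses-once : ∀ {n} (u v : Literal n) → StrictlyDistinct u v → Once u v (allClauses n)
allClauses-once {n} u v u≢v with joins-∈-allClauses u v u≢v
... | c , c∈ , j = unique⇒once (allClauses n) (allClauses-unique n) c∈ j λ d∈ jd → same d∈ c∈ jd j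
  where
  same : ∀ {c d} → c ∈ allClauses n → d ∈ allClauses n → Joins c u v → Joins d u v → c ≡ d
  same _ _ (inj₁ (refl , refl)) (inj₁ (refl , refl)) = refl
  same c∈ d∈ (inj₁ (refl , refl)) (inj₂ (refl , refl)) = contradiction (allClauses-ordered d∈) (ℕₚ.<⇒≯ (allClauses-ordered c∈))
  same c∈ d∈ (inj₂ (refl , refl)) (inj₁ (refl , refl)) = contradiction (allClauses-ordered d∈) (ℕₚ.<⇒≯ (allClauses-ordered c∈))
  same _ _ (inj₂ (refl , refl)) (inj₂ (refl , refl)) = refl

-- Partially revealed formulas

data Status : Set where
  unknown present absent : Status

-- Indexed by pairs of literals, so that the exploration can speak of a clause without knowing in
-- which order the list stores it; `update` writes both orders.
Knowledge : ℕ → Set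
Knowledge n = Literal n → Literal n → Status

update : ∀ {n} → Knowledge n → Literal n → Literal n → Status → Knowledge n
update σ u v t a b = if does (joins? (a , b) u v) then t else σ a b

update-hit : ∀ {n} (σ : Knowledge n) u v t {a b} → Joins (a , b) u v → update σ u v t a b ≡ t
update-hit σ u v t {a} {b} j = cong (λ x → if x then t else σ a b) (dec-true (joins? (a , b) u v) j)

update-miss : ∀ {n} (σ : Knowledge n) u v t {a b} → ¬ Joins (a , b) u v → update σ u v t a b ≡ σ a b
update-miss σ u v t {a} {b} ¬j = cong (λ x → if x then t else σ a b) (dec-false (joins? (a , b) u v) ¬j)

weight : ℚ → Status → ℚ
weight p unknown = p
weight p present = 1ℚ
weight p absent = 0ℚ

-- The conditional expectation given `σ`, defined without dividing by the probability of the
-- condition.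
ExpectGiven : ∀ {n} → ℚ → Knowledge n → List (Clause n) → (Formula n → ℚ) → ℚ
ExpectGiven p σ [] f = f []
ExpectGiven p σ (c ∷ cs) f =
  weight p (σ (proj₁ c) (proj₂ c)) * ExpectGiven p σ cs (f ∘ (c ∷_)) + (1ℚ - weight p (σ (proj₁ c) (proj₂ c))) * ExpectGiven p σ cs f

ExpectGiven-unknown : ∀ {n} p cs (f : Formula n → ℚ) → ExpectGiven p (λ _ _ → unknown) cs f ≡ Expect p cs f
ExpectGiven-unknown p [] f = refl
ExpectGiven-unknown p (c ∷ cs) f = cong₂ (λ x y → p * x + (1ℚ - p) * y) (ExpectGiven-unknown p cs (f ∘ (c ∷_))) (ExpectGiven-unknown p cs f)

ExpectGiven-cong : ∀ {n} p {σ τ : Knowledge n} {cs} → All (λ c → σ (proj₁ c) (proj₂ c) ≡ τ (proj₁ c) (proj₂ c)) cs → ∀ f → ExpectGiven p σ cs f ≡ ExpectGiven p τ cs f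
ExpectGiven-cong p [] f = refl
ExpectGiven-cong p {σ} {τ} {c ∷ cs} (eq ∷ eqs) f rewrite eq =
  cong₂ (λ x y → weight p (τ (proj₁ c) (proj₂ c)) * x + (1ℚ - weight p (τ (proj₁ c) (proj₂ c))) * y)
    (ExpectGiven-cong p eqs (f ∘ (c ∷_))) (ExpectGiven-cong p eqs f)

-- The law of total probability for one clause. The recursion walks to the place given by `Once`;
-- all other clauses keep their weight under the update.
reveal : ∀ {n} p (σ : Knowledge n) u v {cs} → Once u v cs → σ u v ≡ unknown → σ v u ≡ unknown → ∀ f →
  ExpectGiven p σ cs f ≡ p * ExpectGiven p (update σ u v present) cs f + (1ℚ - p) * ExpectGiven p (update σ u v absent) cs f
reveal p σ u v {c ∷ cs} (here j rest) uv vu f = begin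
  weight p (σ (proj₁ c) (proj₂ c)) * E σ f₁ + (1ℚ - weight p (σ (proj₁ c) (proj₂ c))) * E σ f
    ≡⟨ cong (λ s → weight p s * E σ f₁ + (1ℚ - weight p s) * E σ f) (σ-c j) ⟩
  p * E σ f₁ + (1ℚ - p) * E σ f
    ≡⟨ ring p (E σ f₁) (E σ f) ⟩
  p * (1ℚ * E σ f₁ + (1ℚ - 1ℚ) * E σ f) + (1ℚ - p) * (0ℚ * E σ f₁ + (1ℚ - 0ℚ) * E σ f)
    ≡⟨ cong₂ (λ x y → p * x + (1ℚ - p) * y)
         (cong₂ (λ x y → 1ℚ * x + (1ℚ - 1ℚ) * y) (same present f₁) (same present f))
         (cong₂ (λ x y → 0ℚ * x + (1ℚ - 0ℚ) * y) (same absent f₁) (same absent f)) ⟩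
  p * (1ℚ * E (update σ u v present) f₁ + (1ℚ - 1ℚ) * E (update σ u v present) f) + (1ℚ - p) * (0ℚ * E (update σ u v absent) f₁ + (1ℚ - 0ℚ) * E (update σ u v absent) f)
    ≡⟨ cong₂ (λ s t → p * (weight p s * E (update σ u v present) f₁ + (1ℚ - weight p s) * E (update σ u v present) f) + (1ℚ - p) * (weight p t * E (update σ u v absent) f₁ + (1ℚ - weight p t) * E (update σ u v absent) f))
         (sym (update-hit σ u v present j)) (sym (update-hit σ u v absent j)) ⟩
  p * ExpectGiven p (update σ u v present) (c ∷ cs) f + (1ℚ - p) * ExpectGiven p (update σ u v absent) (c ∷ cs) f ∎
  where
  open ≡-Reasoning
  E = λ τ g → ExpectGiven p τ cs g
  f₁ = f ∘ (c ∷_)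
  σ-c : Joins c u v → σ (proj₁ c) (proj₂ c) ≡ unknown
  σ-c (inj₁ (refl , refl)) = uv
  σ-c (inj₂ (refl , refl)) = vu
  same : ∀ t g → E σ g ≡ E (update σ u v t) g
  same t g = ExpectGiven-cong p (All.map (λ ¬j → sym (update-miss σ u v t ¬j)) rest) g
  ring : ∀ p x y → p * x + (1ℚ - p) * y ≡ p * (1ℚ * x + (1ℚ - 1ℚ) * y) + (1ℚ - p) * (0ℚ * x + (1ℚ - 0ℚ) * y)
  ring = solve-∀ ringℚ
reveal p σ u v {c ∷ cs} (there ¬j once) uv vu f = begin
  w * E σ f₁ + (1ℚ - w) * E σ f
    ≡⟨ cong₂ (λ x y → w * x + (1ℚ - w) * y) (reveal p σ u v once uv vu f₁) (reveal p σ u v once uv vu f) ⟩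
  w * (p * E σ₊ f₁ + (1ℚ - p) * E σ₋ f₁) + (1ℚ - w) * (p * E σ₊ f + (1ℚ - p) * E σ₋ f)
    ≡⟨ ring w p (E σ₊ f₁) (E σ₋ f₁) (E σ₊ f) (E σ₋ f) ⟩
  p * (w * E σ₊ f₁ + (1ℚ - w) * E σ₊ f) + (1ℚ - p) * (w * E σ₋ f₁ + (1ℚ - w) * E σ₋ f)
    ≡⟨ cong₂ (λ s t → p * (weight p s * E σ₊ f₁ + (1ℚ - weight p s) * E σ₊ f) + (1ℚ - p) * (weight p t * E σ₋ f₁ + (1ℚ - weight p t) * E σ₋ f))
         (sym (update-miss σ u v present ¬j)) (sym (update-miss σ u v absent ¬j)) ⟩
  p * ExpectGiven p σ₊ (c ∷ cs) f + (1ℚ - p) * ExpectGiven p σ₋ (c ∷ cs) f ∎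
  where
  open ≡-Reasoning
  E = λ τ g → ExpectGiven p τ cs g
  f₁ = f ∘ (c ∷_)
  σ₊ = update σ u v present
  σ₋ = update σ u v absent
  w = weight p (σ (proj₁ c) (proj₂ c))
  ring : ∀ w p a b c d → w * (p * a + (1ℚ - p) * b) + (1ℚ - w) * (p * c + (1ℚ - p) * d) ≡ p * (w * a + (1ℚ - w) * c) + (1ℚ - p) * (w * b + (1ℚ - w) * d)
  ring = solve-∀ ringℚ

data Consistent {n} (σ : Knowledge n) : List (Clause n) → Formula n → Set where
  [] : Consistent σ [] []
  take : ∀ {c cs F} → σ (proj₁ c) (proj₂ c) ≢ absent → Consistent σ cs F → Consistent σ (c ∷ cs) (c ∷ F)
  skip : ∀ {c cs F} → σ (proj₁ c) (proj₂ c) ≢ present → Consistent σ cs F → Consistent σ (c ∷ cs) F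

consistent-∈ : ∀ {n} {σ : Knowledge n} {cs F c} → Consistent σ cs F → c ∈ F → c ∈ cs × σ (proj₁ c) (proj₂ c) ≢ absent
consistent-∈ (take ¬abs con) (here refl) = here refl , ¬abs
consistent-∈ (take ¬abs con) (there c∈) with consistent-∈ con c∈
... | c∈cs , ¬a = there c∈cs , ¬a
consistent-∈ (skip ¬pre con) c∈ with consistent-∈ con c∈
... | c∈cs , ¬a = there c∈cs , ¬a

present-∈ : ∀ {n} {σ : Knowledge n} {cs F c} → Consistent σ cs F → c ∈ cs → σ (proj₁ c) (proj₂ c) ≡ present → c ∈ F
present-∈ (take _ con) (here refl) pre = here refl
present-∈ (take _ con) (there c∈) pre = there (present-∈ con c∈ pre)
present-∈ (skip ¬pre con) (here refl) pre = contradiction pre ¬pre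
present-∈ (skip _ con) (there c∈) pre = present-∈ con c∈ pre

-- Formulas that disagree with the knowledge have weight zero, so the payoffs are compared only on
-- consistent ones, where present edges are edges of the formula.
ExpectGiven-mono : ∀ {n} p → 0ℚ ≤ p → 0ℚ ≤ 1ℚ - p → ∀ (σ : Knowledge n) cs {f g : Formula n → ℚ} → (∀ F → Consistent σ cs F → f F ≤ g F) → ExpectGiven p σ cs f ≤ ExpectGiven p σ cs g
ExpectGiven-mono p 0≤p 0≤q σ [] le = le [] []
ExpectGiven-mono p 0≤p 0≤q σ (c ∷ cs) {f} {g} le with σ (proj₁ c) (proj₂ c) in eq
... | unknown = +-mono-≤
  (*-monoʳ 0≤p (ExpectGiven-mono p 0≤p 0≤q σ cs λ F con → le (c ∷ F) (take (λ abs → contradiction (trans (sym eq) abs) λ ()) con)))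
  (*-monoʳ 0≤q (ExpectGiven-mono p 0≤p 0≤q σ cs λ F con → le F (skip (λ pre → contradiction (trans (sym eq) pre) λ ()) con)))
... | present = subst₂ _≤_ (ring (ExpectGiven p σ cs (f ∘ (c ∷_))) (ExpectGiven p σ cs f)) (ring (ExpectGiven p σ cs (g ∘ (c ∷_))) (ExpectGiven p σ cs g)) (ExpectGiven-mono p 0≤p 0≤q σ cs λ F con → le (c ∷ F) (take (λ abs → contradiction (trans (sym eq) abs) λ ()) con))
  where
  ring : ∀ x y → x ≡ 1ℚ * x + (1ℚ - 1ℚ) * y
  ring = solve-∀ ringℚ
... | absent = subst₂ _≤_ (ring (ExpectGiven p σ cs f) (ExpectGiven p σ cs (f ∘ (c ∷_)))) (ring (ExpectGiven p σ cs g) (ExpectGiven p σ cs (g ∘ (c ∷_)))) (ExpectGiven-mono p 0≤p 0≤q σ cs λ F con → le F (skip (λ pre → contradiction (trans (sym eq) pre) λ ()) con))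
  where
  ring : ∀ x y → x ≡ 0ℚ * y + (1ℚ - 0ℚ) * x
  ring = solve-∀ ringℚ

ExpectGiven-const : ∀ {n} p (σ : Knowledge n) cs x → ExpectGiven p σ cs (λ _ → x) ≡ x
ExpectGiven-const p σ [] x = refl
ExpectGiven-const p σ (c ∷ cs) x = trans (cong₂ (λ a b → w * a + (1ℚ - w) * b) (ExpectGiven-const p σ cs x) (ExpectGiven-const p σ cs x)) (ring w x)
  where
  w = weight p (σ (proj₁ c) (proj₂ c))
  ring : ∀ w x → w * x + (1ℚ - w) * x ≡ x
  ring = solve-∀ ringℚ

-- Exploration of the literals reachable from r

-- The Boolean is the sign of the literal that was reached. `out` marks variables withheld from this
-- exploration: kept for a later one, or already used by an earlier one.
data Phase : Set where
  out fresh : Phase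
  active done : Bool → Phase

active-injective : ∀ {b c} → active b ≡ active c → b ≡ c
active-injective refl = refl

≢⇒not≡ : ∀ {c c′} → c ≢ c′ → not c ≡ c′
≢⇒not≡ {false} {false} ≢ = contradiction refl ≢
≢⇒not≡ {false} {true} ≢ = refl
≢⇒not≡ {true} {false} ≢ = refl
≢⇒not≡ {true} {true} ≢ = contradiction refl ≢

phase : ∀ ph → ph ≡ out ⊎ ph ≡ fresh ⊎ (Σ Bool λ c → ph ≡ active c) ⊎ (Σ Bool λ c → ph ≡ done c)
phase out = inj₁ refl
phase fresh = inj₂ (inj₁ refl)
phase (active c) = inj₂ (inj₂ (inj₁ (c , refl)))
phase (done c) = inj₂ (inj₂ (inj₂ (c , refl)))

not≢ : ∀ b → not b ≢ b
not≢ true ()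
not≢ false ()

module _ {n : ℕ} where

  Phases : Set
  Phases = Fin n → Phase

  _[_↦_] : Phases → Fin n → Phase → Phases
  (s [ v ↦ ph ]) w = if does (w Fin.≟ v) then ph else s w

  set-hit : ∀ s v ph → (s [ v ↦ ph ]) v ≡ ph
  set-hit s v ph = cong (λ x → if x then ph else s v) (dec-true (v Fin.≟ v) refl)

  set-miss : ∀ s v ph {w} → w ≢ v → (s [ v ↦ ph ]) w ≡ s w
  set-miss s v ph {w} w≢v = cong (λ x → if x then ph else s w) (dec-false (w Fin.≟ v) w≢v)

  -- An edge out of `l` is a clause containing `neg l`, and it is tested when `l` is processed. So
  -- the literals whose mutual clauses are all still unknown are those of fresh variables and the
  -- negations of active literals.
  Explored Open : Phases → Literal n → Set
  Explored s (v , b) = s v ≡ active b ⊎ s v ≡ done b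
  Open s (v , b) = s v ≡ fresh ⊎ s v ≡ active (not b)

  Untouched : Phases → Fin n → Set
  Untouched s v = s v ≡ fresh ⊎ s v ≡ out

  PresentEdge : Knowledge n → Literal n → Literal n → Set
  PresentEdge σ x y = StrictlyDistinct x y × σ (neg x) y ≡ present

  Symmetric : Knowledge n → Set
  Symmetric σ = ∀ a b → σ a b ≡ σ b a

  update-symmetric : ∀ σ u v t → Symmetric σ → Symmetric (update σ u v t)
  update-symmetric σ u v t sym-σ a b with joins? (a , b) u v
  ... | yes j = trans (update-hit σ u v t j) (sym (update-hit σ u v t (joins-swap j)))
  ... | no ¬j = trans (update-miss σ u v t ¬j) (trans (sym-σ a b) (sym (update-miss σ u v t (λ j → ¬j (joins-swap j)))))

  update-persist : ∀ σ u v t → Symmetric σ → σ u v ≡ unknown → ∀ {a b} → σ a b ≢ unknown → update σ u v t a b ≡ σ a b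
  update-persist σ u v t sym-σ uv {a} {b} known = update-miss σ u v t λ
    { (inj₁ (refl , refl)) → known uv
    ; (inj₂ (refl , refl)) → known (trans (sym-σ a b) uv) }

  present-edge-update : ∀ σ u v t → Symmetric σ → σ u v ≡ unknown → ∀ {a b} → PresentEdge σ a b → PresentEdge (update σ u v t) a b
  present-edge-update σ u v t sym-σ uv (a≢b , pre) = a≢b , trans (update-persist σ u v t sym-σ uv λ unk → contradiction (trans (sym pre) unk) λ ()) pre

  contrapositive : ∀ σ → Symmetric σ → ∀ {a b} → Star (PresentEdge σ) a b → Star (PresentEdge σ) (neg b) (neg a)
  contrapositive σ sym-σ nil = nil
  contrapositive σ sym-σ {a} {c} (_◅_ {j = b} (a≢b , pre) path) =
    contrapositive σ sym-σ path ◅◅ ((λ eq → a≢b (sym eq)) , trans (cong (λ z → σ z (neg a)) (neg-neg b)) (trans (sym-σ b (neg a)) pre)) ◅ nil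

  -- The contrapositive of a path from `r` to `neg l` leads from `l` to `neg r`; so reaching both
  -- literals of a variable settles the event and the run can stop.
  contradictory : ∀ σ → Symmetric σ → ∀ {r l} → Star (PresentEdge σ) r l → Star (PresentEdge σ) r (neg l) → Star (PresentEdge σ) r (neg r)
  contradictory σ sym-σ {r} {l} p₁ p₂ = p₁ ◅◅ subst (λ z → Star (PresentEdge σ) z (neg r)) (neg-neg l) (contrapositive σ sym-σ p₂)

  module Exploration (σ₀ : Knowledge n) (r : Literal n) (Out : Fin n → Set) where

    -- `open-unknown` makes every test a fresh coin toss; `untouched` guarantees that a second
    -- exploration among the remaining variables finds nothing revealed.
    record Core (σ : Knowledge n) (s : Phases) : Set where
      field
        symm : Symmetric σ
        root : Explored s r
        open-unknown : ∀ l l′ → Open s l → Open s l′ → StrictlyDistinct l l′ → σ l l′ ≡ unknown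
        reached : ∀ l → Explored s l → Star (PresentEdge σ) r l
        untouched : ∀ l l′ → Untouched s (proj₁ l) → Untouched s (proj₁ l′) → σ l l′ ≡ σ₀ l l′
        out⇒ : ∀ v → s v ≡ out → Out v
        ⇒out : ∀ v → Out v → s v ≡ out

    Closed : Knowledge n → Phases → Fin n → Bool → Set
    Closed σ s v b = ∀ w c → s w ≢ out → v ≢ w → σ (v , not b) (w , c) ≡ absent ⊎ Explored s (w , c)

    record State (σ : Knowledge n) (s : Phases) (A : List (Literal n)) (U : List (Fin n)) : Set where
      field
        core : Core σ s
        closed : ∀ v b → s v ≡ done b → Closed σ s v b
        A-sound : ∀ v b → (v , b) ∈ A → s v ≡ active b
        A-compl : ∀ v b → s v ≡ active b → (v , b) ∈ A
        A-unique : Unique A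
        U-sound : ∀ v → v ∈ U → s v ≡ fresh
        U-compl : ∀ v → s v ≡ fresh → v ∈ U
        U-unique : Unique U

    -- The literal (x , b) is being processed: R are the active literals and V the unexplored variables still to be
    -- tested, W the variables found not to be hit.
    record Midway (x : Fin n) (b : Bool) (σ : Knowledge n) (s : Phases) (R : List (Literal n)) (V : List (Fin n)) (A : List (Literal n)) (W : List (Fin n)) : Set where
      field
        core : Core σ s
        current : s x ≡ done b
        closed : ∀ v b′ → v ≢ x → s v ≡ done b′ → Closed σ s v b′
        tested : ∀ w c → s w ≢ out → x ≢ w → σ (x , not b) (w , c) ≡ absent ⊎ Explored s (w , c) ⊎ w ∈ V ⊎ (w , not c) ∈ R
        V-unknown : ∀ w c → w ∈ V → σ (x , not b) (w , c) ≡ unknown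
        R-unknown : ∀ w c → (w , c) ∈ R → σ (x , not b) (w , not c) ≡ unknown
        R-sound : ∀ v c → (v , c) ∈ R → s v ≡ active c
        R-unique : Unique R
        A-sound : ∀ v c → (v , c) ∈ A → s v ≡ active c
        A-compl : ∀ v c → s v ≡ active c → (v , c) ∈ A
        A-unique : Unique A
        V-sound : ∀ v → v ∈ V → s v ≡ fresh
        W-sound : ∀ v → v ∈ W → s v ≡ fresh
        VW-compl : ∀ v → s v ≡ fresh → v ∈ V ⊎ v ∈ W
        V-unique : Unique V
        W-unique : Unique W
        VW-disj : ∀ v → v ∈ V → ¬ v ∈ W

    -- The tested clause contains `(x , not b)` with `x` done. Such a literal is neither open nor
    -- untouched, so the fields about unrevealed clauses do not see the update.
    core-update : ∀ {σ s x b} l t → Core σ s → s x ≡ done b → σ (x , not b) l ≡ unknown → Core (update σ (x , not b) l t) s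
    core-update {σ} {s} {x} {b} l t core x-done unk = record
      { symm = update-symmetric σ u l t symm
      ; root = root
      ; open-unknown = λ l₁ l₂ o₁ o₂ d → trans (update-miss σ u l t λ
          { (inj₁ (refl , _)) → ¬open o₁
          ; (inj₂ (_ , refl)) → ¬open o₂ }) (open-unknown l₁ l₂ o₁ o₂ d)
      ; reached = λ l′ e → gmap (reached l′ e)
      ; untouched = λ l₁ l₂ o₁ o₂ → trans (update-miss σ u l t λ
          { (inj₁ (refl , _)) → ¬untouched o₁
          ; (inj₂ (_ , refl)) → ¬untouched o₂ }) (untouched l₁ l₂ o₁ o₂)
      ; out⇒ = out⇒
      ; ⇒out = ⇒out }
      where
      open Core core
      u : Literal n
      u = x , not b
      ¬open : ∀ {c} → ¬ Open s (x , c)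
      ¬open (inj₁ eq) with () ← trans (sym x-done) eq
      ¬open (inj₂ eq) with () ← trans (sym x-done) eq
      ¬untouched : ¬ Untouched s x
      ¬untouched (inj₁ eq) with () ← trans (sym x-done) eq
      ¬untouched (inj₂ eq) with () ← trans (sym x-done) eq
      gmap : ∀ {a c} → Star (PresentEdge σ) a c → Star (PresentEdge (update σ u l t)) a c
      gmap nil = nil
      gmap (e ◅ es) = present-edge-update σ u l t symm unk e ◅ gmap es

    closed-update : ∀ {σ s} u l t v b → Symmetric σ → σ u l ≡ unknown → Closed σ s v b → Closed (update σ u l t) s v b
    closed-update {σ} u l t v b sym-σ unk cl w c w-in v≢w with cl w c w-in v≢w
    ... | inj₁ abs = inj₁ (trans (update-persist σ u l t sym-σ unk λ eq → contradiction (trans (sym abs) eq) λ ()) abs)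
    ... | inj₂ expl = inj₂ expl

    begin-processing : ∀ {σ s x b A U} → State σ s ((x , b) ∷ A) U → Midway x b σ (s [ x ↦ done b ]) A U A []
    begin-processing {σ} {s} {x} {b} {A} {U} st = record
      { core = record
          { symm = symm
          ; root = explored⁺ root
          ; open-unknown = λ l l′ o o′ → open-unknown l l′ (open⁻ o) (open⁻ o′)
          ; reached = λ l e → reached l (explored⁻ e)
          ; untouched = λ l l′ o o′ → untouched l l′ (untouched⁻ o) (untouched⁻ o′)
          ; out⇒ = λ v eq → out⇒ v (out⁻ v eq)
          ; ⇒out = λ v o → trans (set-miss s x (done b) (λ { refl → case (trans (sym (⇒out v o)) x-active) })) (⇒out v o) }
      ; current = set-hit s x (done b)
      ; closed = λ v b′ v≢x eq w c w-in v≢w → Sum.map₂ explored⁺ (closed v b′ (trans (sym (set-miss s x (done b) v≢x)) eq) w c (λ eq′ → w-in (out⁺ w eq′)) v≢w)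
      ; tested = tested′
      ; V-unknown = λ w c w∈ → open-unknown (x , not b) (w , c) x-open (inj₁ (U-sound w w∈)) (x≢ w (U-sound w w∈) λ ())
      ; R-unknown = λ w c wc∈ → open-unknown (x , not b) (w , not c) x-open (inj₂ (trans (A-sound w c (there wc∈)) (cong active (sym (𝔹ₚ.not-involutive c))))) (x≢A w c wc∈)
      ; R-sound = A-sound′
      ; R-unique = tail A-unique
      ; A-sound = A-sound′
      ; A-compl = λ v c eq → A-compl′ v c eq
      ; A-unique = tail A-unique
      ; V-sound = λ v v∈ → trans (set-miss s x (done b) (λ eq → x≢ v (U-sound v v∈) (λ ()) (sym eq))) (U-sound v v∈)
      ; W-sound = λ v ()
      ; VW-compl = λ v eq → inj₁ (U-compl v (fresh⁻ v eq))
      ; V-unique = U-unique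
      ; W-unique = []
      ; VW-disj = λ v _ () }
      where
      open State st
      open Core core
      case : ∀ {b} {X : Set} → out ≡ active b → X
      case ()
      tail : ∀ {y ys} → Unique {A = Literal n} (y ∷ ys) → Unique ys
      tail (_ ∷ u) = u
      x-active : s x ≡ active b
      x-active = A-sound x b (here refl)
      x-open : Open s (x , not b)
      x-open = inj₂ (trans x-active (cong active (sym (𝔹ₚ.not-involutive b))))
      s′ : Phases
      s′ = s [ x ↦ done b ]
      x≢ : ∀ w {ph} → s w ≡ ph → active b ≢ ph → x ≢ w
      x≢ w eq ≢ refl = ≢ (trans (sym x-active) eq)
      x≢A : ∀ w c → (w , c) ∈ A → x ≢ w
      x≢A w c wc∈ refl with A-unique
      ... | x∉ ∷ _ = All.lookup x∉ wc∈ (cong (x ,_) (active-injective (trans (sym x-active) (A-sound w c (there wc∈)))))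
      miss : ∀ {w} → w ≢ x → s′ w ≡ s w
      miss = set-miss s x (done b)
      back : ∀ w ph → s′ w ≡ ph → done b ≢ ph → s w ≡ ph
      back w ph eq ≢ with w Fin.≟ x
      ... | yes refl = contradiction eq ≢
      ... | no w≢x = eq
      fresh⁻ : ∀ w → s′ w ≡ fresh → s w ≡ fresh
      fresh⁻ w eq = back w fresh eq λ ()
      out⁻ : ∀ w → s′ w ≡ out → s w ≡ out
      out⁻ w eq = back w out eq λ ()
      out⁺ : ∀ w → s w ≡ out → s′ w ≡ out
      out⁺ w eq = trans (miss λ { refl → case (trans (sym eq) x-active) }) eq
      open⁻ : ∀ {l} → Open s′ l → Open s l
      open⁻ (inj₁ eq) = inj₁ (fresh⁻ _ eq)
      open⁻ (inj₂ eq) = inj₂ (back _ _ eq λ ())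
      untouched⁻ : ∀ {v} → Untouched s′ v → Untouched s v
      untouched⁻ (inj₁ eq) = inj₁ (fresh⁻ _ eq)
      untouched⁻ (inj₂ eq) = inj₂ (out⁻ _ eq)
      explored⁺ : ∀ {l} → Explored s l → Explored s′ l
      explored⁺ {w , c} e with w Fin.≟ x
      explored⁺ {w , c} (inj₁ eq) | yes refl with refl ← trans (sym eq) x-active = inj₂ refl
      explored⁺ {w , c} (inj₂ eq) | yes refl with () ← trans (sym eq) x-active
      explored⁺ {w , c} (inj₁ eq) | no w≢x = inj₁ eq
      explored⁺ {w , c} (inj₂ eq) | no w≢x = inj₂ eq
      explored⁻ : ∀ {l} → Explored s′ l → Explored s l
      explored⁻ {w , c} (inj₁ eq) = inj₁ (back w _ eq λ ())
      explored⁻ {w , c} (inj₂ eq) with w Fin.≟ x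
      ... | yes refl with refl ← eq = inj₁ x-active
      ... | no w≢x = inj₂ eq
      A-sound′ : ∀ v c → (v , c) ∈ A → s′ v ≡ active c
      A-sound′ v c vc∈ = trans (miss λ eq → x≢A v c vc∈ (sym eq)) (A-sound v c (there vc∈))
      A-compl′ : ∀ v c → s′ v ≡ active c → (v , c) ∈ A
      A-compl′ v c eq with A-compl v c (back v _ eq λ ())
      ... | there vc∈ = vc∈
      ... | here refl with () ← trans (sym (set-hit s x (done b))) eq
      tested′ : ∀ w c → s′ w ≢ out → x ≢ w → σ (x , not b) (w , c) ≡ absent ⊎ Explored s′ (w , c) ⊎ w ∈ U ⊎ (w , not c) ∈ A
      tested′ w c w-in x≢w with phase (s w)
      ... | inj₁ eq = contradiction (out⁺ w eq) w-in
      ... | inj₂ (inj₁ eq) = inj₂ (inj₂ (inj₁ (U-compl w eq)))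
      ... | inj₂ (inj₂ (inj₁ (c′ , eq))) with c 𝔹ₚ.≟ c′
      ...   | yes refl = inj₂ (inj₁ (explored⁺ (inj₁ eq)))
      ...   | no c≢c′ with A-compl w c′ eq
      ...     | here refl = contradiction refl x≢w
      ...     | there wc∈ = inj₂ (inj₂ (inj₂ (subst (λ z → (w , z) ∈ A) (sym (≢⇒not≡ c≢c′)) wc∈)))
      -- `(w , c)` is the negation of a done literal. The same clause was an edge out of that
      -- literal into `(x , not b)`, so it is absent: otherwise `(x , not b)` would be explored,
      -- against `x` being active with sign `b`.
      tested′ w c w-in x≢w | inj₂ (inj₂ (inj₂ (c′ , eq))) with c 𝔹ₚ.≟ c′
      ... | yes refl = inj₂ (inj₁ (explored⁺ (inj₂ eq)))
      ... | no c≢c′ with closed w c′ eq x (not b) (λ x-out → case (trans (sym x-out) x-active)) (λ eq′ → x≢w (sym eq′))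
      ...   | inj₁ abs = inj₁ (trans (symm (x , not b) (w , c)) (subst (λ z → σ (w , z) (x , not b) ≡ absent) (trans (cong not (sym (≢⇒not≡ c≢c′))) (𝔹ₚ.not-involutive c)) abs))
      ...   | inj₂ (inj₁ eq′) = contradiction (active-injective (trans (sym eq′) x-active)) (not≢ b)
      ...   | inj₂ (inj₂ eq′) with () ← trans (sym eq′) x-active

    -- Only the edge to the negation of an active literal is tested. An edge to the active literal
    -- itself leads nowhere new and stays unrevealed, hence one factor `q` per waiting literal and
    -- not two.
    test-active : ∀ {x b σ s a c R V A W} → Midway x b σ s ((a , c) ∷ R) V A W → Midway x b (update σ (x , not b) (a , not c) absent) s R V A W
    test-active {x} {b} {σ} {s} {a} {c} {R} {V} {A} {W} mid = record
      { core = core-update (a , not c) absent core current unk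
      ; current = current
      ; closed = λ v b′ v≢x eq → closed-update u (a , not c) absent v b′ (Core.symm core) unk (closed v b′ v≢x eq)
      ; tested = tested′
      ; V-unknown = λ w c′ w∈ → trans (update-miss σ u (a , not c) absent (not-joins w c′ λ { refl → case (trans (sym (V-sound w w∈)) (R-sound a c (here refl))) })) (V-unknown w c′ w∈)
      ; R-unknown = λ w c′ wc∈ → trans (update-miss σ u (a , not c) absent (λ j → R-fresh w c′ wc∈ (joins-snd w (not c′) (x≢ w c′ (there wc∈)) j))) (R-unknown w c′ (there wc∈))
      ; R-sound = λ v c′ vc∈ → R-sound v c′ (there vc∈)
      ; R-unique = tail R-unique
      ; A-sound = A-sound ; A-compl = A-compl ; A-unique = A-unique ; V-sound = V-sound ; W-sound = W-sound
      ; VW-compl = VW-compl ; V-unique = V-unique ; W-unique = W-unique ; VW-disj = VW-disj }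
      where
      open Midway mid
      u : Literal n
      u = x , not b
      case : ∀ {c} {X : Set} → fresh ≡ active c → X
      case ()
      tail : ∀ {y ys} → Unique {A = Literal n} (y ∷ ys) → Unique ys
      tail (_ ∷ un) = un
      unk : σ u (a , not c) ≡ unknown
      unk = R-unknown a c (here refl)
      x≢ : ∀ w c′ → (w , c′) ∈ (a , c) ∷ R → x ≢ w
      x≢ w c′ wc∈ refl with () ← trans (sym current) (R-sound w c′ wc∈)
      joins-snd : ∀ w c′ → x ≢ w → Joins (u , (w , c′)) u (a , not c) → (w , c′) ≡ (a , not c)
      joins-snd w c′ x≢w (inj₁ (_ , eq)) = eq
      joins-snd w c′ x≢w (inj₂ (_ , eq)) = contradiction (sym (cong proj₁ eq)) x≢w
      not-joins : ∀ w c′ → w ≢ a → ¬ Joins (u , (w , c′)) u (a , not c)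
      not-joins w c′ w≢a (inj₁ (_ , refl)) = w≢a refl
      not-joins w c′ w≢a (inj₂ (eq , _)) = x≢ a c (here refl) (cong proj₁ eq)
      R-fresh : ∀ w c′ → (w , c′) ∈ R → (w , not c′) ≢ (a , not c)
      R-fresh w c′ wc∈ eq with R-unique
      ... | a∉ ∷ _ = All.lookup a∉ wc∈ (sym (trans (sym (neg-neg (w , c′))) (trans (cong neg eq) (neg-neg (a , c)))))
      tested′ : ∀ w c′ → s w ≢ out → x ≢ w → update σ u (a , not c) absent u (w , c′) ≡ absent ⊎ Explored s (w , c′) ⊎ w ∈ V ⊎ (w , not c′) ∈ R
      tested′ w c′ w-in x≢w with tested w c′ w-in x≢w
      ... | inj₁ abs = inj₁ (trans (update-persist σ u (a , not c) absent (Core.symm core) unk λ eq → contradiction (trans (sym abs) eq) λ ()) abs)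
      ... | inj₂ (inj₁ expl) = inj₂ (inj₁ expl)
      ... | inj₂ (inj₂ (inj₁ w∈)) = inj₂ (inj₂ (inj₁ w∈))
      ... | inj₂ (inj₂ (inj₂ (there wc∈))) = inj₂ (inj₂ (inj₂ wc∈))
      ... | inj₂ (inj₂ (inj₂ (here refl))) = inj₁ (update-hit σ u (a , not (not c′)) absent (inj₁ (refl , cong (w ,_) (sym (𝔹ₚ.not-involutive c′)))))

    module Test {x b σ s v V A W} (mid : Midway x b σ s [] (v ∷ V) A W) (t₁ t₂ : Status) where
      open Midway mid
      open Core core using (symm)

      u : Literal n
      u = x , not b

      σ′ σ″ : Knowledge n
      σ′ = update σ u (v , true) t₁
      σ″ = update σ′ u (v , false) t₂

      v-fresh : s v ≡ fresh
      v-fresh = V-sound v (here refl)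

      x≢v : x ≢ v
      x≢v refl with () ← trans (sym current) v-fresh

      unk₁ : σ u (v , true) ≡ unknown
      unk₁ = V-unknown v true (here refl)

      not-joins : ∀ w c c′ → (w , c) ≢ (v , c′) → ¬ Joins (u , (w , c)) u (v , c′)
      not-joins w c c′ ≢ (inj₁ (_ , eq)) = ≢ eq
      not-joins w c c′ ≢ (inj₂ (eq , _)) = x≢v (cong proj₁ eq)

      unk₂ : σ′ u (v , false) ≡ unknown
      unk₂ = trans (update-miss σ u (v , true) t₁ (not-joins v false true λ ())) (V-unknown v false (here refl))

      core′ : Core σ′ s
      core′ = core-update (v , true) t₁ core current unk₁

      core″ : Core σ″ s
      core″ = core-update (v , false) t₂ core′ current unk₂

      at-true : σ″ u (v , true) ≡ t₁
      at-true = trans (update-miss σ′ u (v , false) t₂ (not-joins v true false λ ())) (update-hit σ u (v , true) t₁ (inj₁ (refl , refl)))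

      at-false : σ″ u (v , false) ≡ t₂
      at-false = update-hit σ′ u (v , false) t₂ (inj₁ (refl , refl))

      elsewhere : ∀ w c → w ≢ v → σ″ u (w , c) ≡ σ u (w , c)
      elsewhere w c w≢v = trans (update-miss σ′ u (v , false) t₂ (not-joins w c false λ { refl → w≢v refl }))
        (update-miss σ u (v , true) t₁ (not-joins w c true λ { refl → w≢v refl }))

      closed″ : ∀ w b′ → w ≢ x → s w ≡ done b′ → Closed σ″ s w b′
      closed″ w b′ w≢x eq = closed-update u (v , false) t₂ w b′ (Core.symm core′) unk₂ (closed-update u (v , true) t₁ w b′ symm unk₁ (closed w b′ w≢x eq))

      v∉ : ∀ {w} → w ∈ V → w ≢ v
      v∉ w∈ refl with V-unique
      ... | v∉V ∷ _ = All.lookup v∉V w∈ refl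

      V-tail : Unique V
      V-tail with V-unique
      ... | _ ∷ un = un

      tested-elsewhere : ∀ w c → w ≢ v → s w ≢ out → x ≢ w → σ″ u (w , c) ≡ absent ⊎ Explored s (w , c) ⊎ w ∈ V ⊎ (w , not c) ∈ []
      tested-elsewhere w c w≢v w-in x≢w with tested w c w-in x≢w
      ... | inj₁ abs = inj₁ (trans (elsewhere w c w≢v) abs)
      ... | inj₂ (inj₁ expl) = inj₂ (inj₁ expl)
      ... | inj₂ (inj₂ (inj₁ (here eq))) = contradiction eq w≢v
      ... | inj₂ (inj₂ (inj₁ (there w∈))) = inj₂ (inj₂ (inj₁ w∈))

      not-hit : t₁ ≡ absent → t₂ ≡ absent → Midway x b σ″ s [] V A (v ∷ W)
      not-hit t₁-abs t₂-abs = record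
        { core = core″
        ; current = current
        ; closed = closed″
        ; tested = tested′
        ; V-unknown = λ w c w∈ → trans (elsewhere w c (v∉ w∈)) (V-unknown w c (there w∈))
        ; R-unknown = λ w c ()
        ; R-sound = λ w c ()
        ; R-unique = []
        ; A-sound = A-sound ; A-compl = A-compl ; A-unique = A-unique
        ; V-sound = λ w w∈ → V-sound w (there w∈)
        ; W-sound = λ { w (here refl) → v-fresh ; w (there w∈) → W-sound w w∈ }
        ; VW-compl = compl
        ; V-unique = V-tail
        ; W-unique = All.tabulate (λ w∈ eq → VW-disj v (here refl) (subst (_∈ W) (sym eq) w∈)) ∷ W-unique
        ; VW-disj = λ { w w∈ (here refl) → v∉ w∈ refl ; w w∈ (there w∈′) → VW-disj w (there w∈) w∈′ } }
        where
        compl : ∀ w → s w ≡ fresh → w ∈ V ⊎ w ∈ (v ∷ W)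
        compl w eq with VW-compl w eq
        ... | inj₁ (here eq′) = inj₂ (here eq′)
        ... | inj₁ (there w∈) = inj₁ w∈
        ... | inj₂ w∈ = inj₂ (there w∈)
        tested′ : ∀ w c → s w ≢ out → x ≢ w → σ″ u (w , c) ≡ absent ⊎ Explored s (w , c) ⊎ w ∈ V ⊎ (w , not c) ∈ []
        tested′ w c w-in x≢w = cases (w Fin.≟ v)
          where
          at-v : ∀ c → σ″ u (v , c) ≡ absent
          at-v true = trans at-true t₁-abs
          at-v false = trans at-false t₂-abs
          cases : Dec (w ≡ v) → σ″ u (w , c) ≡ absent ⊎ Explored s (w , c) ⊎ w ∈ V ⊎ (w , not c) ∈ []
          cases (yes w≡v) = inj₁ (subst (λ z → σ″ u (z , c) ≡ absent) (sym w≡v) (at-v c))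
          cases (no w≢v) = tested-elsewhere w c w≢v w-in x≢w

      hit : ∀ c → σ″ u (v , c) ≡ present → σ″ u (v , not c) ≡ absent → Midway x b σ″ (s [ v ↦ active c ]) [] V ((v , c) ∷ A) W
      hit c pre abs = record
        { core = record
            { symm = Core.symm core″
            ; root = explored⁺ (Core.root core″)
            ; open-unknown = λ l l′ o o′ → Core.open-unknown core″ l l′ (open⁻ o) (open⁻ o′)
            ; reached = reached′
            ; untouched = λ l l′ o o′ → Core.untouched core″ l l′ (untouched⁻ o) (untouched⁻ o′)
            ; out⇒ = λ w eq → Core.out⇒ core″ w (back w eq λ ())
            ; ⇒out = λ w o → forth (λ ()) (Core.⇒out core″ w o) }
        ; current = trans (miss x≢v) current
        ; closed = λ w b′ w≢x eq w′ c′ w′-in w≢w′ → Sum.map₂ explored⁺ (closed″ w b′ w≢x (back w eq λ ()) w′ c′ (λ eq′ → w′-in (forth (λ ()) eq′)) w≢w′)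
        ; tested = tested′
        ; V-unknown = λ w c′ w∈ → trans (elsewhere w c′ (v∉ w∈)) (V-unknown w c′ (there w∈))
        ; R-unknown = λ w c ()
        ; R-sound = λ w c ()
        ; R-unique = []
        ; A-sound = λ { w c′ (here refl) → set-hit s v (active c) ; w c′ (there w∈) → forth (λ ()) (A-sound w c′ w∈) }
        ; A-compl = A-compl′
        ; A-unique = All.tabulate (λ w∈ eq → contradiction (trans (sym v-fresh) (A-sound v c (subst (_∈ A) (sym eq) w∈))) λ ()) ∷ A-unique
        ; V-sound = λ w w∈ → trans (miss (v∉ w∈)) (V-sound w (there w∈))
        ; W-sound = λ w w∈ → trans (miss λ { refl → VW-disj v (here refl) w∈ }) (W-sound w w∈)
        ; VW-compl = compl
        ; V-unique = V-tail
        ; W-unique = W-unique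
        ; VW-disj = λ w w∈ → VW-disj w (there w∈) }
        where
        s′ : Phases
        s′ = s [ v ↦ active c ]
        miss : ∀ {w} → w ≢ v → s′ w ≡ s w
        miss = set-miss s v (active c)
        back : ∀ w {ph} → s′ w ≡ ph → active c ≢ ph → s w ≡ ph
        back w eq ≢ with w Fin.≟ v
        ... | yes refl = contradiction eq ≢
        ... | no w≢v = eq
        forth : ∀ {w ph} → ph ≢ fresh → s w ≡ ph → s′ w ≡ ph
        forth {w} ≢fresh eq = trans (miss λ { refl → ≢fresh (trans (sym eq) v-fresh) }) eq
        explored⁺ : ∀ {l} → Explored s l → Explored s′ l
        explored⁺ (inj₁ eq) = inj₁ (forth (λ ()) eq)
        explored⁺ (inj₂ eq) = inj₂ (forth (λ ()) eq)
        at-v : ∀ {w} → w ≡ v → s′ w ≡ active c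
        at-v refl = set-hit s v (active c)
        open⁻ : ∀ {l} → Open s′ l → Open s l
        open⁻ {w , _} (inj₁ eq) = inj₁ (back w eq λ ())
        open⁻ {w , d} (inj₂ eq) with w Fin.≟ v
        ... | yes refl = inj₁ v-fresh
        ... | no w≢v = inj₂ eq
        untouched⁻ : ∀ {w} → Untouched s′ w → Untouched s w
        untouched⁻ (inj₁ eq) = inj₁ (back _ eq λ ())
        untouched⁻ (inj₂ eq) = inj₂ (back _ eq λ ())
        reached′ : ∀ l → Explored s′ l → Star (PresentEdge σ″) r l
        reached′ (w , d) (inj₂ eq) = Core.reached core″ (w , d) (inj₂ (back w eq λ ()))
        reached′ (w , d) (inj₁ eq) with w Fin.≟ v
        ... | no w≢v = Core.reached core″ (w , d) (inj₁ eq)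
        ... | yes refl with refl ← eq = Core.reached core″ (x , b) (inj₂ current) ◅◅ ((x≢v , pre) ◅ nil)
        A-compl′ : ∀ w d → s′ w ≡ active d → (w , d) ∈ (v , c) ∷ A
        A-compl′ w d eq with w Fin.≟ v
        ... | no w≢v = there (A-compl w d eq)
        ... | yes refl with refl ← eq = here refl
        compl : ∀ w → s′ w ≡ fresh → w ∈ V ⊎ w ∈ W
        compl w eq with VW-compl w (back w eq λ ())
        ... | inj₁ (here refl) = contradiction (trans (sym (set-hit s v (active c))) eq) λ ()
        ... | inj₁ (there w∈) = inj₁ w∈
        ... | inj₂ w∈ = inj₂ w∈
        tested′ : ∀ w d → s′ w ≢ out → x ≢ w → σ″ u (w , d) ≡ absent ⊎ Explored s′ (w , d) ⊎ w ∈ V ⊎ (w , not d) ∈ []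
        tested′ w d w-in x≢w = cases (w Fin.≟ v)
          where
          cases : Dec (w ≡ v) → σ″ u (w , d) ≡ absent ⊎ Explored s′ (w , d) ⊎ w ∈ V ⊎ (w , not d) ∈ []
          cases (no w≢v) = Sum.map₂ (Sum.map₁ explored⁺) (tested-elsewhere w d w≢v (λ eq → w-in (forth (λ ()) eq)) x≢w)
          cases (yes w≡v) with d 𝔹ₚ.≟ c
          ... | yes refl = inj₂ (inj₁ (inj₁ (at-v w≡v)))
          ... | no d≢c = inj₁ (subst₂ (λ y z → σ″ u (y , z) ≡ absent) (sym w≡v) (sym (trans (sym (𝔹ₚ.not-involutive d)) (cong not (≢⇒not≡ d≢c)))) abs)

    finish-processing : ∀ {x b σ s A W} → Midway x b σ s [] [] A W → State σ s A W
    finish-processing {x} {b} {σ} {s} {A} {W} mid = record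
      { core = core
      ; closed = closed′
      ; A-sound = A-sound ; A-compl = A-compl ; A-unique = A-unique
      ; U-sound = W-sound
      ; U-compl = λ v eq → compl (VW-compl v eq)
      ; U-unique = W-unique }
      where
      open Midway mid
      compl : ∀ {v} → v ∈ [] ⊎ v ∈ W → v ∈ W
      compl (inj₂ v∈) = v∈
      closed′ : ∀ v b′ → s v ≡ done b′ → Closed σ s v b′
      closed′ v b′ eq with v Fin.≟ x
      ... | no v≢x = closed v b′ v≢x eq
      ... | yes refl with refl ← trans (sym eq) current = λ w c w-in x≢w → last (tested w c w-in x≢w)
        where
        last : ∀ {w c} → σ (x , not b) (w , c) ≡ absent ⊎ Explored s (w , c) ⊎ w ∈ [] ⊎ (w , not c) ∈ [] → σ (x , not b) (w , c) ≡ absent ⊎ Explored s (w , c)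
        last (inj₁ abs) = inj₁ abs
        last (inj₂ (inj₁ expl)) = inj₂ expl
        last (inj₂ (inj₂ (inj₁ ())))
        last (inj₂ (inj₂ (inj₂ ())))

    -- Contradictory runs enter only through an upper bound 0. The payoff may therefore be a product
    -- of misses, or the negative of a miss, for which the result is a lower bound on the
    -- probability of a miss.
    module Bound (p : ℚ) (0≤p : 0ℚ ≤ p) (0≤q : 0ℚ ≤ 1ℚ - p) (f : Formula n → ℚ) (φ : ℕ → ℚ)
      (dead : ∀ σ → Symmetric σ → Star (PresentEdge σ) r (neg r) → ExpectGiven p σ (allClauses n) f ≤ 0ℚ)
      (stop : ∀ σ s U → State σ s [] U → ExpectGiven p σ (allClauses n) f ≤ φ (length U)) where
      open Chain p 0≤p 0≤q using (q; Bin-cong)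

      private
        E : Knowledge n → ℚ
        E σ = ExpectGiven p σ (allClauses n) f

        reveal-≤ : ∀ {σ X Y} u v → StrictlyDistinct u v → Symmetric σ → σ u v ≡ unknown → E (update σ u v present) ≤ X → E (update σ u v absent) ≤ Y → E σ ≤ p * X + q * Y
        reveal-≤ {σ} u v u≢v sym-σ unk le₁ le₂ = ≤-trans
          (≤-reflexive (reveal p σ u v (allClauses-once u v u≢v) unk (trans (sym-σ v u) unk) f))
          (+-mono-≤ (*-monoʳ 0≤p le₁) (*-monoʳ 0≤q le₂))

        test-actives : ∀ {x b σ s V A W B} R → (∀ σ → Midway x b σ s [] V A W → E σ ≤ B) → Midway x b σ s R V A W → E σ ≤ q ^ℚ length R * B
        test-actives {σ = σ} {B = B} [] cont mid = ≤-trans (cont σ mid) (≤-reflexive (sym (*-identityˡ B)))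
        test-actives {x} {b} {σ} {s} {V} {A} {W} {B} ((a , c) ∷ R) cont mid = ≤-trans
          (reveal-≤ (x , not b) (a , not c) x≢a (Core.symm core) unk
            (dead _ (Core.symm core₊) (contradictory _ (Core.symm core₊) (Core.reached core₊ (a , c) (inj₁ (R-sound a c (here refl))))
              (Core.reached core₊ (x , b) (inj₂ current) ◅◅ ((x≢a , update-hit σ (x , not b) (a , not c) present (inj₁ (refl , refl))) ◅ nil))))
            (test-actives R cont (test-active mid)))
          (≤-reflexive (ring p (q ^ℚ length R) B))
          where
          open Midway mid
          x≢a : x ≢ a
          x≢a refl with () ← trans (sym current) (R-sound a c (here refl))
          unk : σ (x , not b) (a , not c) ≡ unknown
          unk = R-unknown a c (here refl)
          core₊ : Core (update σ (x , not b) (a , not c) present) s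
          core₊ = core-update (a , not c) present core current unk
          ring : ∀ p y B → p * 0ℚ + (1ℚ - p) * (y * B) ≡ (1ℚ - p) * y * B
          ring = solve-∀ ringℚ

        -- `Bin` is unrolled one variable at a time. Variables already tested are counted by the
        -- lengths of `A` and `W`, which appear as shifts in the arguments of `G`.
        test-variables : ∀ {x b} fuel (G : ℕ → ℕ → ℚ) → (∀ σ s A W → Midway x b σ s [] [] A W → length W ℕ.+ length A ≡ fuel → E σ ≤ G (length A) (length W)) →
          ∀ V {σ s A W} → Midway x b σ s [] V A W → length W ℕ.+ (length V ℕ.+ length A) ≡ fuel →
          E σ ≤ Bin p (length V) (λ k m → G (length A ℕ.+ k) (length W ℕ.+ m))
        test-variables fuel G cont [] {σ} {s} {A} {W} mid eq = ≤-trans (cont σ s A W mid eq)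
          (≤-reflexive (cong₂ G (sym (ℕₚ.+-identityʳ (length A))) (sym (ℕₚ.+-identityʳ (length W)))))
        test-variables {x} {b} fuel G cont (v ∷ V) {σ} {s} {A} {W} mid eq = ≤-trans
          (reveal-≤ u (v , true) x≢v (Core.symm core) (V-unknown v true (here refl))
            (reveal-≤ u (v , false) x≢v (Core.symm (Test.core′ mid present present)) (Test.unk₂ mid present present)
              (dead _ (Core.symm (Test.core″ mid present present)) both-present)
              (recur-hit true (Test.hit mid present absent true (Test.at-true mid present absent) (Test.at-false mid present absent))))
            (reveal-≤ u (v , false) x≢v (Core.symm (Test.core′ mid absent absent)) (Test.unk₂ mid absent absent)
              (recur-hit false (Test.hit mid absent present false (Test.at-false mid absent present) (Test.at-true mid absent present)))
              recur-miss))
          (≤-reflexive (ring p H N))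
          where
          open Midway mid
          u : Literal n
          u = x , not b
          x≢v : x ≢ v
          x≢v = Test.x≢v mid present present
          H N : ℚ
          H = Bin p (length V) (λ k m → G (length A ℕ.+ suc k) (length W ℕ.+ m))
          N = Bin p (length V) (λ k m → G (length A ℕ.+ k) (length W ℕ.+ suc m))
          both-present : Star (PresentEdge (Test.σ″ mid present present)) r (neg r)
          both-present = contradictory _ (Core.symm core″) {l = v , true}
            (Core.reached core″ (x , b) (inj₂ current) ◅◅ ((x≢v , Test.at-true mid present present) ◅ nil))
            (Core.reached core″ (x , b) (inj₂ current) ◅◅ ((x≢v , Test.at-false mid present present) ◅ nil))
            where
            core″ : Core (Test.σ″ mid present present) s
            core″ = Test.core″ mid present present
          recur-hit : ∀ {σ′ s′} c → Midway x b σ′ s′ [] V ((v , c) ∷ A) W → E σ′ ≤ H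
          recur-hit c mid′ = ≤-trans
            (test-variables fuel G cont V mid′ (trans (cong (length W ℕ.+_) (ℕₚ.+-suc (length V) (length A))) eq))
            (≤-reflexive (Bin-cong (length V) λ k m _ → cong (λ z → G z (length W ℕ.+ m)) (sym (ℕₚ.+-suc (length A) k))))
          recur-miss : E (Test.σ″ mid absent absent) ≤ N
          recur-miss = ≤-trans
            (test-variables fuel G cont V (Test.not-hit mid absent absent refl refl) (trans (sym (ℕₚ.+-suc (length W) (length V ℕ.+ length A))) eq))
            (≤-reflexive (Bin-cong (length V) λ k m _ → cong (G (length A ℕ.+ k)) (sym (ℕₚ.+-suc (length W) m))))
          ring : ∀ p H N → p * (p * 0ℚ + (1ℚ - p) * H) + (1ℚ - p) * (p * H + (1ℚ - p) * N) ≡ (1ℚ - p) * (1ℚ - p) * N + # 2 * p * (1ℚ - p) * H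
          ring = solve-∀ ringℚ

      explore : ∀ fuel i {σ s A U} → State σ s A U → length U ℕ.+ length A ≡ fuel → E σ ≤ K p (λ _ m → φ m) fuel i (length U) (length A)
      explore fuel i {σ} {s} {[]} {U} st eq = stop σ s U st
      explore zero i {A = u ∷ A} {U} st eq with () ← trans (sym (ℕₚ.+-suc (length U) (length A))) eq
      explore (suc fuel) i {A = (x , b) ∷ A} {U} st eq = test-actives A
        (λ σ mid → test-variables fuel (λ a w → K p (λ _ m → φ m) fuel (suc i) w a)
          (λ σ s A W mid → explore fuel (suc i) (finish-processing mid))
          U mid (ℕₚ.suc-injective (trans (sym (ℕₚ.+-suc (length U) (length A))) eq)))
        (begin-processing st)

-- From knowledge to formulas, and initial states

module _ {n : ℕ} where

  present-edge⇒edge : ∀ {σ : Knowledge n} {F a b} → Symmetric σ → Consistent σ (allClauses n) F → PresentEdge σ a b → Edge F a b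
  present-edge⇒edge {σ} {F} {a} {b} sym-σ con (a≢b , pre) with joins-∈-allClauses (neg a) b a≢b
  ... | c , c∈ , j = lose (present-∈ con c∈ (trans (at j) pre)) j
    where
    at : Joins c (neg a) b → σ (proj₁ c) (proj₂ c) ≡ σ (neg a) b
    at (inj₁ (refl , refl)) = refl
    at (inj₂ (refl , refl)) = sym-σ b (neg a)

  present-path⇒reach : ∀ {σ : Knowledge n} {F a b} → Symmetric σ → Consistent σ (allClauses n) F → Star (PresentEdge σ) a b → Reach F a b
  present-path⇒reach sym-σ con nil = nil
  present-path⇒reach sym-σ con (e ◅ es) = present-edge⇒edge sym-σ con e ◅ present-path⇒reach sym-σ con es

  edge⇒not-absent : ∀ {σ : Knowledge n} {F a b} → Symmetric σ → Consistent σ (allClauses n) F → Edge F a b → StrictlyDistinct a b × σ (neg a) b ≢ absent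
  edge⇒not-absent {σ} {F} {a} {b} sym-σ con e with find e
  ... | c , c∈F , j with consistent-∈ con c∈F
  ...   | c∈ , ¬abs = distinct j , λ abs → ¬abs (trans (at j) abs)
    where
    at : Joins c (neg a) b → σ (proj₁ c) (proj₂ c) ≡ σ (neg a) b
    at (inj₁ (refl , refl)) = refl
    at (inj₂ (refl , refl)) = sym-σ b (neg a)
    distinct : Joins c (neg a) b → StrictlyDistinct a b
    distinct (inj₁ (refl , refl)) eq = ℕₚ.<-irrefl (cong toℕ eq) (allClauses-ordered c∈)
    distinct (inj₂ (refl , refl)) eq = ℕₚ.<-irrefl (cong toℕ (sym eq)) (allClauses-ordered c∈)

  module Start (σ₀ : Knowledge n) (sym-σ₀ : Symmetric σ₀) (x : Fin n) (b : Bool) (U : List (Fin n)) (U-unique : Unique U) (x∉U : ¬ x ∈ U)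
    (all-unknown : ∀ l l′ → (proj₁ l ≡ x ⊎ proj₁ l ∈ U) → (proj₁ l′ ≡ x ⊎ proj₁ l′ ∈ U) → StrictlyDistinct l l′ → σ₀ l l′ ≡ unknown) where

    Outside : Fin n → Set
    Outside v = v ≢ x × ¬ v ∈ U

    open Exploration σ₀ (x , b) Outside

    s₀ : Phases
    s₀ v = if does (v Fin.≟ x) then active b else (if does (member? Fin._≟_ v U) then fresh else out)

    data View (v : Fin n) : Set where
      root : v ≡ x → s₀ v ≡ active b → View v
      inside : v ∈ U → s₀ v ≡ fresh → View v
      outside : Outside v → s₀ v ≡ out → View v

    view : ∀ v → View v
    view v with v Fin.≟ x in eq | member? Fin._≟_ v U in eq′
    ... | yes v≡x | _ = root v≡x (cong (λ d → if does d then active b else (if does (member? Fin._≟_ v U) then fresh else out)) eq)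
    ... | no v≢x | yes v∈ = inside v∈ (cong₂ (λ d d′ → if does d then active b else (if does d′ then fresh else out)) eq eq′)
    ... | no v≢x | no v∉ = outside (v≢x , v∉) (cong₂ (λ d d′ → if does d then active b else (if does d′ then fresh else out)) eq eq′)

    fresh⇒∈U : ∀ v → s₀ v ≡ fresh → v ∈ U
    fresh⇒∈U v eq with view v
    ... | root _ eq′ with () ← trans (sym eq) eq′
    ... | inside v∈ _ = v∈
    ... | outside _ eq′ with () ← trans (sym eq) eq′

    ∈U⇒fresh : ∀ v → v ∈ U → s₀ v ≡ fresh
    ∈U⇒fresh v v∈ with view v
    ... | root refl _ = contradiction v∈ x∉U
    ... | inside _ eq = eq
    ... | outside (_ , v∉) _ = contradiction v∈ v∉

    active⇒root : ∀ v c → s₀ v ≡ active c → v ≡ x × c ≡ b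
    active⇒root v c eq with view v
    ... | root v≡x eq′ = v≡x , active-injective (trans (sym eq) eq′)
    ... | inside _ eq′ with () ← trans (sym eq) eq′
    ... | outside _ eq′ with () ← trans (sym eq) eq′

    root-active : s₀ x ≡ active b
    root-active = cong (λ d → if d then active b else (if does (member? Fin._≟_ x U) then fresh else out)) (dec-true (x Fin.≟ x) refl)

    ¬done : ∀ v c → s₀ v ≢ done c
    ¬done v c eq with view v
    ... | root _ eq′ with () ← trans (sym eq) eq′
    ... | inside _ eq′ with () ← trans (sym eq) eq′
    ... | outside _ eq′ with () ← trans (sym eq) eq′

    start : State σ₀ s₀ ((x , b) ∷ []) U
    start = record
      { core = record
          { symm = sym-σ₀
          ; root = inj₁ root-active
          ; open-unknown = λ l l′ o o′ d → all-unknown l l′ (open⇒ o) (open⇒ o′) d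
          ; reached = λ { (v , c) (inj₁ eq) → reached v c (active⇒root v c eq) ; (v , c) (inj₂ eq) → contradiction eq (¬done v c) }
          ; untouched = λ _ _ _ _ → refl
          ; out⇒ = out⇒′
          ; ⇒out = ⇒out′ }
      ; closed = λ v c eq → contradiction eq (¬done v c)
      ; A-sound = λ { v c (here refl) → root-active }
      ; A-compl = λ v c eq → here (cong₂ _,_ (proj₁ (active⇒root v c eq)) (proj₂ (active⇒root v c eq)))
      ; A-unique = [] ∷ []
      ; U-sound = ∈U⇒fresh
      ; U-compl = fresh⇒∈U
      ; U-unique = U-unique }
      where
      open⇒ : ∀ {l} → Open s₀ l → proj₁ l ≡ x ⊎ proj₁ l ∈ U
      open⇒ (inj₁ eq) = inj₂ (fresh⇒∈U _ eq)
      open⇒ {_ , c} (inj₂ eq) = inj₁ (proj₁ (active⇒root _ (not c) eq))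
      reached : ∀ v c → v ≡ x × c ≡ b → Star (PresentEdge σ₀) (x , b) (v , c)
      reached v c (refl , refl) = nil
      out⇒′ : ∀ v → s₀ v ≡ out → Outside v
      out⇒′ v eq with view v
      ... | root _ eq′ with () ← trans (sym eq) eq′
      ... | inside _ eq′ with () ← trans (sym eq) eq′
      ... | outside o _ = o
      ⇒out′ : ∀ v → Outside v → s₀ v ≡ out
      ⇒out′ v (v≢x , v∉) with view v
      ... | root v≡x _ = contradiction v≡x v≢x
      ... | inside v∈ _ = contradiction v∈ v∉
      ... | outside _ eq = eq

  others : Fin n → List (Fin n) → List (Fin n)
  others x = List.filter (λ v → ¬? (v Fin.≟ x))

  length-others : ∀ {x} xs → Unique xs → x ∈ xs → suc (length (others x xs)) ≡ length xs
  length-others {x} (x ∷ xs) (x∉ ∷ un) (here refl) = cong suc (cong length (trans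
    (Listₚ.filter-reject (λ v → ¬? (v Fin.≟ x)) (λ ≢ → ≢ refl))
    (Listₚ.filter-all (λ v → ¬? (v Fin.≟ x)) (All.map (λ x≢v v≡x → x≢v (sym v≡x)) x∉))))
  length-others {x} (v ∷ xs) (v∉ ∷ un) (there x∈) = cong suc (trans
    (cong length (Listₚ.filter-accept (λ v → ¬? (v Fin.≟ x)) (All.lookup v∉ x∈)))
    (length-others xs un x∈))

  others-unique : ∀ {x xs} → Unique xs → Unique (others x xs)
  others-unique {x} = Uniqueₚ.filter⁺ (λ v → ¬? (v Fin.≟ x))

  ∈-others : ∀ {x v xs} → v ∈ xs → v ≢ x → v ∈ others x xs
  ∈-others {x} = ∈-filter⁺ (λ v → ¬? (v Fin.≟ x))

  ∉-others : ∀ {x} xs → ¬ x ∈ others x xs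
  ∉-others {x} xs x∈ = proj₂ (∈-filter⁻ (λ v → ¬? (v Fin.≟ x)) {xs = xs} x∈) refl

-- Expectations over all formulas

Expect-cong : ∀ {n} p cs {f g : Formula n → ℚ} → (∀ F → f F ≡ g F) → Expect p cs f ≡ Expect p cs g
Expect-cong p [] eq = eq []
Expect-cong p (c ∷ cs) eq = cong₂ (λ a b → p * a + (1ℚ - p) * b) (Expect-cong p cs λ F → eq (c ∷ F)) (Expect-cong p cs eq)

Expect-linear : ∀ {n} p cs a b {f g : Formula n → ℚ} → Expect p cs (λ F → a * f F + b * g F) ≡ a * Expect p cs f + b * Expect p cs g
Expect-linear p [] a b = refl
Expect-linear p (c ∷ cs) a b {f} {g} = trans
  (cong₂ (λ u v → p * u + (1ℚ - p) * v) (Expect-linear p cs a b) (Expect-linear p cs a b))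
  (ring p a b (Expect p cs (f ∘ (c ∷_))) (Expect p cs f) (Expect p cs (g ∘ (c ∷_))) (Expect p cs g))
  where
  ring : ∀ p a b f₁ f₀ g₁ g₀ → p * (a * f₁ + b * g₁) + (1ℚ - p) * (a * f₀ + b * g₀) ≡ a * (p * f₁ + (1ℚ - p) * f₀) + b * (p * g₁ + (1ℚ - p) * g₀)
  ring = solve-∀ ringℚ

Expect-const : ∀ {n} p (cs : List (Clause n)) x → Expect p cs (λ _ → x) ≡ x
Expect-const p [] x = refl
Expect-const p (c ∷ cs) x = trans (cong₂ (λ u v → p * u + (1ℚ - p) * v) (Expect-const p cs x) (Expect-const p cs x)) (ring p x)
  where
  ring : ∀ p x → p * x + (1ℚ - p) * x ≡ x
  ring = solve-∀ ringℚ

Expect-mono : ∀ {n} p → 0ℚ ≤ p → 0ℚ ≤ 1ℚ - p → ∀ cs {f g : Formula n → ℚ} → (∀ F → f F ≤ g F) → Expect p cs f ≤ Expect p cs g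
Expect-mono p 0≤p 0≤q [] le = le []
Expect-mono p 0≤p 0≤q (c ∷ cs) le = +-mono-≤ (*-monoʳ 0≤p (Expect-mono p 0≤p 0≤q cs λ F → le (c ∷ F))) (*-monoʳ 0≤q (Expect-mono p 0≤p 0≤q cs le))

-- Monotone in the digraph and not in the list of clauses: this survives putting the same clause in
-- front on both sides, and reachability has it at once.
Increasing : ∀ {n} → (Formula n → ℚ) → Set
Increasing {n} f = ∀ S T → (∀ (x y : Literal n) → Edge S x y → Edge T x y) → f S ≤ f T

increasing-∷ : ∀ {n} {f : Formula n → ℚ} c → Increasing f → Increasing (f ∘ (c ∷_))
increasing-∷ c inc S T sub = inc (c ∷ S) (c ∷ T) λ { x y (here j) → here j ; x y (there e) → there (sub x y e) }

-- The induction step is p (1 - p) (f₁ - f₀) (g₁ - g₀) ≥ 0.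
harris : ∀ {n} p → 0ℚ ≤ p → 0ℚ ≤ 1ℚ - p → ∀ cs {f g : Formula n → ℚ} → Increasing f → Increasing g →
  Expect p cs f * Expect p cs g ≤ Expect p cs (λ F → f F * g F)
harris p 0≤p 0≤q [] inc-f inc-g = ≤-refl
harris p 0≤p 0≤q (c ∷ cs) {f} {g} inc-f inc-g = ≤-trans
  (≤-by (0≤p ⊗ 0≤q ⊗ (diff≥0 (Expect-mono p 0≤p 0≤q cs (step inc-f)) ⊗ diff≥0 (Expect-mono p 0≤p 0≤q cs (step inc-g))))
    (ring p (Expect p cs (f ∘ (c ∷_))) (Expect p cs f) (Expect p cs (g ∘ (c ∷_))) (Expect p cs g)))
  (+-mono-≤ (*-monoʳ 0≤p (harris p 0≤p 0≤q cs (increasing-∷ c inc-f) (increasing-∷ c inc-g))) (*-monoʳ 0≤q (harris p 0≤p 0≤q cs inc-f inc-g)))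
  where
  step : ∀ {h} → Increasing h → ∀ F → h F ≤ h (c ∷ F)
  step inc F = inc F (c ∷ F) λ x y e → there e
  ring : ∀ p f₁ f₀ g₁ g₀ → (p * f₁ + (1ℚ - p) * f₀) * (p * g₁ + (1ℚ - p) * g₀) + p * (1ℚ - p) * ((f₁ - f₀) * (g₁ - g₀)) ≡ p * (f₁ * g₁) + (1ℚ - p) * (f₀ * g₀)
  ring = solve-∀ ringℚ

indicator-mono : ∀ {P Q : Set} (P? : Dec P) (Q? : Dec Q) → (P → Q) → indicator P? ≤ indicator Q?
indicator-mono (yes x) (yes _) _ = ≤-refl
indicator-mono (yes x) (no ¬y) P→Q = contradiction (P→Q x) ¬y
indicator-mono (no _) (yes _) _ = 0≤c 1ℚ
indicator-mono (no _) (no _) _ = ≤-refl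

indicator-× : ∀ {P Q : Set} (P? : Dec P) (Q? : Dec Q) → indicator (P? ×-dec Q?) ≡ indicator P? * indicator Q?
indicator-× (yes _) (yes _) = refl
indicator-× (yes _) (no _) = refl
indicator-× (no _) (yes _) = refl
indicator-× (no _) (no _) = refl

1-indicator≥0 : ∀ {P : Set} (P? : Dec P) → 0ℚ ≤ 1ℚ - indicator P?
1-indicator≥0 (yes _) = 0≤c 0ℚ
1-indicator≥0 (no _) = 0≤c 1ℚ

1-indicator≤1 : ∀ {P : Set} (P? : Dec P) → 1ℚ - indicator P? ≤ 1ℚ
1-indicator≤1 (yes _) = 0≤c 1ℚ
1-indicator≤1 (no _) = ≤-refl

indicator-yes : ∀ {P : Set} (P? : Dec P) → P → 1ℚ - indicator P? ≡ 0ℚ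
indicator-yes (yes _) _ = refl
indicator-yes (no ¬x) x = contradiction x ¬x

indicator-no : ∀ {P : Set} (P? : Dec P) → ¬ P → 1ℚ - indicator P? ≡ 1ℚ
indicator-no (yes x) ¬x = contradiction x ¬x
indicator-no (no _) _ = refl

-- Reachability probabilities and the recursion

module Probability {n₂ : ℕ} (p : ℚ) (0≤p : 0ℚ ≤ p) (0≤q : 0ℚ ≤ 1ℚ - p)
  (dec : (F : Formula (suc (suc n₂))) (u v : Literal (suc (suc n₂))) → Dec (Reach F u v)) where
  open Chain p 0≤p 0≤q

  n : ℕ
  n = suc (suc n₂)

  miss : Literal n → Formula n → ℚ
  miss x F = 1ℚ - indicator (dec F x (neg x))

  miss-probability : Literal n → ℚ
  miss-probability x = Expect p (allClauses n) (miss x)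

  private
    blank : Knowledge n
    blank _ _ = unknown

    blank-symmetric : Symmetric blank
    blank-symmetric _ _ = refl

    blank-unknown : ∀ {P Q : Literal n → Set} l l′ → P l → Q l′ → StrictlyDistinct l l′ → blank l l′ ≡ unknown
    blank-unknown _ _ _ _ _ = refl

  -- The exploration bounds expectations from above, so it is applied to minus the miss: never
  -- positive, and exactly -1 at the end of a run without contradiction, because the done literals
  -- are then closed under all edges.
  ρ≤miss : ∀ x → ρ p (suc n₂) ≤ miss-probability x
  ρ≤miss (x , b) = subst₂ _≤_ (ring (ρ p (suc n₂))) (ring (miss-probability (x , b))) (neg-antimono-≤ bound)
    where
    U : List (Fin n)
    U = others x (List.allFin n)
    |U| : length U ≡ suc n₂
    |U| = ℕₚ.suc-injective (trans (length-others (List.allFin n) (Uniqueₚ.allFin⁺ n) (∈-allFin x)) (Listₚ.length-tabulate {n = n} (λ i → i)))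
    U-unique : Unique U
    U-unique = others-unique {x = x} (Uniqueₚ.allFin⁺ n)
    module S = Start blank blank-symmetric x b U U-unique (∉-others (List.allFin n)) blank-unknown
    open Exploration blank (x , b) S.Outside
    f : Formula n → ℚ
    f F = 0ℚ - miss (x , b) F
    nowhere-out : ∀ {σ s} → Core σ s → ∀ w → s w ≢ out
    nowhere-out core w eq with Core.out⇒ core w eq
    ... | w≢x , w∉U = w∉U (∈-others (∈-allFin w) w≢x)
    -- All variables other than that of `x` start fresh, so none is `out` and `Closed` speaks about
    -- every edge of the formula.
    closed-done : ∀ {σ s V F} → State σ s [] V → Consistent σ (allClauses n) F → ∀ {l l′} → Reach F l l′ → s (proj₁ l) ≡ done (proj₂ l) → s (proj₁ l′) ≡ done (proj₂ l′)
    closed-done st con nil eq = eq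
    closed-done {σ} {s} {V} {F} st con {v , c} (_◅_ {j = w , d} e es) eq with edge⇒not-absent (Core.symm (State.core st)) con e
    ... | v≢w , ¬abs with State.closed st v c eq w d (nowhere-out (State.core st) w) v≢w
    ...   | inj₁ abs = contradiction abs ¬abs
    ...   | inj₂ (inj₂ eq′) = closed-done st con es eq′
    ...   | inj₂ (inj₁ act) with () ← State.A-compl st w d act
    unreachable : ∀ {σ s V F} → State σ s [] V → Consistent σ (allClauses n) F → ¬ Reach F (x , b) (neg (x , b))
    unreachable {σ} {s} st con path = not≢ b (done-injective (trans (sym (closed-done st con {x , b} {neg (x , b)} path done-x)) done-x))
      where
      done-injective : ∀ {c d} → done c ≡ done d → c ≡ d
      done-injective refl = refl
      done-x : s x ≡ done b
      done-x with Core.root (State.core st)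
      ... | inj₂ eq = eq
      ... | inj₁ act with () ← State.A-compl st x b act
    neg-neg-ring : ∀ z → 0ℚ - (0ℚ - z) ≡ z
    neg-neg-ring = solve-∀ ringℚ
    dead : ∀ σ → Symmetric σ → Star (PresentEdge σ) (x , b) (neg (x , b)) → ExpectGiven p σ (allClauses n) f ≤ 0ℚ
    dead σ _ _ = ≤-trans (ExpectGiven-mono p 0≤p 0≤q σ (allClauses n) (λ F _ → diff≥0⁻¹ (≤-trans (1-indicator≥0 (dec F (x , b) (neg (x , b)))) (≤-reflexive (sym (neg-neg-ring (miss (x , b) F)))))))
      (≤-reflexive (ExpectGiven-const p σ (allClauses n) 0ℚ))
    minus-one : ℕ → ℚ
    minus-one _ = 0ℚ - 1ℚ
    stop : ∀ σ s V → State σ s [] V → ExpectGiven p σ (allClauses n) f ≤ minus-one (length V)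
    stop σ s V st = ≤-trans (ExpectGiven-mono p 0≤p 0≤q σ (allClauses n) (λ F con → ≤-reflexive (cong (λ z → 0ℚ - z) (indicator-no (dec F (x , b) (neg (x , b))) (unreachable st con)))))
      (≤-reflexive (ExpectGiven-const p σ (allClauses n) (0ℚ - 1ℚ)))
    module Bd = Bound p 0≤p 0≤q f minus-one dead stop
    bound : - miss-probability (x , b) ≤ - ρ p (suc n₂)
    bound = begin
      - miss-probability (x , b)
        ≡⟨ ring₁ (miss-probability (x , b)) ⟩
      0ℚ * miss-probability (x , b) + (- 1ℚ) * miss-probability (x , b)
        ≡⟨ sym (Expect-linear p (allClauses n) 0ℚ (- 1ℚ)) ⟩
      Expect p (allClauses n) (λ F → 0ℚ * miss (x , b) F + (- 1ℚ) * miss (x , b) F)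
        ≡⟨ Expect-cong p (allClauses n) (λ F → ring₂ (miss (x , b) F)) ⟩
      Expect p (allClauses n) f
        ≡⟨ sym (ExpectGiven-unknown p (allClauses n) f) ⟩
      ExpectGiven p blank (allClauses n) f
        ≤⟨ Bd.explore n 0 S.start (trans (ℕₚ.+-comm (length U) 1) (cong suc |U|)) ⟩
      K p (λ _ _ → 0ℚ - 1ℚ) n 0 (length U) 1
        ≡⟨ cong (λ z → K p (λ _ _ → 0ℚ - 1ℚ) n 0 z 1) |U| ⟩
      K p (λ _ _ → 0ℚ - 1ℚ) n 0 (suc n₂) 1
        ≡⟨ K-const (0ℚ - 1ℚ) n 0 (suc n₂) 1 ⟩
      (0ℚ - 1ℚ) * ρ p (suc n₂)
        ≡⟨ ring₃ (ρ p (suc n₂)) ⟩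
      - ρ p (suc n₂) ∎
      where
      open ≤-Reasoning
      ring₁ : ∀ z → - z ≡ 0ℚ * z + (- 1ℚ) * z
      ring₁ = solve-∀ ringℚ
      ring₂ : ∀ z → 0ℚ * z + (- 1ℚ) * z ≡ 0ℚ - z
      ring₂ = solve-∀ ringℚ
      ring₃ : ∀ z → (0ℚ - 1ℚ) * z ≡ - z
      ring₃ = solve-∀ ringℚ
    ring : ∀ z → - - z ≡ z
    ring = solve-∀ ringℚ

  -- First explore from y without the variable of x; nothing about x and the untouched variables is revealed.
  both-miss≤ : ∀ x y → StrictlyDistinct x y → Expect p (allClauses n) (λ F → miss x F * miss y F) ≤ K p (λ _ m → ρ p m) (suc n₂) 0 n₂ 1
  both-miss≤ (x , a) (y , b) x≢y = begin
    Expect p (allClauses n) f ≡⟨ sym (ExpectGiven-unknown p (allClauses n) f) ⟩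
    ExpectGiven p blank (allClauses n) f ≤⟨ Bd.explore (suc n₂) 0 S.start (trans (ℕₚ.+-comm (length U) 1) (cong suc |U|)) ⟩
    K p (λ _ m → ρ p m) (suc n₂) 0 (length U) 1 ≡⟨ cong (λ z → K p (λ _ m → ρ p m) (suc n₂) 0 z 1) |U| ⟩
    K p (λ _ m → ρ p m) (suc n₂) 0 n₂ 1 ∎
    where
    open ≤-Reasoning
    f : Formula n → ℚ
    f F = miss (x , a) F * miss (y , b) F
    ys U : List (Fin n)
    ys = others y (List.allFin n)
    U = others x ys
    ys-unique : Unique ys
    ys-unique = others-unique {x = y} (Uniqueₚ.allFin⁺ n)
    x∈ys : x ∈ ys
    x∈ys = ∈-others (∈-allFin x) x≢y
    |U| : length U ≡ n₂
    |U| = ℕₚ.suc-injective (ℕₚ.suc-injective (trans (cong suc (length-others ys ys-unique x∈ys)) (trans (length-others (List.allFin n) (Uniqueₚ.allFin⁺ n) (∈-allFin y)) (Listₚ.length-tabulate {n = n} (λ i → i)))))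
    y∉U : ¬ y ∈ U
    y∉U y∈ = ∉-others (List.allFin n) (proj₁ (∈-filter⁻ (λ v → ¬? (v Fin.≟ x)) {xs = ys} y∈))
    U-unique : Unique U
    U-unique = others-unique {x = x} ys-unique
    module S = Start blank blank-symmetric y b U U-unique y∉U blank-unknown
    open Exploration blank (y , b) S.Outside
    miss-zero : ∀ {σ F} z c → Symmetric σ → Consistent σ (allClauses n) F → Star (PresentEdge σ) (z , c) (neg (z , c)) → miss (z , c) F ≡ 0ℚ
    miss-zero {F = F} z c sym-σ con path = indicator-yes (dec F (z , c) (neg (z , c))) (present-path⇒reach sym-σ con path)
    dead-x : ∀ σ → Symmetric σ → Star (PresentEdge σ) (x , a) (neg (x , a)) → ExpectGiven p σ (allClauses n) f ≤ 0ℚ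
    dead-x σ sym-σ path = ≤-trans (ExpectGiven-mono p 0≤p 0≤q σ (allClauses n) λ F con → ≤-reflexive (trans (cong (_* miss (y , b) F) (miss-zero x a sym-σ con path)) (*-zeroˡ (miss (y , b) F))))
      (≤-reflexive (ExpectGiven-const p σ (allClauses n) 0ℚ))
    dead-y : ∀ σ → Symmetric σ → Star (PresentEdge σ) (y , b) (neg (y , b)) → ExpectGiven p σ (allClauses n) f ≤ 0ℚ
    dead-y σ sym-σ path = ≤-trans (ExpectGiven-mono p 0≤p 0≤q σ (allClauses n) λ F con → ≤-reflexive (trans (cong (miss (x , a) F *_) (miss-zero y b sym-σ con path)) (*-zeroʳ (miss (x , a) F))))
      (≤-reflexive (ExpectGiven-const p σ (allClauses n) 0ℚ))
    -- The second exploration starts from the knowledge `σ` left by the first. The variable of `x`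
    -- was `out` and those in `V` are still fresh, so all clauses among them are unknown.
    then-x : ∀ σ s V → State σ s [] V → ExpectGiven p σ (allClauses n) f ≤ ρ p (length V)
    then-x σ s V st = ≤-trans (Bx.explore (suc (length V)) 0 Sx.start (ℕₚ.+-comm (length V) 1))
      (≤-reflexive (trans (K-const 1ℚ (suc (length V)) 0 (length V) 1) (*-identityˡ (ρ p (length V)))))
      where
      open State st renaming (U-unique to V-unique)
      s-x : s x ≡ out
      s-x = Core.⇒out core x (x≢y , ∉-others ys)
      x∉V : ¬ x ∈ V
      x∉V x∈ with () ← trans (sym s-x) (U-sound x x∈)
      quiet : ∀ {v} → v ≡ x ⊎ v ∈ V → Untouched s v
      quiet (inj₁ refl) = inj₂ s-x
      quiet (inj₂ v∈) = inj₁ (U-sound _ v∈)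
      V-unknown : ∀ l l′ → (proj₁ l ≡ x ⊎ proj₁ l ∈ V) → (proj₁ l′ ≡ x ⊎ proj₁ l′ ∈ V) → StrictlyDistinct l l′ → σ l l′ ≡ unknown
      V-unknown l l′ o o′ _ = Core.untouched core l l′ (quiet o) (quiet o′)
      module Sx = Start σ (Core.symm core) x a V V-unique x∉V V-unknown
      one : ℕ → ℚ
      one _ = 1ℚ
      -- Edges from `x` into variables used by the first exploration are never tested; bounding both
      -- misses by 1 makes up for this, and it is why only an inequality results.
      ≤1-at-end : ∀ τ t W → Exploration.State σ (x , a) Sx.Outside τ t [] W → ExpectGiven p τ (allClauses n) f ≤ one (length W)
      ≤1-at-end τ _ _ _ = ≤-trans (ExpectGiven-mono p 0≤p 0≤q τ (allClauses n) λ F _ → ≤-trans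
          (*-mono-≤ (1-indicator≥0 (dec F (x , a) (neg (x , a)))) (1-indicator≤1 (dec F (x , a) (neg (x , a)))) (1-indicator≥0 (dec F (y , b) (neg (y , b)))) (1-indicator≤1 (dec F (y , b) (neg (y , b)))))
          (≤-reflexive (*-identityˡ 1ℚ)))
        (≤-reflexive (ExpectGiven-const p τ (allClauses n) 1ℚ))
      module Bx = Exploration.Bound σ (x , a) Sx.Outside p 0≤p 0≤q f one dead-x ≤1-at-end
    module Bd = Bound p 0≤p 0≤q f (ρ p) dead-y then-x

module Comparison {n₂ : ℕ} (p : ℚ) (0≤p : 0ℚ ≤ p) (0≤q : 0ℚ ≤ 1ℚ - p)
  (dec : (F : Formula (suc (suc n₂))) (u v : Literal (suc (suc n₂))) → Dec (Reach F u v)) where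
  open Probability p 0≤p 0≤q dec
  open Chain p 0≤p 0≤q using (r≥0; r≤1)

  hit : Literal n → Formula n → ℚ
  hit x F = indicator (dec F x (neg x))

  P : Literal n → ℚ
  P x = Expect p (allClauses n) (hit x)

  P₂ : Literal n → Literal n → ℚ
  P₂ x y = Expect p (allClauses n) (λ F → indicator (both (λ F → dec F x (neg x)) (λ F → dec F y (neg y)) F))

  private
    hit-increasing : ∀ x → Increasing (hit x)
    hit-increasing x S T sub = indicator-mono (dec S x (neg x)) (dec T x (neg x)) (Star.map (λ {a} {b} → sub a b))

    P₂-product : ∀ x y → P₂ x y ≡ Expect p (allClauses n) (λ F → hit x F * hit y F)
    P₂-product x y = Expect-cong p (allClauses n) λ F → indicator-× (dec F x (neg x)) (dec F y (neg y))

    miss-P : ∀ x → miss-probability x ≡ 1ℚ - P x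
    miss-P x = trans (Expect-cong p (allClauses n) λ F → ring (hit x F))
      (trans (Expect-linear p (allClauses n) 1ℚ (- 1ℚ) {λ _ → 1ℚ} {hit x})
        (trans (cong (λ z → 1ℚ * z + (- 1ℚ) * P x) (Expect-const p (allClauses n) 1ℚ)) (sym (ring (P x)))))
      where
      ring : ∀ z → 1ℚ - z ≡ 1ℚ * 1ℚ + (- 1ℚ) * z
      ring = solve-∀ ringℚ

    miss-P₂ : ∀ x y → Expect p (allClauses n) (λ F → miss x F * miss y F) ≡ 1ℚ - P x - P y + P₂ x y
    miss-P₂ x y = begin
      Expect p (allClauses n) (λ F → miss x F * miss y F)
        ≡⟨ Expect-cong p (allClauses n) (λ F → ring₁ (hit x F) (hit y F)) ⟩
      Expect p (allClauses n) (λ F → 1ℚ * miss x F + (- 1ℚ) * (1ℚ * hit y F + (- 1ℚ) * (hit x F * hit y F)))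
        ≡⟨ Expect-linear p (allClauses n) 1ℚ (- 1ℚ) {miss x} ⟩
      1ℚ * miss-probability x + (- 1ℚ) * Expect p (allClauses n) (λ F → 1ℚ * hit y F + (- 1ℚ) * (hit x F * hit y F))
        ≡⟨ cong₂ (λ u v → 1ℚ * u + (- 1ℚ) * v) (miss-P x) (trans (Expect-linear p (allClauses n) 1ℚ (- 1ℚ) {hit y} {λ F → hit x F * hit y F}) (cong (λ z → 1ℚ * P y + (- 1ℚ) * z) (sym (P₂-product x y)))) ⟩
      1ℚ * (1ℚ - P x) + (- 1ℚ) * (1ℚ * P y + (- 1ℚ) * P₂ x y)
        ≡⟨ ring₂ (P x) (P y) (P₂ x y) ⟩
      1ℚ - P x - P y + P₂ x y ∎
      where
      open ≡-Reasoning
      ring₁ : ∀ a b → (1ℚ - a) * (1ℚ - b) ≡ 1ℚ * (1ℚ - a) + (- 1ℚ) * (1ℚ * b + (- 1ℚ) * (a * b))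
      ring₁ = solve-∀ ringℚ
      ring₂ : ∀ a b c → 1ℚ * (1ℚ - a) + (- 1ℚ) * (1ℚ * b + (- 1ℚ) * c) ≡ 1ℚ - a - b + c
      ring₂ = solve-∀ ringℚ

  positively-correlated : ∀ x y → P x * P y ≤ P₂ x y
  positively-correlated x y = ≤-trans (harris p 0≤p 0≤q (allClauses n) (hit-increasing x) (hit-increasing y)) (≤-reflexive (sym (P₂-product x y)))

  P≤1-ρ : ∀ x → P x ≤ 1ℚ - ρ p (suc n₂)
  P≤1-ρ x = ≤-by (diff≥0 (≤-trans (ρ≤miss x) (≤-reflexive (miss-P x)))) (ring (P x) (ρ p (suc n₂)))
    where
    ring : ∀ P r → P + (1ℚ - P - r) ≡ 1ℚ - r
    ring = solve-∀ ringℚ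

  P≥0 : ∀ x → 0ℚ ≤ P x
  P≥0 x = ≤-trans (≤-reflexive (sym (Expect-const p (allClauses n) 0ℚ))) (Expect-mono p 0≤p 0≤q (allClauses n) λ F → 0≤indicator (dec F x (neg x)))
    where
    0≤indicator : ∀ {Q : Set} (Q? : Dec Q) → 0ℚ ≤ indicator Q?
    0≤indicator (yes _) = 0≤c 1ℚ
    0≤indicator (no _) = 0≤c 0ℚ

  -- Two events have the same covariance as their complements. For the misses, the upper bound on
  -- the joint event and the lower bounds on the single ones both point in the right direction.
  covariance≤chain : ∀ x y → StrictlyDistinct x y → P₂ x y - P x * P y ≤ K p (λ _ m → ρ p m) (suc n₂) 0 n₂ 1 - ρ p (suc n₂) * ρ p (suc n₂)
  covariance≤chain x y x≢y = ≤-trans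
    (≤-reflexive (trans (ring (P x) (P y) (P₂ x y)) (cong₂ _-_ (sym (miss-P₂ x y)) (cong₂ _*_ (sym (miss-P x)) (sym (miss-P y))))))
    (+-mono-≤ (both-miss≤ x y x≢y) (neg-antimono-≤ (*-mono-≤ (r≥0 (suc (suc n₂)) (suc n₂) 1) (ρ≤miss x) (r≥0 (suc (suc n₂)) (suc n₂) 1) (ρ≤miss y))))
    where
    ring : ∀ a b c → c - a * b ≡ 1ℚ - a - b + c - (1ℚ - a) * (1ℚ - b)
    ring = solve-∀ ringℚ

-- Choice of `δ` and assembly of the two cases

#-inverse : ∀ k → (+ 1 / suc k) * # suc k ≡ 1ℚ
#-inverse k = toℚᵘ-injective (ℚᵘₚ.≃-trans (toℚᵘ-homo-* (+ 1 / suc k) (# suc k))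
  (ℚᵘₚ.≃-trans (ℚᵘₚ.*-cong (toℚᵘ-fromℚᵘ (ℚᵘ.mkℚᵘ (+ 1) k)) (toℚᵘ-fromℚᵘ (ℚᵘ.mkℚᵘ (+ suc k) 0)))
    (ℚᵘ.*≡* (trans (ℤₚ.*-identityʳ (+ 1 ℤ.* + suc k)) (cong (+ 1 ℤ.*_) (cong +_ (sym (ℕₚ.*-identityʳ (suc k)))))))))

inverse : ∀ {x} → 0ℚ < x → Σ ℚ λ y → x * y ≡ 1ℚ
inverse {x} 0<x = ℚ.1/_ x {{pos⇒nonZero x {{positive 0<x}}}} , *-inverseʳ x {{pos⇒nonZero x {{positive 0<x}}}}

module Bounds (n₂ : ℕ) (ε : ℚ) (dec : (F : Formula (suc (suc n₂))) (u v : Literal (suc (suc n₂))) → Dec (Reach F u v))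
  (x y : Literal (suc (suc n₂))) (x≢y : StrictlyDistinct x y) (δ : ℚ) (0<δ : 0ℚ < δ) (δ-small : δ ≤ + 1 / 1024)
  (n-large : 1ℚ ≤ δ * δ * δ * # suc (suc n₂)) where

  n : ℕ
  n = suc (suc n₂)

  p : ℚ
  p = (1ℚ + ε) * (+ 1 / 2) * (+ 1 / n)

  z : ℚ
  z = proj₁ (inverse 0<δ)

  δz : δ * z ≡ 1ℚ
  δz = proj₂ (inverse 0<δ)

  p-n : p * # n ≡ (1ℚ + ε) * ½
  p-n = trans (*-assoc ((1ℚ + ε) * ½) (+ 1 / n) (# n)) (trans (cong ((1ℚ + ε) * ½ *_) (#-inverse (suc n₂))) (*-identityʳ ((1ℚ + ε) * ½)))

  0≤δ : 0ℚ ≤ δ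
  0≤δ = <⇒≤ 0<δ

  1-16δ : 0ℚ ≤ 1ℚ - # 16 * δ
  1-16δ = 1-cδ≥0 (# 16) (#≥0 16) δ-small (0≤c (1ℚ - # 16 * (+ 1 / 1024)))

  1-δ : 0ℚ ≤ 1ℚ - δ
  1-δ = 1-δ≥0 δ-small

  δ³≤1 : δ * δ * δ ≤ 1ℚ
  δ³≤1 = ≤-by (1-δ ⊗ (0≤c 1ℚ ⊕ 0≤δ ⊕ 0≤δ ⊗ 0≤δ)) (ring δ)
    where
    ring : ∀ d → d * d * d + (1ℚ - d) * (1ℚ + d + d * d) ≡ 1ℚ
    ring = solve-∀ ringℚ

  0≤p : 0ℚ ≤ 1ℚ + ε → 0ℚ ≤ p
  0≤p 0≤1+ε = 0≤1+ε ⊗ 0≤c ½ ⊗ 0≤1/n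
    where
    0≤1/n : 0ℚ ≤ + 1 / n
    0≤1/n = nonNegative⁻¹ (+ 1 / n) {{normalize-nonNeg 1 n}}

  -- `1 ≤ δ³ n` is multiplied by `p`, and `p n` is known.
  p≤ : 0ℚ ≤ p → p ≤ δ * δ * δ * ((1ℚ + ε) * ½)
  p≤ 0≤p = ≤-trans (≤-trans (≤-reflexive (sym (*-identityʳ p))) (*-monoʳ 0≤p n-large)) (≤-reflexive (trans (ring p (δ * δ * δ) (# n)) (cong (δ * δ * δ *_) p-n)))
    where
    ring : ∀ p d n → p * (d * n) ≡ d * (p * n)
    ring = solve-∀ ringℚ

  Px Py Pxy : ℚ
  Px = Pr n p (λ F → Reach F x (neg x)) (λ F → dec F x (neg x))
  Py = Pr n p (λ F → Reach F y (neg y)) (λ F → dec F y (neg y))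
  Pxy = Pr n p (λ F → Reach F x (neg x) × Reach F y (neg y)) (both (λ F → dec F x (neg x)) (λ F → dec F y (neg y)))

  module Above (ε≡ : ε ≡ # 16 * δ) where
    0≤p₊ : 0ℚ ≤ p
    0≤p₊ = 0≤p (subst (λ e → 0ℚ ≤ 1ℚ + e) (sym ε≡) (0≤c 1ℚ ⊕ #≥0 16 ⊗ 0≤δ))

    p-n₊ : p * # n ≡ ½ + # 8 * δ
    p-n₊ = trans p-n (trans (cong (λ e → (1ℚ + e) * ½) ε≡) (ring δ))
      where
      ring : ∀ d → (1ℚ + # 16 * d) * ½ ≡ ½ + # 8 * d
      ring = solve-∀ ringℚ

    p≤δ³ : p ≤ δ * δ * δ
    p≤δ³ = ≤-trans (p≤ 0≤p₊) (≤-trans (≤-reflexive (cong (λ e → δ * δ * δ * ((1ℚ + e) * ½)) ε≡)) (≤-by (0≤δ ⊗ 0≤δ ⊗ 0≤δ ⊗ (0≤c ½ ⊗ 1-16δ)) (ring δ)))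
      where
      ring : ∀ d → d * d * d * ((1ℚ + # 16 * d) * ½) + d * d * d * (½ * (1ℚ - # 16 * d)) ≡ d * d * d
      ring = solve-∀ ringℚ

    0≤q₊ : 0ℚ ≤ 1ℚ - p
    0≤q₊ = diff≥0 (≤-trans p≤δ³ δ³≤1)

    open Comparison p 0≤p₊ 0≤q₊ dec using (positively-correlated; covariance≤chain)

    correlated : 0ℚ ≤ Pxy - Px * Py
    correlated = diff≥0 (positively-correlated x y)

    bound : (Pxy - Px * Py) * ε * # n ≤ # 16 * (B₁ * B₀) + # 16 * B₁
    bound = begin
      (Pxy - Px * Py) * ε * # n
        ≡⟨ trans (cong (λ e → (Pxy - Px * Py) * e * # n) ε≡) (*-assoc (Pxy - Px * Py) (# 16 * δ) (# n)) ⟩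
      (Pxy - Px * Py) * (# 16 * δ * # n)
        ≤⟨ *-monoˡ (#≥0 16 ⊗ 0≤δ ⊗ #≥0 n) (≤-trans (covariance≤chain x y x≢y) (covariance-bound z δz n₂ refl)) ⟩
      (B₁ * p * (B₀ * z) + B₁ * p) * (# 16 * δ * # n)
        ≡⟨ trans (ring₁ B₁ p B₀ z δ (# n)) (cong₂ (λ u v → # 16 * (B₁ * B₀) * u * v + # 16 * B₁ * u * δ) p-n₊ δz) ⟩
      # 16 * (B₁ * B₀) * (½ + # 8 * δ) * 1ℚ + # 16 * B₁ * (½ + # 8 * δ) * δ
        ≤⟨ ≤-by (#≥0 16 ⊗ (0≤B₁ ⊗ 0≤B₀) ⊗ (0≤c ½ ⊗ 1-16δ) ⊕ #≥0 16 ⊗ 0≤B₁ ⊗ (0≤c ½ ⊗ 1-16δ ⊕ (0≤c ½ ⊕ #≥0 8 ⊗ 0≤δ) ⊗ 1-δ)) (ring₂ B₁ B₀ δ) ⟩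
      # 16 * (B₁ * B₀) + # 16 * B₁ ∎
      where
      open ≤-Reasoning
      open Supercritical p 0≤p₊ 0≤q₊ n δ 0<δ δ-small p-n₊ p≤δ³ n-large using (covariance-bound)
      0≤B₀ : 0ℚ ≤ B₀
      0≤B₀ = ≤-trans (0≤c 1ℚ) 1≤B₀
      0≤B₁ : 0ℚ ≤ B₁
      0≤B₁ = #≥0 513 ⊗ 0≤B₀
      ring₁ : ∀ B p A z d n → (B * p * (A * z) + B * p) * (# 16 * d * n) ≡ # 16 * (B * A) * (p * n) * (d * z) + # 16 * B * (p * n) * d
      ring₁ = solve-∀ ringℚ
      ring₂ : ∀ B A d → # 16 * (B * A) * (½ + # 8 * d) * 1ℚ + # 16 * B * (½ + # 8 * d) * d +
        (# 16 * (B * A) * (½ * (1ℚ - # 16 * d)) + # 16 * B * (½ * (1ℚ - # 16 * d) + (½ + # 8 * d) * (1ℚ - d))) ≡ # 16 * (B * A) + # 16 * B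
      ring₂ = solve-∀ ringℚ

  module Below (ε≡ : ε ≡ - (# 16 * δ)) where
    0≤p₋ : 0ℚ ≤ p
    0≤p₋ = 0≤p (subst (λ e → 0ℚ ≤ 1ℚ + e) (sym ε≡) 1-16δ)

    p-n₋ : p * # n ≡ ½ - # 8 * δ
    p-n₋ = trans p-n (trans (cong (λ e → (1ℚ + e) * ½) ε≡) (ring δ))
      where
      ring : ∀ d → (1ℚ + - (# 16 * d)) * ½ ≡ ½ - # 8 * d
      ring = solve-∀ ringℚ

    2p≤δ³ : # 2 * p ≤ δ * δ * δ
    2p≤δ³ = ≤-trans (*-monoʳ (#≥0 2) (p≤ 0≤p₋)) (≤-trans (≤-reflexive (cong (λ e → # 2 * (δ * δ * δ * ((1ℚ + e) * ½))) ε≡)) (≤-by (0≤δ ⊗ 0≤δ ⊗ 0≤δ ⊗ (#≥0 16 ⊗ 0≤δ)) (ring δ)))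
      where
      ring : ∀ d → # 2 * (d * d * d * ((1ℚ + - (# 16 * d)) * ½)) + d * d * d * (# 16 * d) ≡ d * d * d
      ring = solve-∀ ringℚ

    0≤q₋ : 0ℚ ≤ 1ℚ - p
    0≤q₋ = ≤-trans (diff≥0 (≤-trans 2p≤δ³ δ³≤1) ⊕ 0≤p₋) (≤-reflexive (ring p))
      where
      ring : ∀ p → 1ℚ - # 2 * p + p ≡ 1ℚ - p
      ring = solve-∀ ringℚ

    open Comparison p 0≤p₋ 0≤q₋ dec using (positively-correlated; covariance≤chain; P≤1-ρ; P≥0)

    correlated : Px * Py ≤ Pxy
    correlated = positively-correlated x y

    bound : Pxy * (ε ^ℚ 4) * # (n ℕ.* n) ≤ # 784 * (# 16 * # 16 * # 16 * # 16)
    bound = begin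
      Pxy * (ε ^ℚ 4) * # (n ℕ.* n)
        ≡⟨ trans (cong₂ (λ e m → Pxy * (e ^ℚ 4) * m) ε≡ (#-* n n)) (*-assoc Pxy ((- (# 16 * δ)) ^ℚ 4) (# n * # n)) ⟩
      Pxy * ((- (# 16 * δ)) ^ℚ 4 * (# n * # n))
        ≤⟨ *-monoˡ (≤-trans ((#≥0 16 ⊗ #≥0 16 ⊗ #≥0 16 ⊗ #≥0 16) ⊗ (0≤δ ⊗ 0≤δ ⊗ 0≤δ ⊗ 0≤δ) ⊗ (#≥0 n ⊗ #≥0 n)) (≤-reflexive (ring₁ (# 16) δ (# n * # n)))) Pxy≤ ⟩
      # 784 * (p * p) * (z * z * z * z) * ((- (# 16 * δ)) ^ℚ 4 * (# n * # n))
        ≡⟨ trans (ring₂ (# 784) (# 16) p z δ (# n)) (cong₂ (λ u v → # 784 * (# 16 * # 16 * # 16 * # 16) * (u * u) * (v * v * v * v)) p-n₋ δz) ⟩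
      # 784 * (# 16 * # 16 * # 16 * # 16) * ((½ - # 8 * δ) * (½ - # 8 * δ)) * (1ℚ * 1ℚ * 1ℚ * 1ℚ)
        ≤⟨ ≤-by (#≥0 784 ⊗ (#≥0 16 ⊗ #≥0 16 ⊗ #≥0 16 ⊗ #≥0 16) ⊗ ((0≤c ½ ⊕ #≥0 8 ⊗ 0≤δ) ⊗ (0≤c 1ℚ ⊕ 0≤c ½ ⊗ 1-16δ))) (ring₃ δ (# 784 * (# 16 * # 16 * # 16 * # 16))) ⟩
      # 784 * (# 16 * # 16 * # 16 * # 16) ∎
      where
      open ≤-Reasoning
      open Subcritical p 0≤p₋ 0≤q₋ n δ 0<δ δ-small p-n₋ 2p≤δ³ z δz using (covariance-bound; ρ-lower)
      -- 780 bounds the covariance, and the product of the two bounds `2 p / δ²` on single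
      -- probabilities adds 4.
      Pxy≤ : Pxy ≤ # 784 * (p * p) * (z * z * z * z)
      Pxy≤ = ≤-trans
        (≤-by (diff≥0 (≤-trans (covariance≤chain x y x≢y) (covariance-bound n₂ refl)) ⊕ diff≥0 (*-mono-≤ (P≥0 x) (P≤ x) (P≥0 y) (P≤ y))) (ring₄ Pxy (Px * Py) (# 780 * (p * p) * (z * z * z * z)) (# 2 * p * (z * z) * (# 2 * p * (z * z)))))
        (≤-reflexive (ring₅ p z))
        where
        P≤ : ∀ u → Expect p (allClauses n) (λ F → indicator (dec F u (neg u))) ≤ # 2 * p * (z * z)
        P≤ u = ≤-trans (P≤1-ρ u) (ρ-lower (suc n₂) (ℕₚ.n≤1+n (suc n₂)))
        ring₄ : ∀ a b c d → a + (c - (a - b) + (d - b)) ≡ c + d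
        ring₄ = solve-∀ ringℚ
        ring₅ : ∀ p z → # 780 * (p * p) * (z * z * z * z) + # 2 * p * (z * z) * (# 2 * p * (z * z)) ≡ # 784 * (p * p) * (z * z * z * z)
        ring₅ = solve-∀ ringℚ
      ring₁ : ∀ k d m → k * k * k * k * (d * d * d * d) * m ≡ - (k * d) * (- (k * d) * (- (k * d) * (- (k * d) * 1ℚ))) * m
      ring₁ = solve-∀ ringℚ
      ring₂ : ∀ c k p z d n → c * (p * p) * (z * z * z * z) * (- (k * d) * (- (k * d) * (- (k * d) * (- (k * d) * 1ℚ))) * (n * n)) ≡
        c * (k * k * k * k) * (p * n * (p * n)) * (d * z * (d * z) * (d * z) * (d * z))
      ring₂ = solve-∀ ringℚ
      ring₃ : ∀ d B → B * ((½ - # 8 * d) * (½ - # 8 * d)) * (1ℚ * 1ℚ * 1ℚ * 1ℚ) + B * ((½ + # 8 * d) * (1ℚ + ½ * (1ℚ - # 16 * d))) ≡ B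
      ring₃ = solve-∀ ringℚ

theorem3p2 :
  Σ ℚ λ λ₀ → Σ ℚ λ ε₀ → Σ ℚ λ C →
    (0ℚ < λ₀) × (0ℚ < ε₀) × (ε₀ < 1ℚ) × (0ℚ ≤ C) ×
    ((n : ℕ) .{{_ : NonZero n}} → (ε : ℚ) →
     (dec : (F : Formula n) (u v : Literal n) → Dec (Reach F u v)) →
     (x y : Literal n) → StrictlyDistinct x y →
     -- λ_n = ε n^(1/3);  λ₀ ≤ |λ_n|  ⇔  λ₀³ ≤ |ε|³ n ;  |λ_n| ≤ ε₀ n^(1/3)  ⇔  |ε| ≤ ε₀
     (λ₀ ^ℚ 3) ≤ (∣ ε ∣ ^ℚ 3) * (+ n / 1) → ∣ ε ∣ ≤ ε₀ →
     let p = (1ℚ + ε) * (+ 1 / 2) * (+ 1 / n)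
         Px = Pr n p (λ F → Reach F x (neg x)) (λ F → dec F x (neg x))
         Py = Pr n p (λ F → Reach F y (neg y)) (λ F → dec F y (neg y))
         Pxy = Pr n p (λ F → Reach F x (neg x) × Reach F y (neg y))
                 (both (λ F → dec F x (neg x)) (λ F → dec F y (neg y)))
     in
     -- (i) ε < 0 : Px Py ≤ Pxy ≤ C n^(-2/3) / λ_n^4 = C / (ε⁴ n²)
     (ε < 0ℚ → (Px * Py ≤ Pxy) × (Pxy * (ε ^ℚ 4) * (+ (n ℕ.* n) / 1) ≤ C)) ×
     -- (ii) ε > 0 : 0 ≤ Pxy - Px Py ≤ C n^(-2/3) / λ_n = C / (ε n)
     (0ℚ < ε → (0ℚ ≤ Pxy - Px * Py) × ((Pxy - Px * Py) * ε * (+ n / 1) ≤ C)))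
theorem3p2 = # 16 , + 1 / 64 , C₊ + C₋ , toWitness {a? = 0ℚ <? # 16} tt , toWitness {a? = 0ℚ <? + 1 / 64} tt , toWitness {a? = + 1 / 64 <? 1ℚ} tt , 0≤C₊ ⊕ 0≤C₋ , main
  where
  C₊ C₋ : ℚ
  C₊ = # 16 * (B₁ * B₀) + # 16 * B₁
  C₋ = # 784 * (# 16 * # 16 * # 16 * # 16)
  0≤B₀ : 0ℚ ≤ B₀
  0≤B₀ = ≤-trans (0≤c 1ℚ) 1≤B₀
  0≤B₁ : 0ℚ ≤ B₁
  0≤B₁ = #≥0 513 ⊗ 0≤B₀
  0≤C₊ : 0ℚ ≤ C₊
  0≤C₊ = #≥0 16 ⊗ (0≤B₁ ⊗ 0≤B₀) ⊕ #≥0 16 ⊗ 0≤B₁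
  0≤C₋ : 0ℚ ≤ C₋
  0≤C₋ = #≥0 784 ⊗ (#≥0 16 ⊗ #≥0 16 ⊗ #≥0 16 ⊗ #≥0 16)
  main : (n : ℕ) .{{_ : NonZero n}} → (ε : ℚ) → (dec : (F : Formula n) (u v : Literal n) → Dec (Reach F u v)) → (x y : Literal n) → StrictlyDistinct x y →
    ((# 16) ^ℚ 3) ≤ (∣ ε ∣ ^ℚ 3) * # n → ∣ ε ∣ ≤ + 1 / 64 →
    let p = (1ℚ + ε) * (+ 1 / 2) * (+ 1 / n)
        Px = Pr n p (λ F → Reach F x (neg x)) (λ F → dec F x (neg x))
        Py = Pr n p (λ F → Reach F y (neg y)) (λ F → dec F y (neg y))
        Pxy = Pr n p (λ F → Reach F x (neg x) × Reach F y (neg y)) (both (λ F → dec F x (neg x)) (λ F → dec F y (neg y)))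
    in
    (ε < 0ℚ → (Px * Py ≤ Pxy) × (Pxy * (ε ^ℚ 4) * # (n ℕ.* n) ≤ C₊ + C₋)) ×
    (0ℚ < ε → (0ℚ ≤ Pxy - Px * Py) × ((Pxy - Px * Py) * ε * # n ≤ C₊ + C₋))
  -- With a single variable there are no strictly distinct literals.
  main (suc zero) ε dec (Fin.zero , _) (Fin.zero , _) x≢y _ _ = contradiction refl x≢y
  main (suc (suc n₂)) ε dec x y x≢y large small =
    (λ ε<0 → let module Bd = Bounds n₂ ε dec x y x≢y δ (0<δ (subst (0ℚ <_) (sym (∣ε∣≡-ε ε<0)) (neg-antimono-< ε<0))) δ-small n-large
                 module Be = Bd.Below (trans (ring₂ ε) (cong (λ e → - (# 16 * ((+ 1 / 16) * e))) (sym (∣ε∣≡-ε ε<0))))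
             in Be.correlated , ≤-trans Be.bound (≤-by 0≤C₊ (+-comm C₋ C₊))) ,
    (λ 0<ε → let module Bd = Bounds n₂ ε dec x y x≢y δ (0<δ (subst (0ℚ <_) (sym (∣ε∣≡ε 0<ε)) 0<ε)) δ-small n-large
                 module Ab = Bd.Above (trans (ring₁ ε) (cong (λ e → # 16 * ((+ 1 / 16) * e)) (sym (∣ε∣≡ε 0<ε))))
             in Ab.correlated , ≤-trans Ab.bound (≤-by 0≤C₋ refl))
    where
    -- In terms of `δ`, the choice `λ₀ = 16` becomes `1 ≤ δ³ n` and `ε₀ = 1/64` becomes
    -- `δ ≤ 1/1024`, which keeps factors such as `1 - 512 δ` nonnegative.
    δ : ℚ
    δ = (+ 1 / 16) * ∣ ε ∣
    0<δ : 0ℚ < ∣ ε ∣ → 0ℚ < δ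
    0<δ 0<∣ε∣ = subst (_< δ) (*-zeroʳ (+ 1 / 16)) (*-monoʳ-<-pos (+ 1 / 16) 0<∣ε∣)
    δ-small : δ ≤ + 1 / 1024
    δ-small = *-monoʳ (0≤c (+ 1 / 16)) small
    n-large : 1ℚ ≤ δ * δ * δ * # suc (suc n₂)
    n-large = ≤-trans (*-monoʳ {(+ 1 / 16) * (+ 1 / 16) * (+ 1 / 16)} (0≤c ((+ 1 / 16) * (+ 1 / 16) * (+ 1 / 16))) large) (≤-reflexive (ring₃ (+ 1 / 16) ∣ ε ∣ (# suc (suc n₂))))
      where
      ring₃ : ∀ k e n → k * k * k * (e * (e * (e * 1ℚ)) * n) ≡ k * e * (k * e) * (k * e) * n
      ring₃ = solve-∀ ringℚ
    ∣ε∣≡ε : 0ℚ < ε → ∣ ε ∣ ≡ ε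
    ∣ε∣≡ε 0<ε = 0≤p⇒∣p∣≡p (<⇒≤ 0<ε)
    ∣ε∣≡-ε : ε < 0ℚ → ∣ ε ∣ ≡ - ε
    ∣ε∣≡-ε ε<0 = trans (sym (∣-p∣≡∣p∣ ε)) (0≤p⇒∣p∣≡p (<⇒≤ (neg-antimono-< ε<0)))
    ring₁ : ∀ e → e ≡ # 16 * ((+ 1 / 16) * e)
    ring₁ = solve-∀ ringℚ
    ring₂ : ∀ e → e ≡ - (# 16 * ((+ 1 / 16) * (- e)))
    ring₂ = solve-∀ ringℚ
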